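{- Let $\mathtt{P}$, $\mathtt{Q}$ be finite $\pi$-calculus processes and $D$ a distinction. If $\mathtt{P}\sim_o^D\mathtt{Q}$ then the formula $\forall\bar x.([\![D]\!]\supset\mathrm{lbisim}\,[\![\mathtt{P}]\!]\,[\![\mathtt{Q}]\!])$ is provable in $FO\lambda^{\Delta\nabla}$ with the definition $\mathbf{D}_\pi$ plus the $\mathrm{lbisim}$ clause, where $\bar x$ are the free names of $\mathtt{P}$, $\mathtt{Q}$ and $D$.
   Context: Finite $\pi$-calculus processes, actions and the late transition relation $\xrightarrow{\alpha}$ are as in Milner–Parrow–Walker. A distinction is a finite symmetric irreflexive relation on names; a name substitution $\theta$ respects $D$ if $(x,y)\in D$ implies $x\theta\neq y\theta$; $D\theta$ is the image. An indexed family $\{\mathcal{S}_D\}_D$ of symmetric relations is an indexed open bisimulation if for every $D$, every $\theta$ respecting $D$ and $\mathtt{P}\mathcal{S}_D\mathtt{Q}$: (1) $\mathtt{P}\theta\xrightarrow{\alpha}\mathtt{P}'$, $\alpha$ free, implies $\mathtt{Q}\theta\xrightarrow{\alpha}\mathtt{Q}'$ with $\mathtt{P}'\mathcal{S}_{D\theta}\mathtt{Q}'$; (2) $\mathtt{P}\theta\xrightarrow{x(z)}\mathtt{P}'$, $z\notin\mathrm{n}(\mathtt{P}\theta,\mathtt{Q}\theta)$, implies $\mathtt{Q}\theta\xrightarrow{x(z)}\mathtt{Q}'$ with $\mathtt{P}'\mathcal{S}_{D\theta}\mathtt{Q}'$; (3) $\mathtt{P}\theta\xrightarrow{\bar x(z)}\mathtt{P}'$,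 $z\notin\mathrm{n}(\mathtt{P}\theta,\mathtt{Q}\theta)$, implies $\mathtt{Q}\theta\xrightarrow{\bar x(z)}\mathtt{Q}'$ with $\mathtt{P}'\mathcal{S}_{D''}\mathtt{Q}'$, $D''=D\theta\cup(\{z\}\times\mathrm{fn}(\mathtt{P}\theta,\mathtt{Q}\theta,D\theta))$ symmetrized. $\mathtt{P}\sim_o^D\mathtt{Q}$ iff $\mathtt{P}\mathcal{S}_D\mathtt{Q}$ for some indexed open bisimulation. For $D=\{(x_1,y_1),\dots,(x_n,y_n)\}$, $[\![D]\!]=x_1\neq y_1\land\dots\land x_n\neq y_n$ ($\top$ if empty). $FO\lambda^{\Delta\nabla}$ (Miller–Tiu): intuitionistic sequent calculus over simply typed $\lambda$-terms with $\top,\bot,\land,\lor,\supset$, $\forall,\exists,\nabla$ ($\nabla$ introduced on both sides by a fresh locally scoped variable), raised eigenvariables, and stratified definitions with defR (unfolding) and defL (case analysis over complete sets of unifiers with clause heads); equality $\forall x[x=x\triangleq\top]$, $s\neq t:=(s=t)\supset\bot$. Encoding (names of type $n$ with no constants): $[\![\cdot]\!]$ maps $0,+,|,\tau.$ to constants, $[x=y]\mathtt{P}\mapsto\mathrm{match}\,x\,y[\![\mathtt{P}]\!]$, $\bar xy.\mathtt{P}\mapsto\mathrm{out}\,x\,y[\![\mathtt{P}]\!]$, $x(y).\mathtt{P}\mapsto\mathrm{in}\,x(\lambda y.[\![\mathtt{P}]\!])$, $(x)\mathtt{P}\mapsto\nu(\lambda x.[\![\mathtt{P}]\!])$; actions $\tau$,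 $\downarrow x\,y$, $\uparrow x\,y$. $\mathbf{D}_\pi$ defines $\mathrm{one}:p\to a\to p\to o$ and $\mathrm{onep}:p\to(n\to a)\to(n\to p)\to o$ by: $\mathrm{one}(\tau P)\tau P\triangleq\top$; $\mathrm{onep}(\mathrm{in}XM)(\downarrow X)M\triangleq\top$; $\mathrm{one}(\mathrm{out}\,x\,y\,P)(\uparrow xy)P\triangleq\top$; match $\mathrm{one}(\mathrm{match}\,x\,x\,P)AQ\triangleq\mathrm{one}PAQ$ (also for onep); sum $\mathrm{one}(P+Q)AR\triangleq\mathrm{one}PAR$, $\triangleq\mathrm{one}QAR$ (also onep); par $\mathrm{one}(P|Q)A(P'|Q)\triangleq\mathrm{one}PAP'$, $\mathrm{one}(P|Q)A(P|Q')\triangleq\mathrm{one}QAQ'$, $\mathrm{onep}(P|Q)A(\lambda n.(Mn|Q))\triangleq\mathrm{onep}PAM$, $\mathrm{onep}(P|Q)A(\lambda n.(P|Nn))\triangleq\mathrm{onep}QAN$; res $\mathrm{one}(\nu\lambda n.Pn)A(\nu\lambda n.Qn)\triangleq\nabla n.\mathrm{one}(Pn)A(Qn)$, $\mathrm{onep}(\nu\lambda n.Pn)A(\lambda m.\nu\lambda n.P'nm)\triangleq\nabla n.\mathrm{onep}(Pn)A(P'n)$; open $\mathrm{onep}(\nu\lambda n.Mn)(\uparrow X)M'\triangleq\nabla n.\mathrm{one}(Mn)(\uparrow Xn)(M'n)$; close $\mathrm{one}(P|Q)\tau(\nu\lambda n.(Mn|Nn))\triangleq\exists X.\mathrm{onep}P(\downarrow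 X)M\land\mathrm{onep}Q(\uparrow X)N$ and with $\uparrow,\downarrow$ swapped; com $\mathrm{one}(P|Q)\tau(MY|Q')\triangleq\exists X.\mathrm{onep}P(\downarrow X)M\land\mathrm{one}Q(\uparrow XY)Q'$, $\mathrm{one}(P|Q)\tau(P'|NY)\triangleq\exists X.\mathrm{one}P(\uparrow XY)P'\land\mathrm{onep}Q(\downarrow X)N$. $\mathrm{lbisim}PQ\triangleq$ the conjunction of $\forall A\forall P'[\mathrm{one}PAP'\supset\exists Q'.\mathrm{one}QAQ'\land\mathrm{lbisim}P'Q']$, $\forall X\forall P'[\mathrm{onep}P(\downarrow X)P'\supset\exists Q'.\mathrm{onep}Q(\downarrow X)Q'\land\forall w.\mathrm{lbisim}(P'w)(Q'w)]$, $\forall X\forall P'[\mathrm{onep}P(\uparrow X)P'\supset\exists Q'.\mathrm{onep}Q(\uparrow X)Q'\land\nabla w.\mathrm{lbisim}(P'w)(Q'w)]$, and the three symmetric conjuncts obtained by swapping the roles of $P$ and $Q$ (with recursive calls $\mathrm{lbisim}Q'P'$, $\mathrm{lbisim}(Q'w)(P'w)$). -}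

module Defs where

open import Data.Nat using (ℕ; zero; suc)
open import Data.Fin using (Fin; zero; suc)
open import Data.List using (List; []; _∷_; _++_; map; concatMap)
open import Data.List.Membership.Propositional using (_∈_; _∉_)
open import Data.List.Relation.Binary.Permutation.Propositional using (_↭_)
open import Data.Product using (∃; _×_; _,_) renaming (Σ to Sigma)
open import Data.Sum using (_⊎_)
open import Relation.Binary.PropositionalEquality using (_≡_; _≢_)

-- PART I.  Finite π-calculus (Milner–Parrow–Walker), late semantics.
-- Processes are in scoped de Bruijn form: a  Proc n  has its free names
-- among  Fin n ; binders (input, restriction) bind index  zero .
-- Alpha-equivalent processes are therefore syntactically identical.

data Proc (n : ℕ) : Set where
  𝟘     : Proc n
  _⊕_   : Proc n → Proc n → Proc n
  _∥_   : Proc n → Proc n → Proc n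
  τ∙_   : Proc n → Proc n
  [_≐_]_ : Fin n → Fin n → Proc n → Proc n
  out   : Fin n → Fin n → Proc n → Proc n
  inp   : Fin n → Proc (suc n) → Proc n
  new   : Proc (suc n) → Proc n

ext : ∀ {n m} → (Fin n → Fin m) → Fin (suc n) → Fin (suc m)
ext ρ zero    = zero
ext ρ (suc i) = suc (ρ i)

ren : ∀ {n m} → (Fin n → Fin m) → Proc n → Proc m
ren ρ 𝟘             = 𝟘
ren ρ (P ⊕ Q)       = ren ρ P ⊕ ren ρ Q
ren ρ (P ∥ Q)       = ren ρ P ∥ ren ρ Q
ren ρ (τ∙ P)        = τ∙ ren ρ P
ren ρ ([ x ≐ y ] P) = [ ρ x ≐ ρ y ] ren ρ P
ren ρ (out x y P)   = out (ρ x) (ρ y) (ren ρ P)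
ren ρ (inp x P)     = inp (ρ x) (ren (ext ρ) P)
ren ρ (new P)       = new (ren (ext ρ) P)

inst : ∀ {n} → Fin n → Fin (suc n) → Fin n
inst y zero    = y
inst y (suc i) = i

swap : ∀ {n} → Fin (suc (suc n)) → Fin (suc (suc n))
swap zero          = suc zero
swap (suc zero)    = zero
swap (suc (suc i)) = suc (suc i)

data FAct (n : ℕ) : Set where
  τₐ  : FAct n
  ō   : Fin n → Fin n → FAct n

renFA : ∀ {n m} → (Fin n → Fin m) → FAct n → FAct m
renFA ρ τₐ      = τₐ
renFA ρ (ō x y) = ō (ρ x) (ρ y)

-- bound actions: x(z) (late input) and x̄(z) (bound output);
-- the bound name z is index zero of the residual.
data BAct (n : ℕ) : Set where
  ι  : Fin n → BAct n
  ōν : Fin n → BAct n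

renBA : ∀ {n m} → (Fin n → Fin m) → BAct n → BAct m
renBA ρ (ι x)  = ι (ρ x)
renBA ρ (ōν x) = ōν (ρ x)

-- late transition relation (MPW rules TAU, OUT, IN, MATCH, SUM, PAR,
-- COM, CLOSE, RES, OPEN; side conditions on bound names are automatic)
infix 4 _—[_]→_ _—[_]→ᵇ_
data _—[_]→_ {n : ℕ} : Proc n → FAct n → Proc n → Set
data _—[_]→ᵇ_ {n : ℕ} : Proc n → BAct n → Proc (suc n) → Set

data _—[_]→_ {n} where
  tau    : ∀ {P} → τ∙ P —[ τₐ ]→ P
  output : ∀ {x y P} → out x y P —[ ō x y ]→ P
  match  : ∀ {x P α P'} → P —[ α ]→ P' → [ x ≐ x ] P —[ α ]→ P'
  sumˡ   : ∀ {P Q α P'} → P —[ α ]→ P' → P ⊕ Q —[ α ]→ P'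
  sumʳ   : ∀ {P Q α Q'} → Q —[ α ]→ Q' → P ⊕ Q —[ α ]→ Q'
  parˡ   : ∀ {P Q α P'} → P —[ α ]→ P' → P ∥ Q —[ α ]→ P' ∥ Q
  parʳ   : ∀ {P Q α Q'} → Q —[ α ]→ Q' → P ∥ Q —[ α ]→ P ∥ Q'
  comˡ   : ∀ {P Q x y P' Q'} → P —[ ō x y ]→ P' → Q —[ ι x ]→ᵇ Q' →
           P ∥ Q —[ τₐ ]→ P' ∥ ren (inst y) Q'
  comʳ   : ∀ {P Q x y P' Q'} → P —[ ι x ]→ᵇ P' → Q —[ ō x y ]→ Q' →
           P ∥ Q —[ τₐ ]→ ren (inst y) P' ∥ Q'
  closeˡ : ∀ {P Q x P' Q'} → P —[ ōν x ]→ᵇ P' → Q —[ ι x ]→ᵇ Q' →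
           P ∥ Q —[ τₐ ]→ new (P' ∥ Q')
  closeʳ : ∀ {P Q x P' Q'} → P —[ ι x ]→ᵇ P' → Q —[ ōν x ]→ᵇ Q' →
           P ∥ Q —[ τₐ ]→ new (P' ∥ Q')
  res    : ∀ {P α P'} → P —[ renFA suc α ]→ P' → new P —[ α ]→ new P'

data _—[_]→ᵇ_ {n} where
  input  : ∀ {x P} → inp x P —[ ι x ]→ᵇ P
  match  : ∀ {x P β P'} → P —[ β ]→ᵇ P' → [ x ≐ x ] P —[ β ]→ᵇ P'
  sumˡ   : ∀ {P Q β P'} → P —[ β ]→ᵇ P' → P ⊕ Q —[ β ]→ᵇ P'
  sumʳ   : ∀ {P Q β Q'} → Q —[ β ]→ᵇ Q' → P ⊕ Q —[ β ]→ᵇ Q'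
  parˡ   : ∀ {P Q β P'} → P —[ β ]→ᵇ P' → P ∥ Q —[ β ]→ᵇ P' ∥ ren suc Q
  parʳ   : ∀ {P Q β Q'} → Q —[ β ]→ᵇ Q' → P ∥ Q —[ β ]→ᵇ ren suc P ∥ Q'
  res    : ∀ {P β P'} → P —[ renBA suc β ]→ᵇ P' → new P —[ β ]→ᵇ new (ren swap P')
  open'  : ∀ {P x P'} → P —[ ō (suc x) zero ]→ P' → new P —[ ōν x ]→ᵇ P'

down : ∀ {n} → List (Fin (suc n)) → List (Fin n)
down []            = []
down (zero  ∷ xs)  = down xs
down (suc i ∷ xs)  = i ∷ down xs

fn : ∀ {n} → Proc n → List (Fin n)
fn 𝟘             = []
fn (P ⊕ Q)       = fn P ++ fn Q
fn (P ∥ Q)       = fn P ++ fn Q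
fn (τ∙ P)        = fn P
fn ([ x ≐ y ] P) = x ∷ y ∷ fn P
fn (out x y P)   = x ∷ y ∷ fn P
fn (inp x P)     = x ∷ down (fn P)
fn (new P)       = down (fn P)

Dist : ℕ → Set
Dist n = List (Fin n × Fin n)

record IsDistinction {n} (D : Dist n) : Set where
  field
    symmetric   : ∀ {x y} → (x , y) ∈ D → (y , x) ∈ D
    irreflexive : ∀ {x} → (x , x) ∉ D

Respects : ∀ {n m} → (Fin n → Fin m) → Dist n → Set
Respects θ D = ∀ {x y} → (x , y) ∈ D → θ x ≢ θ y

pairMap : ∀ {n m} → (Fin n → Fin m) → Fin n × Fin n → Fin m × Fin m
pairMap θ (x , y) = θ x , θ y

_[_]ᴰ : ∀ {n m} → Dist n → (Fin n → Fin m) → Dist m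
D [ θ ]ᴰ = map (pairMap θ) D

namesᴰ : ∀ {n} → Dist n → List (Fin n)
namesᴰ = concatMap (λ { (x , y) → x ∷ y ∷ [] })

-- D'' = Dθ ∪ ({z} × fn(Pθ,Qθ,Dθ)) symmetrized, with z = index zero
-- (Dθ' is already the image Dθ; P Q are already Pθ, Qθ)
boutDist : ∀ {m} → Dist m → Proc m → Proc m → Dist (suc m)
boutDist Dθ Pθ Qθ =
  (Dθ [ suc ]ᴰ) ++
  concatMap (λ u → (zero , suc u) ∷ (suc u , zero) ∷ [])
            (fn Pθ ++ fn Qθ ++ namesᴰ Dθ)

Family : Set₁
Family = (n : ℕ) → Dist n → Proc n → Proc n → Set

record IsOpenBisim (S : Family) : Set where
  field
    symm   : ∀ {n D P Q} → IsDistinction D → S n D P Q → S n D Q P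
    freeStep : ∀ {n m D P Q} → IsDistinction D → S n D P Q →
             (θ : Fin n → Fin m) → Respects θ D →
             ∀ {α P'} → ren θ P —[ α ]→ P' →
             ∃ λ Q' → (ren θ Q —[ α ]→ Q') × S m (D [ θ ]ᴰ) P' Q'
    inStep : ∀ {n m D P Q} → IsDistinction D → S n D P Q →
             (θ : Fin n → Fin m) → Respects θ D →
             ∀ {x P'} → ren θ P —[ ι x ]→ᵇ P' →
             ∃ λ Q' → (ren θ Q —[ ι x ]→ᵇ Q') ×
                      S (suc m) ((D [ θ ]ᴰ) [ suc ]ᴰ) P' Q'
    boutStep : ∀ {n m D P Q} → IsDistinction D → S n D P Q →
             (θ : Fin n → Fin m) → Respects θ D →
             ∀ {x P'} → ren θ P —[ ōν x ]→ᵇ P' →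
             ∃ λ Q' → (ren θ Q —[ ōν x ]→ᵇ Q') ×
                      S (suc m) (boutDist (D [ θ ]ᴰ) (ren θ P) (ren θ Q)) P' Q'

OpenBisimilar : ∀ {n} → Dist n → Proc n → Proc n → Set₁
OpenBisimilar {n} D P Q = Sigma Family λ S → IsOpenBisim S × S n D P Q

-- PART II.  The logic FOλ^{Δ∇}.
-- Simply typed λ-terms (intrinsically typed, de Bruijn) over base types
-- n (names), p (processes), a (actions); no constants of type n.
-- Terms are identified up to βη-conversion  _≈_ .

infixr 7 _⇒_
data Ty : Set where
  nm pr ac : Ty
  _⇒_      : Ty → Ty → Ty

infixl 5 _▸_
data Ctx : Set where
  ε   : Ctx
  _▸_ : Ctx → Ty → Ctx

data _∋_ : Ctx → Ty → Set where
  vz : ∀ {Γ τ}   → (Γ ▸ τ) ∋ τ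
  vs : ∀ {Γ τ ρ} → Γ ∋ τ → (Γ ▸ ρ) ∋ τ

data Const : Ty → Set where
  c𝟘      : Const pr
  c+ c∣   : Const (pr ⇒ pr ⇒ pr)
  cτ      : Const (pr ⇒ pr)
  cmatch  : Const (nm ⇒ nm ⇒ pr ⇒ pr)
  cout    : Const (nm ⇒ nm ⇒ pr ⇒ pr)
  cin     : Const (nm ⇒ (nm ⇒ pr) ⇒ pr)
  cν      : Const ((nm ⇒ pr) ⇒ pr)
  aτ      : Const ac
  a↓ a↑   : Const (nm ⇒ nm ⇒ ac)

data Tm (Γ : Ctx) : Ty → Set where
  var : ∀ {τ} → Γ ∋ τ → Tm Γ τ
  con : ∀ {τ} → Const τ → Tm Γ τ
  lam : ∀ {σ τ} → Tm (Γ ▸ σ) τ → Tm Γ (σ ⇒ τ)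
  app : ∀ {σ τ} → Tm Γ (σ ⇒ τ) → Tm Γ σ → Tm Γ τ

Ren : Ctx → Ctx → Set
Ren Γ Δ = ∀ {τ} → Γ ∋ τ → Δ ∋ τ

Sub : Ctx → Ctx → Set
Sub Γ Δ = ∀ {τ} → Γ ∋ τ → Tm Δ τ

liftR : ∀ {Γ Δ τ} → Ren Γ Δ → Ren (Γ ▸ τ) (Δ ▸ τ)
liftR ρ vz     = vz
liftR ρ (vs v) = vs (ρ v)

renT : ∀ {Γ Δ τ} → Ren Γ Δ → Tm Γ τ → Tm Δ τ
renT ρ (var v)   = var (ρ v)
renT ρ (con c)   = con c
renT ρ (lam t)   = lam (renT (liftR ρ) t)
renT ρ (app t u) = app (renT ρ t) (renT ρ u)

wkT : ∀ {Γ ρ τ} → Tm Γ τ → Tm (Γ ▸ ρ) τ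
wkT = renT vs

liftS : ∀ {Γ Δ τ} → Sub Γ Δ → Sub (Γ ▸ τ) (Δ ▸ τ)
liftS θ vz     = var vz
liftS θ (vs v) = wkT (θ v)

subT : ∀ {Γ Δ τ} → Sub Γ Δ → Tm Γ τ → Tm Δ τ
subT θ (var v)   = θ v
subT θ (con c)   = con c
subT θ (lam t)   = lam (subT (liftS θ) t)
subT θ (app t u) = app (subT θ t) (subT θ u)

sub0 : ∀ {Γ τ} → Tm Γ τ → Sub (Γ ▸ τ) Γ
sub0 u vz     = u
sub0 u (vs v) = var v

infix 4 _≈_
data _≈_ : ∀ {Γ τ} → Tm Γ τ → Tm Γ τ → Set where
  ≈refl  : ∀ {Γ τ} {t : Tm Γ τ} → t ≈ t
  ≈sym   : ∀ {Γ τ} {t u : Tm Γ τ} → t ≈ u → u ≈ t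
  ≈trans : ∀ {Γ τ} {t u v : Tm Γ τ} → t ≈ u → u ≈ v → t ≈ v
  ≈app   : ∀ {Γ σ τ} {t t' : Tm Γ (σ ⇒ τ)} {u u' : Tm Γ σ} →
           t ≈ t' → u ≈ u' → app t u ≈ app t' u'
  ≈lam   : ∀ {Γ σ τ} {t t' : Tm (Γ ▸ σ) τ} → t ≈ t' → lam t ≈ lam t'
  ≈β     : ∀ {Γ σ τ} {t : Tm (Γ ▸ σ) τ} {u : Tm Γ σ} →
           app (lam t) u ≈ subT (sub0 u) t
  ≈η     : ∀ {Γ σ τ} {t : Tm Γ (σ ⇒ τ)} → t ≈ lam (app (wkT t) (var vz))

data Args (Γ : Ctx) : List Ty → Set where
  []  : Args Γ []
  _∷_ : ∀ {τ τs} → Tm Γ τ → Args Γ τs → Args Γ (τ ∷ τs)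

subA : ∀ {Γ Δ τs} → Sub Γ Δ → Args Γ τs → Args Δ τs
subA θ []       = []
subA θ (t ∷ ts) = subT θ t ∷ subA θ ts

renA : ∀ {Γ Δ τs} → Ren Γ Δ → Args Γ τs → Args Δ τs
renA ρ []       = []
renA ρ (t ∷ ts) = renT ρ t ∷ renA ρ ts

infix 4 _≈*_
data _≈*_ {Γ : Ctx} : ∀ {τs} → Args Γ τs → Args Γ τs → Set where
  []  : [] ≈* []
  _∷_ : ∀ {τ τs} {t u : Tm Γ τ} {ts us : Args Γ τs} →
        t ≈ u → ts ≈* us → (t ∷ ts) ≈* (u ∷ us)

data Pred : Set where
  eq     : Ty → Pred
  one    : Pred
  onep   : Pred
  lbisim : Pred

arity : Pred → List Ty
arity (eq τ) = τ ∷ τ ∷ []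
arity one    = pr ∷ ac ∷ pr ∷ []
arity onep   = pr ∷ (nm ⇒ ac) ∷ (nm ⇒ pr) ∷ []
arity lbisim = pr ∷ pr ∷ []

infixr 6 _∧̇_
infixr 5 _∨̇_
infixr 4 _⊃̇_
data Fm (Γ : Ctx) : Set where
  ⊤̇ ⊥̇          : Fm Γ
  _∧̇_ _∨̇_ _⊃̇_  : Fm Γ → Fm Γ → Fm Γ
  ∀̇ ∃̇ ∇̇       : (τ : Ty) → Fm (Γ ▸ τ) → Fm Γ
  atom         : (p : Pred) → Args Γ (arity p) → Fm Γ

renF : ∀ {Γ Δ} → Ren Γ Δ → Fm Γ → Fm Δ
renF ρ ⊤̇          = ⊤̇
renF ρ ⊥̇          = ⊥̇
renF ρ (A ∧̇ B)    = renF ρ A ∧̇ renF ρ B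
renF ρ (A ∨̇ B)    = renF ρ A ∨̇ renF ρ B
renF ρ (A ⊃̇ B)    = renF ρ A ⊃̇ renF ρ B
renF ρ (∀̇ τ A)    = ∀̇ τ (renF (liftR ρ) A)
renF ρ (∃̇ τ A)    = ∃̇ τ (renF (liftR ρ) A)
renF ρ (∇̇ τ A)    = ∇̇ τ (renF (liftR ρ) A)
renF ρ (atom p ts) = atom p (renA ρ ts)

subF : ∀ {Γ Δ} → Sub Γ Δ → Fm Γ → Fm Δ
subF θ ⊤̇          = ⊤̇
subF θ ⊥̇          = ⊥̇
subF θ (A ∧̇ B)    = subF θ A ∧̇ subF θ B
subF θ (A ∨̇ B)    = subF θ A ∨̇ subF θ B
subF θ (A ⊃̇ B)    = subF θ A ⊃̇ subF θ B
subF θ (∀̇ τ A)    = ∀̇ τ (subF (liftS θ) A)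
subF θ (∃̇ τ A)    = ∃̇ τ (subF (liftS θ) A)
subF θ (∇̇ τ A)    = ∇̇ τ (subF (liftS θ) A)
subF θ (atom p ts) = atom p (subA θ ts)

infix 4 _≈F_
data _≈F_ : ∀ {Γ} → Fm Γ → Fm Γ → Set where
  ⊤̇ : ∀ {Γ} → ⊤̇ {Γ} ≈F ⊤̇
  ⊥̇ : ∀ {Γ} → ⊥̇ {Γ} ≈F ⊥̇
  _∧̇_ : ∀ {Γ} {A A' B B' : Fm Γ} → A ≈F A' → B ≈F B' → (A ∧̇ B) ≈F (A' ∧̇ B')
  _∨̇_ : ∀ {Γ} {A A' B B' : Fm Γ} → A ≈F A' → B ≈F B' → (A ∨̇ B) ≈F (A' ∨̇ B')
  _⊃̇_ : ∀ {Γ} {A A' B B' : Fm Γ} → A ≈F A' → B ≈F B' → (A ⊃̇ B) ≈F (A' ⊃̇ B')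
  ∀̇ : ∀ {Γ τ} {A A' : Fm (Γ ▸ τ)} → A ≈F A' → ∀̇ τ A ≈F ∀̇ τ A'
  ∃̇ : ∀ {Γ τ} {A A' : Fm (Γ ▸ τ)} → A ≈F A' → ∃̇ τ A ≈F ∃̇ τ A'
  ∇̇ : ∀ {Γ τ} {A A' : Fm (Γ ▸ τ)} → A ≈F A' → ∇̇ τ A ≈F ∇̇ τ A'
  atom : ∀ {Γ p} {ts us : Args Γ (arity p)} → ts ≈* us → atom p ts ≈F atom p us

_≠̇_ : ∀ {Γ τ} → Tm Γ τ → Tm Γ τ → Fm Γ
s ≠̇ t = atom (eq _) (s ∷ t ∷ []) ⊃̇ ⊥̇

infixl 5 _⧺_
_⧺_ : Ctx → Ctx → Ctx
Γ ⧺ ε       = Γ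
Γ ⧺ (σ ▸ τ) = (Γ ⧺ σ) ▸ τ

liftR* : ∀ {Γ Δ} σ → Ren Γ Δ → Ren (Γ ⧺ σ) (Δ ⧺ σ)
liftR* ε       ρ = ρ
liftR* (σ ▸ τ) ρ = liftR (liftR* σ ρ)

liftS* : ∀ {Γ Δ} σ → Sub Γ Δ → Sub (Γ ⧺ σ) (Δ ⧺ σ)
liftS* ε       θ = θ
liftS* (σ ▸ τ) θ = liftS (liftS* σ θ)

wk⧺ : ∀ {Γ} R → Ren Γ (Γ ⧺ R)
wk⧺ ε       v = v
wk⧺ (R ▸ τ) v = vs (wk⧺ R v)

raise : Ctx → Ty → Ty
raise ε       τ = τ
raise (σ ▸ ρ) τ = raise σ (ρ ⇒ τ)

raiseCtx : Ctx → Ctx → Ctx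
raiseCtx σ ε       = ε
raiseCtx σ (X ▸ τ) = raiseCtx σ X ▸ raise σ τ

appLocals : ∀ {Δ τ} σ → Tm Δ (raise σ τ) → Tm (Δ ⧺ σ) τ
appLocals ε       t = t
appLocals (σ ▸ ρ) t = app (wkT (appLocals σ t)) (var vz)

-- instantiate the bound variable by a new raised eigenvariable h
raiseInst : ∀ {Σ} σ {τ} → Sub ((Σ ⧺ σ) ▸ τ) ((Σ ▸ raise σ τ) ⧺ σ)
raiseInst σ vz     = appLocals σ (var vz)
raiseInst σ (vs v) = var (liftR* σ vs v)

-- instantiate clause variables X by new raised eigenvariables
raiseSub : ∀ {Σ} σ X → Sub X ((Σ ⧺ raiseCtx σ X) ⧺ σ)
raiseSub σ (X ▸ τ) vz     = appLocals σ (var vz)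
raiseSub σ (X ▸ τ) (vs v) = renT (liftR* σ vs) (raiseSub σ X v)

data Cl : Pred → Set where
  eqRefl                                            : ∀ {τ} → Cl (eq τ)
  oneTau oneOut oneMatch oneSumˡ oneSumʳ oneParˡ oneParʳ oneRes
    oneCloseˡ oneCloseʳ oneComˡ oneComʳ              : Cl one
  onepIn onepMatch onepSumˡ onepSumʳ onepParˡ onepParʳ onepRes
    onepOpen                                        : Cl onep
  lbisimDef                                         : Cl lbisim

infixl 9 _·_
_·_ : ∀ {Γ σ τ} → Tm Γ (σ ⇒ τ) → Tm Γ σ → Tm Γ τ
_·_ = app

v0 : ∀ {Γ τ} → Tm (Γ ▸ τ) τ
v0 = var vz
v1 : ∀ {Γ τ ρ} → Tm (Γ ▸ τ ▸ ρ) τ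
v1 = var (vs vz)
v2 : ∀ {Γ τ ρ₁ ρ₂} → Tm (Γ ▸ τ ▸ ρ₁ ▸ ρ₂) τ
v2 = var (vs (vs vz))
v3 : ∀ {Γ τ ρ₁ ρ₂ ρ₃} → Tm (Γ ▸ τ ▸ ρ₁ ▸ ρ₂ ▸ ρ₃) τ
v3 = var (vs (vs (vs vz)))
v4 : ∀ {Γ τ ρ₁ ρ₂ ρ₃ ρ₄} → Tm (Γ ▸ τ ▸ ρ₁ ▸ ρ₂ ▸ ρ₃ ▸ ρ₄) τ
v4 = var (vs (vs (vs (vs vz))))

oneA : ∀ {Γ} → Tm Γ pr → Tm Γ ac → Tm Γ pr → Fm Γ
oneA P A Q = atom one (P ∷ A ∷ Q ∷ [])

onepA : ∀ {Γ} → Tm Γ pr → Tm Γ (nm ⇒ ac) → Tm Γ (nm ⇒ pr) → Fm Γ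
onepA P A Q = atom onep (P ∷ A ∷ Q ∷ [])

lbisimA : ∀ {Γ} → Tm Γ pr → Tm Γ pr → Fm Γ
lbisimA P Q = atom lbisim (P ∷ Q ∷ [])

par : ∀ {Γ} → Tm Γ pr → Tm Γ pr → Tm Γ pr
par P Q = con c∣ · P · Q

νλ : ∀ {Γ} → Tm (Γ ▸ nm) pr → Tm Γ pr
νλ P = con cν · lam P

halfBisim : ∀ {Γ} → Tm Γ pr → Tm Γ pr → Fm Γ
halfBisim P Q =
  ∀̇ ac (∀̇ pr (oneA (wkT (wkT P)) v1 v0 ⊃̇
     ∃̇ pr (oneA (wkT (wkT (wkT Q))) v2 v0 ∧̇ lbisimA v1 v0)))
  ∧̇
  ∀̇ nm (∀̇ (nm ⇒ pr) (onepA (wkT (wkT P)) (con a↓ · v1) v0 ⊃̇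
     ∃̇ (nm ⇒ pr) (onepA (wkT (wkT (wkT Q))) (con a↓ · v2) v0 ∧̇
        ∀̇ nm (lbisimA (v2 · v0) (v1 · v0)))))
  ∧̇
  ∀̇ nm (∀̇ (nm ⇒ pr) (onepA (wkT (wkT P)) (con a↑ · v1) v0 ⊃̇
     ∃̇ (nm ⇒ pr) (onepA (wkT (wkT (wkT Q))) (con a↑ · v2) v0 ∧̇
        ∇̇ nm (lbisimA (v2 · v0) (v1 · v0)))))

record Clause (p : Pred) : Set where
  constructor clause
  field
    vars : Ctx
    head : Args vars (arity p)
    body : Fm vars

clauseOf : ∀ {p} → Cl p → Clause p
clauseOf (eqRefl {τ}) = clause (ε ▸ τ) (v0 ∷ v0 ∷ []) ⊤̇
clauseOf oneTau = clause (ε ▸ pr) (con cτ · v0 ∷ con aτ ∷ v0 ∷ []) ⊤̇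
clauseOf oneOut = clause (ε ▸ nm ▸ nm ▸ pr)
  (con cout · v2 · v1 · v0 ∷ con a↑ · v2 · v1 ∷ v0 ∷ []) ⊤̇
clauseOf oneMatch = clause (ε ▸ nm ▸ pr ▸ ac ▸ pr)
  (con cmatch · v3 · v3 · v2 ∷ v1 ∷ v0 ∷ []) (oneA v2 v1 v0)
clauseOf oneSumˡ = clause (ε ▸ pr ▸ pr ▸ ac ▸ pr)
  (con c+ · v3 · v2 ∷ v1 ∷ v0 ∷ []) (oneA v3 v1 v0)
clauseOf oneSumʳ = clause (ε ▸ pr ▸ pr ▸ ac ▸ pr)
  (con c+ · v3 · v2 ∷ v1 ∷ v0 ∷ []) (oneA v2 v1 v0)
clauseOf oneParˡ = clause (ε ▸ pr ▸ pr ▸ ac ▸ pr)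
  (par v3 v2 ∷ v1 ∷ par v0 v2 ∷ []) (oneA v3 v1 v0)
clauseOf oneParʳ = clause (ε ▸ pr ▸ pr ▸ ac ▸ pr)
  (par v3 v2 ∷ v1 ∷ par v3 v0 ∷ []) (oneA v2 v1 v0)
clauseOf oneRes = clause (ε ▸ (nm ⇒ pr) ▸ ac ▸ (nm ⇒ pr))
  (νλ (v3 · v0) ∷ v1 ∷ νλ (v1 · v0) ∷ [])
  (∇̇ nm (oneA (v3 · v0) v2 (v1 · v0)))
clauseOf oneCloseˡ = clause (ε ▸ pr ▸ pr ▸ (nm ⇒ pr) ▸ (nm ⇒ pr))
  (par v3 v2 ∷ con aτ ∷ νλ (par (v2 · v0) (v1 · v0)) ∷ [])
  (∃̇ nm (onepA v4 (con a↓ · v0) v2 ∧̇ onepA v3 (con a↑ · v0) v1))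
clauseOf oneCloseʳ = clause (ε ▸ pr ▸ pr ▸ (nm ⇒ pr) ▸ (nm ⇒ pr))
  (par v3 v2 ∷ con aτ ∷ νλ (par (v2 · v0) (v1 · v0)) ∷ [])
  (∃̇ nm (onepA v4 (con a↑ · v0) v2 ∧̇ onepA v3 (con a↓ · v0) v1))
clauseOf oneComˡ = clause (ε ▸ pr ▸ pr ▸ (nm ⇒ pr) ▸ nm ▸ pr)
  (par v4 v3 ∷ con aτ ∷ par (v2 · v1) v0 ∷ [])
  (∃̇ nm (onepA (var (vs (vs (vs (vs (vs vz)))))) (con a↓ · v0) v3 ∧̇
         oneA v4 (con a↑ · v0 · v2) v1))
clauseOf oneComʳ = clause (ε ▸ pr ▸ pr ▸ pr ▸ (nm ⇒ pr) ▸ nm)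
  (par v4 v3 ∷ con aτ ∷ par v2 (v1 · v0) ∷ [])
  (∃̇ nm (oneA (var (vs (vs (vs (vs (vs vz)))))) (con a↑ · v0 · v1) v3 ∧̇
         onepA v4 (con a↓ · v0) v2))
clauseOf onepIn = clause (ε ▸ nm ▸ (nm ⇒ pr))
  (con cin · v1 · v0 ∷ con a↓ · v1 ∷ v0 ∷ []) ⊤̇
clauseOf onepMatch = clause (ε ▸ nm ▸ pr ▸ (nm ⇒ ac) ▸ (nm ⇒ pr))
  (con cmatch · v3 · v3 · v2 ∷ v1 ∷ v0 ∷ []) (onepA v2 v1 v0)
clauseOf onepSumˡ = clause (ε ▸ pr ▸ pr ▸ (nm ⇒ ac) ▸ (nm ⇒ pr))
  (con c+ · v3 · v2 ∷ v1 ∷ v0 ∷ []) (onepA v3 v1 v0)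
clauseOf onepSumʳ = clause (ε ▸ pr ▸ pr ▸ (nm ⇒ ac) ▸ (nm ⇒ pr))
  (con c+ · v3 · v2 ∷ v1 ∷ v0 ∷ []) (onepA v2 v1 v0)
clauseOf onepParˡ = clause (ε ▸ pr ▸ pr ▸ (nm ⇒ ac) ▸ (nm ⇒ pr))
  (par v3 v2 ∷ v1 ∷ lam (par (v1 · v0) v3) ∷ []) (onepA v3 v1 v0)
clauseOf onepParʳ = clause (ε ▸ pr ▸ pr ▸ (nm ⇒ ac) ▸ (nm ⇒ pr))
  (par v3 v2 ∷ v1 ∷ lam (par v4 (v1 · v0)) ∷ []) (onepA v2 v1 v0)
clauseOf onepRes = clause (ε ▸ (nm ⇒ pr) ▸ (nm ⇒ ac) ▸ (nm ⇒ nm ⇒ pr))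
  (νλ (v3 · v0) ∷ v1 ∷ lam (νλ (v2 · v0 · v1)) ∷ [])
  (∇̇ nm (onepA (v3 · v0) v2 (v1 · v0)))
clauseOf onepOpen = clause (ε ▸ (nm ⇒ pr) ▸ nm ▸ (nm ⇒ pr))
  (νλ (v3 · v0) ∷ con a↑ · v1 ∷ v0 ∷ [])
  (∇̇ nm (oneA (v3 · v0) (con a↑ · v2 · v0) (v1 · v0)))
clauseOf lbisimDef = clause (ε ▸ pr ▸ pr) (v1 ∷ v0 ∷ [])
  (halfBisim v1 v0 ∧̇ halfBisim v0 v1)

infix 2 _▹_
data LF (Σ : Ctx) : Set where
  _▹_ : (σ : Ctx) → Fm (Σ ⧺ σ) → LF Σ

renLF : ∀ {Σ Σ'} → Ren Σ Σ' → LF Σ → LF Σ'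
renLF ρ (σ ▹ B) = σ ▹ renF (liftR* σ ρ) B

subLF : ∀ {Σ Σ'} → Sub Σ Σ' → LF Σ → LF Σ'
subLF θ (σ ▹ B) = σ ▹ subF (liftS* σ θ) B

Unifies : ∀ {Σ Σ' τs} σ → Args (Σ ⧺ σ) τs → Args (Σ ⧺ σ) τs → Sub Σ Σ' → Set
Unifies σ ts us θ = subA (liftS* σ θ) ts ≈* subA (liftS* σ θ) us

record IsCSU {Σ τs} σ (ts us : Args (Σ ⧺ σ) τs)
             (S : (Σ' : Ctx) → Sub Σ Σ' → Set) : Set where
  field
    sound    : ∀ {Σ'} (δ : Sub Σ Σ') → S Σ' δ → Unifies σ ts us δ
    complete : ∀ {Σ''} (θ : Sub Σ Σ'') → Unifies σ ts us θ →
               Sigma Ctx λ Σ' → Sigma (Sub Σ Σ') λ δ → S Σ' δ ×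
               Sigma (Sub Σ' Σ'') λ ρ → ∀ {τ} (v : Σ ∋ τ) → θ v ≈ subT ρ (δ v)

Σ⁺ : ∀ {p} → Ctx → Ctx → Cl p → Ctx
Σ⁺ Σ σ c = Σ ⧺ raiseCtx σ (Clause.vars (clauseOf c))

infix 1 _⊩_⊢_
data _⊩_⊢_ (Σ : Ctx) : List (LF Σ) → LF Σ → Set₁ where
  init  : ∀ {Γ σ} {B B' : Fm (Σ ⧺ σ)} → B ≈F B' → Σ ⊩ (σ ▹ B) ∷ Γ ⊢ σ ▹ B'
  cut   : ∀ {Γ Δ B C} → Σ ⊩ Γ ⊢ B → Σ ⊩ B ∷ Δ ⊢ C → Σ ⊩ Γ ++ Δ ⊢ C
  contr : ∀ {Γ B C} → Σ ⊩ B ∷ B ∷ Γ ⊢ C → Σ ⊩ B ∷ Γ ⊢ C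
  weak  : ∀ {Γ B C} → Σ ⊩ Γ ⊢ C → Σ ⊩ B ∷ Γ ⊢ C
  exch  : ∀ {Γ Γ' C} → Γ ↭ Γ' → Σ ⊩ Γ ⊢ C → Σ ⊩ Γ' ⊢ C
  ⊤R    : ∀ {Γ σ} → Σ ⊩ Γ ⊢ σ ▹ ⊤̇
  ⊥L    : ∀ {Γ σ C} → Σ ⊩ (σ ▹ ⊥̇) ∷ Γ ⊢ C
  ∧R    : ∀ {Γ σ B C} → Σ ⊩ Γ ⊢ σ ▹ B → Σ ⊩ Γ ⊢ σ ▹ C → Σ ⊩ Γ ⊢ σ ▹ B ∧̇ C
  ∧L₁   : ∀ {Γ σ B C D} → Σ ⊩ (σ ▹ B) ∷ Γ ⊢ D → Σ ⊩ (σ ▹ B ∧̇ C) ∷ Γ ⊢ D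
  ∧L₂   : ∀ {Γ σ B C D} → Σ ⊩ (σ ▹ C) ∷ Γ ⊢ D → Σ ⊩ (σ ▹ B ∧̇ C) ∷ Γ ⊢ D
  ∨R₁   : ∀ {Γ σ B C} → Σ ⊩ Γ ⊢ σ ▹ B → Σ ⊩ Γ ⊢ σ ▹ B ∨̇ C
  ∨R₂   : ∀ {Γ σ B C} → Σ ⊩ Γ ⊢ σ ▹ C → Σ ⊩ Γ ⊢ σ ▹ B ∨̇ C
  ∨L    : ∀ {Γ σ B C D} → Σ ⊩ (σ ▹ B) ∷ Γ ⊢ D → Σ ⊩ (σ ▹ C) ∷ Γ ⊢ D →
          Σ ⊩ (σ ▹ B ∨̇ C) ∷ Γ ⊢ D
  ⊃R    : ∀ {Γ σ B C} → Σ ⊩ (σ ▹ B) ∷ Γ ⊢ σ ▹ C → Σ ⊩ Γ ⊢ σ ▹ B ⊃̇ C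
  ⊃L    : ∀ {Γ σ B C D} → Σ ⊩ Γ ⊢ σ ▹ B → Σ ⊩ (σ ▹ C) ∷ Γ ⊢ D →
          Σ ⊩ (σ ▹ B ⊃̇ C) ∷ Γ ⊢ D
  ∀R    : ∀ {Γ σ τ B} →
          (Σ ▸ raise σ τ) ⊩ map (renLF vs) Γ ⊢ σ ▹ subF (raiseInst σ) B →
          Σ ⊩ Γ ⊢ σ ▹ ∀̇ τ B
  ∀L    : ∀ {Γ σ τ B D} (t : Tm (Σ ⧺ σ) τ) →
          Σ ⊩ (σ ▹ subF (sub0 t) B) ∷ Γ ⊢ D → Σ ⊩ (σ ▹ ∀̇ τ B) ∷ Γ ⊢ D
  ∃R    : ∀ {Γ σ τ B} (t : Tm (Σ ⧺ σ) τ) →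
          Σ ⊩ Γ ⊢ σ ▹ subF (sub0 t) B → Σ ⊩ Γ ⊢ σ ▹ ∃̇ τ B
  ∃L    : ∀ {Γ σ τ B D} →
          (Σ ▸ raise σ τ) ⊩ (σ ▹ subF (raiseInst σ) B) ∷ map (renLF vs) Γ ⊢ renLF vs D →
          Σ ⊩ (σ ▹ ∃̇ τ B) ∷ Γ ⊢ D
  ∇R    : ∀ {Γ σ τ B} → Σ ⊩ Γ ⊢ (σ ▸ τ) ▹ B → Σ ⊩ Γ ⊢ σ ▹ ∇̇ τ B
  ∇L    : ∀ {Γ σ τ B D} → Σ ⊩ ((σ ▸ τ) ▹ B) ∷ Γ ⊢ D → Σ ⊩ (σ ▹ ∇̇ τ B) ∷ Γ ⊢ D
  defR  : ∀ {Γ σ p} {ts : Args (Σ ⧺ σ) (arity p)} (c : Cl p)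
          (u : Sub (Clause.vars (clauseOf c)) (Σ ⧺ σ)) →
          subA u (Clause.head (clauseOf c)) ≈* ts →
          Σ ⊩ Γ ⊢ σ ▹ subF u (Clause.body (clauseOf c)) →
          Σ ⊩ Γ ⊢ σ ▹ atom p ts
  defL  : ∀ {Γ σ p D} {ts : Args (Σ ⧺ σ) (arity p)}
          (S : (c : Cl p) (Σ' : Ctx) → Sub (Σ⁺ Σ σ c) Σ' → Set) →
          ((c : Cl p) →
             IsCSU σ (renA (liftR* σ (wk⧺ _)) ts)
                     (subA (raiseSub σ _) (Clause.head (clauseOf c)))
                     (S c)) →
          ((c : Cl p) (Σ' : Ctx) (δ : Sub (Σ⁺ Σ σ c) Σ') → S c Σ' δ →
             Σ' ⊩ (σ ▹ subF (liftS* σ δ)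
                        (subF (raiseSub σ _) (Clause.body (clauseOf c))))
                  ∷ map (subLF (λ v → δ (wk⧺ _ v))) Γ
                ⊢ subLF (λ v → δ (wk⧺ _ v)) D) →
          Σ ⊩ (σ ▹ atom p ts) ∷ Γ ⊢ D

Provable : Fm ε → Set₁
Provable B = ε ⊩ [] ⊢ ε ▹ B

names : ℕ → Ctx
names zero    = ε
names (suc n) = names n ▸ nm

nameVar : ∀ {n} → Fin n → Tm (names n) nm
nameVar zero    = var vz
nameVar (suc i) = wkT (nameVar i)

⟦_⟧ : ∀ {n} → Proc n → Tm (names n) pr
⟦ 𝟘 ⟧             = con c𝟘
⟦ P ⊕ Q ⟧         = con c+ · ⟦ P ⟧ · ⟦ Q ⟧
⟦ P ∥ Q ⟧         = con c∣ · ⟦ P ⟧ · ⟦ Q ⟧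
⟦ τ∙ P ⟧          = con cτ · ⟦ P ⟧
⟦ [ x ≐ y ] P ⟧   = con cmatch · nameVar x · nameVar y · ⟦ P ⟧
⟦ out x y P ⟧     = con cout · nameVar x · nameVar y · ⟦ P ⟧
⟦ inp x P ⟧       = con cin · nameVar x · lam ⟦ P ⟧
⟦ new P ⟧         = con cν · lam ⟦ P ⟧

⟦_⟧ᴰ : ∀ {n} → Dist n → Fm (names n)
⟦ [] ⟧ᴰ                = ⊤̇
⟦ (x , y) ∷ [] ⟧ᴰ      = nameVar x ≠̇ nameVar y
⟦ (x , y) ∷ p ∷ D ⟧ᴰ   = (nameVar x ≠̇ nameVar y) ∧̇ ⟦ p ∷ D ⟧ᴰ

∀names : ∀ n → Fm (names n) → Fm ε
∀names zero    B = B
∀names (suc n) B = ∀names n (∀̇ nm B)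

-- every name in scope is free in P, Q or D  (so x̄ = fn(P,Q,D))
CoveredBy : ∀ {n} → Proc n → Proc n → Dist n → Set
CoveredBy {n} P Q D = (i : Fin n) → i ∈ fn P ⊎ i ∈ fn Q ⊎ i ∈ namesᴰ D

{-# OPTIONS --safe #-}
module Submission where

-- No constants of type nm exist, but names may become arbitrary terms, so processes are encoded
-- relative to an assignment θ of terms to names, and everything is read up to ≈. The derivation
-- plays the bisimulation game. A hypothesis one ⟦P⟧ A P' is analysed by defL, with all unifiers as
-- complete set of unifiers: unifying the channels of a match or of a communication only tells that
-- θ identifies two names x and y, and merging x with y in P turns this into an actual transition of
-- a renamed process ren κ P with θ ∘ κ ≈ θ. If κ violates the distinction D, the hypothesis ⟦D⟧
-- (or the freshness of a ∇-bound variable) refutes the case; otherwise the bisimulation supplies an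
-- answering transition of ren κ Q, which defR turns into a derivation. Transitions shrink processes,
-- so the game ends. Injectivity of the constants modulo ≈, on which the analysis rests, comes from a
-- logical relation: convertible terms of base type have convertible weak-head normal forms.

open import Data.Nat using (ℕ; zero; suc; _+_; _<_; _≤_; s≤s)
open import Data.Nat.Properties
  using (≤-trans; ≤-reflexive; <-≤-trans; n<1+n; m≤m+n; m≤n+m; +-monoˡ-<; +-monoʳ-<; +-mono-<)
open import Data.Fin using (Fin; zero; suc; _≟_)
open import Data.Fin.Properties using (suc-injective)
open import Data.List using (List; []; _∷_; map; concatMap; _++_)
open import Data.List.Membership.Propositional using (_∈_)
open import Data.List.Membership.Propositional.Properties using (∈-++⁻; ∈-++⁺ˡ; ∈-++⁺ʳ; ∈-map⁻; ∈-map⁺)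
open import Data.List.Properties using (map-∘; map-cong; map-id)
open import Data.List.Relation.Binary.Permutation.Propositional using (↭-refl)
import Data.List.Relation.Binary.Permutation.Propositional as Perm
open import Data.List.Relation.Unary.Any using (here; there)
open import Data.Empty using (⊥; ⊥-elim)
open import Data.Maybe using (Maybe; just; nothing)
open import Data.Product using (∃-syntax; _×_; _,_; proj₁; proj₂)
open import Data.Sum using (_⊎_; inj₁; inj₂)
open import Relation.Binary.Construct.Closure.ReflexiveTransitive using (Star; _◅_) renaming (ε to done)
open import Relation.Binary.PropositionalEquality
open import Relation.Nullary using (yes; no)
open import Function using (_∘_; id)
open import Defs

-- Taking all unifiers spares any unification algorithm, but each branch then carries an arbitrary
-- instantiation `δ` of the signature that is unknown when the goal is stated. This dictates the
-- form of the invariants: `Cont`, `Refutes` and the premises of `∀R'`, `∃L'` and `defL'` are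
-- quantified over all later `δ`. Case analysis is in continuation-passing style, since the
-- transition behind a hypothesis is known only deep inside the derivation. A second obstacle is
-- that open bisimilarity speaks of renamings of names to names, whereas `δ` sends names to terms.
-- No renaming is read off `δ`. Only the identifications that a transition needs, each with a proof
-- of convertibility at hand, are collected in an endomap `κ` of `Fin n`; whatever else `δ`
-- identifies goes unnoticed. So convertibility is never decided, and the one decision to make is
-- whether `κ` respects `D`, a question about finite data.

variable
  Γ Δ Θ Σ Σ' Σ'' X : Ctx
  σ τ : Ty
  τs : List Ty

-- Substitution calculus for terms, formulas and sequents

infix 4 _≗ˢ_
_≗ˢ_ : Sub Γ Δ → Sub Γ Δ → Set
_≗ˢ_ {Γ} θ θ' = ∀ {τ} (v : Γ ∋ τ) → θ v ≡ θ' v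

infixl 6 _⨟_
_⨟_ : Sub Γ Δ → Sub Δ Θ → Sub Γ Θ
(θ ⨟ θ') v = subT θ' (θ v)

infixl 5 _,ˢ_
_,ˢ_ : Sub Γ Δ → Tm Δ τ → Sub (Γ ▸ τ) Δ
(θ ,ˢ t) vz     = t
(θ ,ˢ t) (vs v) = θ v

liftS-cong : {θ θ' : Sub Γ Δ} → θ ≗ˢ θ' → liftS {τ = τ} θ ≗ˢ liftS θ'
liftS-cong e vz     = refl
liftS-cong e (vs v) = cong wkT (e v)

subT-cong : {θ θ' : Sub Γ Δ} → θ ≗ˢ θ' → (t : Tm Γ τ) → subT θ t ≡ subT θ' t
subT-cong e (var v)   = e v
subT-cong e (con c)   = refl
subT-cong e (lam t)   = cong lam (subT-cong (liftS-cong e) t)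
subT-cong e (app t u) = cong₂ app (subT-cong e t) (subT-cong e u)

subT-id : {θ : Sub Γ Γ} → θ ≗ˢ var → (t : Tm Γ τ) → subT θ t ≡ t
subT-id e (var v)   = e v
subT-id e (con c)   = refl
subT-id e (lam t)   = cong lam (subT-id (λ { vz → refl ; (vs v) → cong wkT (e v) }) t)
subT-id e (app t u) = cong₂ app (subT-id e t) (subT-id e u)

renT-subT : (ρ : Ren Γ Δ) (t : Tm Γ τ) → renT ρ t ≡ subT (var ∘ ρ) t
renT-subT ρ (var v)   = refl
renT-subT ρ (con c)   = refl
renT-subT ρ (lam t)   = cong lam (trans (renT-subT (liftR ρ) t)
  (subT-cong (λ { vz → refl ; (vs v) → refl }) t))
renT-subT ρ (app t u) = cong₂ app (renT-subT ρ t) (renT-subT ρ u)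

subT-renT : (ρ : Ren Γ Δ) (θ : Sub Δ Θ) (t : Tm Γ τ) →
  subT θ (renT ρ t) ≡ subT (θ ∘ ρ) t
subT-renT ρ θ (var v)   = refl
subT-renT ρ θ (con c)   = refl
subT-renT ρ θ (lam t)   = cong lam (trans (subT-renT (liftR ρ) (liftS θ) t)
  (subT-cong (λ { vz → refl ; (vs v) → refl }) t))
subT-renT ρ θ (app t u) = cong₂ app (subT-renT ρ θ t) (subT-renT ρ θ u)

renT-renT : (ρ : Ren Γ Δ) (ρ' : Ren Δ Θ) (t : Tm Γ τ) →
  renT ρ' (renT ρ t) ≡ renT (ρ' ∘ ρ) t
renT-renT ρ ρ' t = begin
  renT ρ' (renT ρ t)       ≡⟨ renT-subT ρ' (renT ρ t) ⟩
  subT (var ∘ ρ') (renT ρ t) ≡⟨ subT-renT ρ (var ∘ ρ') t ⟩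
  subT (var ∘ ρ' ∘ ρ) t    ≡⟨ renT-subT (ρ' ∘ ρ) t ⟨
  renT (ρ' ∘ ρ) t          ∎ where open ≡-Reasoning

renT-wkT : (ρ : Ren Γ Δ) (t : Tm Γ τ) → renT (liftR {τ = σ} ρ) (wkT t) ≡ wkT (renT ρ t)
renT-wkT ρ t = trans (renT-renT vs (liftR ρ) t) (sym (renT-renT ρ vs t))

renT-subT-comm : (θ : Sub Γ Δ) (ρ : Ren Δ Θ) (t : Tm Γ τ) →
  renT ρ (subT θ t) ≡ subT (renT ρ ∘ θ) t
renT-subT-comm θ ρ (var v)   = refl
renT-subT-comm θ ρ (con c)   = refl
renT-subT-comm θ ρ (lam t)   = cong lam (trans (renT-subT-comm (liftS θ) (liftR ρ) t)
  (subT-cong (λ { vz → refl ; (vs v) → renT-wkT ρ (θ v) }) t))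
renT-subT-comm θ ρ (app t u) = cong₂ app (renT-subT-comm θ ρ t) (renT-subT-comm θ ρ u)

subT-wkT : (θ : Sub Γ Δ) (t : Tm Γ τ) → subT (liftS {τ = σ} θ) (wkT t) ≡ wkT (subT θ t)
subT-wkT θ t = trans (subT-renT vs (liftS θ) t) (sym (renT-subT-comm θ vs t))

liftS-⨟ : (θ : Sub Γ Δ) (θ' : Sub Δ Θ) → liftS {τ = τ} θ ⨟ liftS θ' ≗ˢ liftS (θ ⨟ θ')
liftS-⨟ θ θ' vz     = refl
liftS-⨟ θ θ' (vs v) = subT-wkT θ' (θ v)

subT-subT : (θ : Sub Γ Δ) (θ' : Sub Δ Θ) (t : Tm Γ τ) →
  subT θ' (subT θ t) ≡ subT (θ ⨟ θ') t
subT-subT θ θ' (var v)   = refl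
subT-subT θ θ' (con c)   = refl
subT-subT θ θ' (lam t)   = cong lam (trans (subT-subT (liftS θ) (liftS θ') t)
  (subT-cong (liftS-⨟ θ θ') t))
subT-subT θ θ' (app t u) = cong₂ app (subT-subT θ θ' t) (subT-subT θ θ' u)

sub0-wkT : (u : Tm Γ σ) (t : Tm Γ τ) → subT (sub0 u) (wkT t) ≡ t
sub0-wkT u t = trans (subT-renT vs (sub0 u) t) (subT-id (λ _ → refl) t)

subT-sub0 : (θ : Sub Γ Δ) (t : Tm (Γ ▸ σ) τ) (u : Tm Γ σ) →
  subT θ (subT (sub0 u) t) ≡ subT (sub0 (subT θ u)) (subT (liftS θ) t)
subT-sub0 θ t u = begin
  subT θ (subT (sub0 u) t)                    ≡⟨ subT-subT (sub0 u) θ t ⟩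
  subT (sub0 u ⨟ θ) t                         ≡⟨ subT-cong pointwise t ⟩
  subT (liftS θ ⨟ sub0 (subT θ u)) t          ≡⟨ subT-subT (liftS θ) (sub0 (subT θ u)) t ⟨
  subT (sub0 (subT θ u)) (subT (liftS θ) t)   ∎
  where
  open ≡-Reasoning
  pointwise : sub0 u ⨟ θ ≗ˢ liftS θ ⨟ sub0 (subT θ u)
  pointwise vz     = refl
  pointwise (vs v) = sym (sub0-wkT (subT θ u) (θ v))

subA-cong : {θ θ' : Sub Γ Δ} → θ ≗ˢ θ' → (ts : Args Γ τs) → subA θ ts ≡ subA θ' ts
subA-cong e []       = refl
subA-cong e (t ∷ ts) = cong₂ _∷_ (subT-cong e t) (subA-cong e ts)

subA-id : {θ : Sub Γ Γ} → θ ≗ˢ var → (ts : Args Γ τs) → subA θ ts ≡ ts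
subA-id e []       = refl
subA-id e (t ∷ ts) = cong₂ _∷_ (subT-id e t) (subA-id e ts)

renA-subA : (ρ : Ren Γ Δ) (ts : Args Γ τs) → renA ρ ts ≡ subA (var ∘ ρ) ts
renA-subA ρ []       = refl
renA-subA ρ (t ∷ ts) = cong₂ _∷_ (renT-subT ρ t) (renA-subA ρ ts)

subA-subA : (θ : Sub Γ Δ) (θ' : Sub Δ Θ) (ts : Args Γ τs) →
  subA θ' (subA θ ts) ≡ subA (θ ⨟ θ') ts
subA-subA θ θ' []       = refl
subA-subA θ θ' (t ∷ ts) = cong₂ _∷_ (subT-subT θ θ' t) (subA-subA θ θ' ts)

subF-cong : {θ θ' : Sub Γ Δ} → θ ≗ˢ θ' → (A : Fm Γ) → subF θ A ≡ subF θ' A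
subF-cong e ⊤̇           = refl
subF-cong e ⊥̇           = refl
subF-cong e (A ∧̇ B)     = cong₂ _∧̇_ (subF-cong e A) (subF-cong e B)
subF-cong e (A ∨̇ B)     = cong₂ _∨̇_ (subF-cong e A) (subF-cong e B)
subF-cong e (A ⊃̇ B)     = cong₂ _⊃̇_ (subF-cong e A) (subF-cong e B)
subF-cong e (∀̇ τ A)     = cong (∀̇ τ) (subF-cong (liftS-cong e) A)
subF-cong e (∃̇ τ A)     = cong (∃̇ τ) (subF-cong (liftS-cong e) A)
subF-cong e (∇̇ τ A)     = cong (∇̇ τ) (subF-cong (liftS-cong e) A)
subF-cong e (atom p ts) = cong (atom p) (subA-cong e ts)

liftS-id : {θ : Sub Γ Γ} → θ ≗ˢ var → liftS {τ = τ} θ ≗ˢ var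
liftS-id e vz     = refl
liftS-id e (vs v) = cong wkT (e v)

subF-id : {θ : Sub Γ Γ} → θ ≗ˢ var → (A : Fm Γ) → subF θ A ≡ A
subF-id e ⊤̇           = refl
subF-id e ⊥̇           = refl
subF-id e (A ∧̇ B)     = cong₂ _∧̇_ (subF-id e A) (subF-id e B)
subF-id e (A ∨̇ B)     = cong₂ _∨̇_ (subF-id e A) (subF-id e B)
subF-id e (A ⊃̇ B)     = cong₂ _⊃̇_ (subF-id e A) (subF-id e B)
subF-id e (∀̇ τ A)     = cong (∀̇ τ) (subF-id (liftS-id e) A)
subF-id e (∃̇ τ A)     = cong (∃̇ τ) (subF-id (liftS-id e) A)
subF-id e (∇̇ τ A)     = cong (∇̇ τ) (subF-id (liftS-id e) A)
subF-id e (atom p ts) = cong (atom p) (subA-id e ts)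

liftR-var : (ρ : Ren Γ Δ) → var ∘ liftR {τ = τ} ρ ≗ˢ liftS (var ∘ ρ)
liftR-var ρ vz     = refl
liftR-var ρ (vs v) = refl

renF-subF : (ρ : Ren Γ Δ) (A : Fm Γ) → renF ρ A ≡ subF (var ∘ ρ) A
renF-subF ρ ⊤̇           = refl
renF-subF ρ ⊥̇           = refl
renF-subF ρ (A ∧̇ B)     = cong₂ _∧̇_ (renF-subF ρ A) (renF-subF ρ B)
renF-subF ρ (A ∨̇ B)     = cong₂ _∨̇_ (renF-subF ρ A) (renF-subF ρ B)
renF-subF ρ (A ⊃̇ B)     = cong₂ _⊃̇_ (renF-subF ρ A) (renF-subF ρ B)
renF-subF ρ (∀̇ τ A)     = cong (∀̇ τ) (trans (renF-subF (liftR ρ) A) (subF-cong (liftR-var ρ) A))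
renF-subF ρ (∃̇ τ A)     = cong (∃̇ τ) (trans (renF-subF (liftR ρ) A) (subF-cong (liftR-var ρ) A))
renF-subF ρ (∇̇ τ A)     = cong (∇̇ τ) (trans (renF-subF (liftR ρ) A) (subF-cong (liftR-var ρ) A))
renF-subF ρ (atom p ts) = cong (atom p) (renA-subA ρ ts)

subF-subF : (θ : Sub Γ Δ) (θ' : Sub Δ Θ) (A : Fm Γ) →
  subF θ' (subF θ A) ≡ subF (θ ⨟ θ') A
subF-subF θ θ' ⊤̇           = refl
subF-subF θ θ' ⊥̇           = refl
subF-subF θ θ' (A ∧̇ B)     = cong₂ _∧̇_ (subF-subF θ θ' A) (subF-subF θ θ' B)
subF-subF θ θ' (A ∨̇ B)     = cong₂ _∨̇_ (subF-subF θ θ' A) (subF-subF θ θ' B)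
subF-subF θ θ' (A ⊃̇ B)     = cong₂ _⊃̇_ (subF-subF θ θ' A) (subF-subF θ θ' B)
subF-subF θ θ' (∀̇ τ A)     = cong (∀̇ τ) (trans (subF-subF (liftS θ) (liftS θ') A) (subF-cong (liftS-⨟ θ θ') A))
subF-subF θ θ' (∃̇ τ A)     = cong (∃̇ τ) (trans (subF-subF (liftS θ) (liftS θ') A) (subF-cong (liftS-⨟ θ θ') A))
subF-subF θ θ' (∇̇ τ A)     = cong (∇̇ τ) (trans (subF-subF (liftS θ) (liftS θ') A) (subF-cong (liftS-⨟ θ θ') A))
subF-subF θ θ' (atom p ts) = cong (atom p) (subA-subA θ θ' ts)

liftS*-cong : ∀ L {θ θ' : Sub Γ Δ} → θ ≗ˢ θ' → liftS* L θ ≗ˢ liftS* L θ'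
liftS*-cong ε       e = e
liftS*-cong (L ▸ τ) e = liftS-cong (liftS*-cong L e)

liftS*-id : ∀ L → liftS* {Γ} L var ≗ˢ var
liftS*-id ε       v = refl
liftS*-id (L ▸ τ) v = liftS-id (liftS*-id L) v

liftS*-⨟ : ∀ L (θ : Sub Γ Δ) (θ' : Sub Δ Θ) → liftS* L θ ⨟ liftS* L θ' ≗ˢ liftS* L (θ ⨟ θ')
liftS*-⨟ ε       θ θ' v = refl
liftS*-⨟ (L ▸ τ) θ θ' v =
  trans (liftS-⨟ (liftS* L θ) (liftS* L θ') v) (liftS-cong (liftS*-⨟ L θ θ') v)

liftR*-var : ∀ L (ρ : Ren Γ Δ) → var ∘ liftR* L ρ ≗ˢ liftS* L (var ∘ ρ)
liftR*-var ε       ρ v      = refl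
liftR*-var (L ▸ τ) ρ vz     = refl
liftR*-var (L ▸ τ) ρ (vs v) = cong wkT (liftR*-var L ρ v)

subT*-id : ∀ L (t : Tm (Σ ⧺ L) τ) → subT (liftS* L var) t ≡ t
subT*-id L t = subT-id (liftS*-id L) t

subT*-⨟ : ∀ L (δ : Sub Σ Σ') (δ' : Sub Σ' Σ'') (t : Tm (Σ ⧺ L) τ) →
  subT (liftS* L δ') (subT (liftS* L δ) t) ≡ subT (liftS* L (δ ⨟ δ')) t
subT*-⨟ L δ δ' t = trans (subT-subT _ _ t) (subT-cong (liftS*-⨟ L δ δ') t)

subLF-id : (G : LF Σ) → subLF var G ≡ G
subLF-id (L ▹ B) = cong (L ▹_) (subF-id (liftS*-id L) B)

subLF-⨟ : (δ : Sub Σ Σ') (δ' : Sub Σ' Σ'') (G : LF Σ) →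
  subLF δ' (subLF δ G) ≡ subLF (δ ⨟ δ') G
subLF-⨟ δ δ' (L ▹ B) = cong (L ▹_) (trans (subF-subF _ _ B) (subF-cong (liftS*-⨟ L δ δ') B))

renLF-subLF : (ρ : Ren Σ Σ') (G : LF Σ) → renLF ρ G ≡ subLF (var ∘ ρ) G
renLF-subLF ρ (L ▹ B) = cong (L ▹_) (trans (renF-subF _ B) (subF-cong (liftR*-var L ρ) B))

_[_]ᶜ : List (LF Σ) → Sub Σ Σ' → List (LF Σ')
Ψ [ δ ]ᶜ = map (subLF δ) Ψ

[]ᶜ-id : (Ψ : List (LF Σ)) → Ψ [ var ]ᶜ ≡ Ψ
[]ᶜ-id Ψ = trans (map-cong subLF-id Ψ) (map-id Ψ)

[]ᶜ-⨟ : (δ : Sub Σ Σ') (δ' : Sub Σ' Σ'') (Ψ : List (LF Σ)) →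
  (Ψ [ δ ]ᶜ) [ δ' ]ᶜ ≡ Ψ [ δ ⨟ δ' ]ᶜ
[]ᶜ-⨟ δ δ' Ψ = trans (sym (map-∘ Ψ)) (map-cong (subLF-⨟ δ δ') Ψ)

[]ᶜ-ren : (ρ : Ren Σ Σ') (Ψ : List (LF Σ)) → map (renLF ρ) Ψ ≡ Ψ [ var ∘ ρ ]ᶜ
[]ᶜ-ren ρ Ψ = map-cong (renLF-subLF ρ) Ψ

-- Conversion and weak-head normal forms

≡⇒≈ : {t u : Tm Γ τ} → t ≡ u → t ≈ u
≡⇒≈ refl = ≈refl

lam-β≡ : {t : Tm (Γ ▸ σ) τ} {u : Tm Γ σ} {t' : Tm Γ τ} → subT (sub0 u) t ≡ t' → app (lam t) u ≈ t'
lam-β≡ e = ≈trans ≈β (≡⇒≈ e)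

≈-subT : (θ : Sub Γ Δ) {t u : Tm Γ τ} → t ≈ u → subT θ t ≈ subT θ u
≈-subT θ ≈refl = ≈refl
≈-subT θ (≈sym e) = ≈sym (≈-subT θ e)
≈-subT θ (≈trans e e') = ≈trans (≈-subT θ e) (≈-subT θ e')
≈-subT θ (≈app e e') = ≈app (≈-subT θ e) (≈-subT θ e')
≈-subT θ (≈lam e) = ≈lam (≈-subT (liftS θ) e)
≈-subT θ (≈β {t = t} {u}) = lam-β≡ (sym (subT-sub0 θ t u))
≈-subT θ (≈η {t = t}) = ≈trans ≈η (≡⇒≈ (cong (λ s → lam (app s (var vz))) (sym (subT-wkT θ t))))

≈-renT : (ρ : Ren Γ Δ) {t u : Tm Γ τ} → t ≈ u → renT ρ t ≈ renT ρ u
≈-renT ρ {t} {u} e =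
  ≈trans (≡⇒≈ (renT-subT ρ t)) (≈trans (≈-subT (var ∘ ρ) e) (≡⇒≈ (sym (renT-subT ρ u))))

infix 4 _↦_ _↦*_ _≋_
data _↦_ : Tm Γ τ → Tm Γ τ → Set where
  beta : {t : Tm (Γ ▸ σ) τ} {u : Tm Γ σ} → app (lam t) u ↦ subT (sub0 u) t
  xi : {t t' : Tm Γ (σ ⇒ τ)} {u : Tm Γ σ} → t ↦ t' → app t u ↦ app t' u

_↦*_ : Tm Γ τ → Tm Γ τ → Set
_↦*_ = Star _↦_

-- Neutral terms with the same head, compared structurally along the spine and up to full conversion
-- in the arguments. In particular `t ≋ t` serves as the predicate that `t` is neutral.
data _≋_ : Tm Γ τ → Tm Γ τ → Set where
  var : (v : Γ ∋ τ) → var v ≋ var v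
  con : (c : Const τ) → con {Γ} c ≋ con c
  app : {t t' : Tm Γ (σ ⇒ τ)} {u u' : Tm Γ σ} → t ≋ t' → u ≈ u' → app t u ≋ app t' u'

≋-sym : {t u : Tm Γ τ} → t ≋ u → u ≋ t
≋-sym (var v)   = var v
≋-sym (con c)   = con c
≋-sym (app e a) = app (≋-sym e) (≈sym a)

≋-trans : {t u s : Tm Γ τ} → t ≋ u → u ≋ s → t ≋ s
≋-trans (var v)   (var .v)    = var v
≋-trans (con c)   (con .c)    = con c
≋-trans (app e a) (app e' a') = app (≋-trans e e') (≈trans a a')

≋-renT : (ρ : Ren Γ Δ) {t u : Tm Γ τ} → t ≋ u → renT ρ t ≋ renT ρ u
≋-renT ρ (var v)   = var (ρ v)
≋-renT ρ (con c)   = con c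
≋-renT ρ (app e a) = app (≋-renT ρ e) (≈-renT ρ a)

≋⇒≈ : {t u : Tm Γ τ} → t ≋ u → t ≈ u
≋⇒≈ (var v)   = ≈refl
≋⇒≈ (con c)   = ≈refl
≋⇒≈ (app e a) = ≈app (≋⇒≈ e) a

↦⇒≈ : {t u : Tm Γ τ} → t ↦ u → t ≈ u
↦⇒≈ beta     = ≈β
↦⇒≈ (xi r) = ≈app (↦⇒≈ r) ≈refl

↦*⇒≈ : {t u : Tm Γ τ} → t ↦* u → t ≈ u
↦*⇒≈ done     = ≈refl
↦*⇒≈ (r ◅ rs) = ≈trans (↦⇒≈ r) (↦*⇒≈ rs)

≋-irreducible : {t u s : Tm Γ τ} → t ≋ u → t ↦ s → ⊥
≋-irreducible (app e a) (xi r) = ≋-irreducible e r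

↦-deterministic : {t u s : Tm Γ τ} → t ↦ u → t ↦ s → u ≡ s
↦-deterministic beta     beta      = refl
↦-deterministic (xi r) (xi r') = cong (λ t → app t _) (↦-deterministic r r')

-- Weak-head reduction is deterministic, so both reducts lie on one path; the `≋` proofs witness
-- that each is neutral, hence the end of that path.
↦*-confluent : {t u u' s s' : Tm Γ τ} → t ↦* u → u ≋ u' → t ↦* s → s ≋ s' → u ≡ s
↦*-confluent done     e done      e' = refl
↦*-confluent done     e (r ◅ rs)  e' = ⊥-elim (≋-irreducible e r)
↦*-confluent (r ◅ rs) e done      e' = ⊥-elim (≋-irreducible e' r)
↦*-confluent (r ◅ rs) e (q ◅ qs)  e' with refl ← ↦-deterministic r q = ↦*-confluent rs e qs e'

renT-sub0 : (ρ : Ren Γ Δ) (t : Tm (Γ ▸ σ) τ) (u : Tm Γ σ) →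
  renT ρ (subT (sub0 u) t) ≡ subT (sub0 (renT ρ u)) (renT (liftR ρ) t)
renT-sub0 ρ t u = trans (renT-subT-comm (sub0 u) ρ t)
  (trans (subT-cong (λ { vz → refl ; (vs v) → refl }) t) (sym (subT-renT (liftR ρ) _ t)))

↦-renT : (ρ : Ren Γ Δ) {t u : Tm Γ τ} → t ↦ u → renT ρ t ↦ renT ρ u
↦-renT ρ (beta {t = t} {u}) = subst (app (lam (renT (liftR ρ) t)) (renT ρ u) ↦_) (sym (renT-sub0 ρ t u)) beta
↦-renT ρ (xi r)           = xi (↦-renT ρ r)

↦*-renT : (ρ : Ren Γ Δ) {t u : Tm Γ τ} → t ↦* u → renT ρ t ↦* renT ρ u
↦*-renT ρ done     = done
↦*-renT ρ (r ◅ rs) = ↦-renT ρ r ◅ ↦*-renT ρ rs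

↦-renT⁻ : (ρ : Ren Γ Δ) (t : Tm Γ τ) {u : Tm Δ τ} → renT ρ t ↦ u → ∃[ u' ] t ↦ u' × renT ρ u' ≡ u
↦-renT⁻ ρ (app (lam t) u) beta = _ , beta , renT-sub0 ρ t u
↦-renT⁻ ρ (app (var _) u) (xi ())
↦-renT⁻ ρ (app (con _) u) (xi ())
↦-renT⁻ ρ (app t@(app _ _) u) (xi r) with _ , r' , refl ← ↦-renT⁻ ρ t r = _ , xi r' , refl

↦*-renT⁻ : (ρ : Ren Γ Δ) (t : Tm Γ τ) {u : Tm Δ τ} → renT ρ t ↦* u → ∃[ u' ] t ↦* u' × renT ρ u' ≡ u
↦*-renT⁻ ρ t done = t , done , refl
↦*-renT⁻ ρ t (r ◅ rs) with t' , r' , refl ← ↦-renT⁻ ρ t r with u' , rs' , e ← ↦*-renT⁻ ρ t' rs =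
  u' , r' ◅ rs' , e

-- The logical relation underlying injectivity of ≈ on rigid terms: at base type, both
-- sides weak-head reduce to neutral terms with the same head and convertible arguments.
Whnf≈ : Tm Γ τ → Tm Γ τ → Set
Whnf≈ t u = ∃[ t' ] ∃[ u' ] t ↦* t' × u ↦* u' × t' ≋ u'

R : ∀ τ {Γ} → Tm Γ τ → Tm Γ τ → Set
R nm      t u = Whnf≈ t u
R pr      t u = Whnf≈ t u
R ac      t u = Whnf≈ t u
R (σ ⇒ τ) {Γ} t u = ∀ {Δ} (ρ : Ren Γ Δ) {a b : Tm Δ σ} → R σ a b →
  R τ (app (renT ρ t) a) (app (renT ρ u) b)

whnf≈-sym : {t u : Tm Γ τ} → Whnf≈ t u → Whnf≈ u t
whnf≈-sym (_ , _ , r , r' , e) = _ , _ , r' , r , ≋-sym e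

whnf≈-trans : {t u s : Tm Γ τ} → Whnf≈ t u → Whnf≈ u s → Whnf≈ t s
whnf≈-trans (_ , _ , r , r' , e) (_ , _ , q , q' , d)
  with refl ← ↦*-confluent r' (≋-sym e) q d = _ , _ , r , q' , ≋-trans e d

whnf≈-renT : (ρ : Ren Γ Δ) {t u : Tm Γ τ} → Whnf≈ t u → Whnf≈ (renT ρ t) (renT ρ u)
whnf≈-renT ρ (_ , _ , r , r' , e) = _ , _ , ↦*-renT ρ r , ↦*-renT ρ r' , ≋-renT ρ e

R-sym : ∀ τ {t u : Tm Γ τ} → R τ t u → R τ u t
R-sym nm      r = whnf≈-sym r
R-sym pr      r = whnf≈-sym r
R-sym ac      r = whnf≈-sym r
R-sym (σ ⇒ τ) r ρ e = R-sym τ (r ρ (R-sym σ e))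

R-trans : ∀ τ {t u s : Tm Γ τ} → R τ t u → R τ u s → R τ t s
R-trans nm      r q = whnf≈-trans r q
R-trans pr      r q = whnf≈-trans r q
R-trans ac      r q = whnf≈-trans r q
-- `R` is only a partial equivalence, but `b` is related to itself because it occurs in the related
-- pair `e`.
R-trans (σ ⇒ τ) r q ρ e = R-trans τ (r ρ e) (q ρ (R-trans σ (R-sym σ e) e))

R-renT : ∀ τ (ρ : Ren Γ Δ) {t u : Tm Γ τ} → R τ t u → R τ (renT ρ t) (renT ρ u)
R-renT nm      ρ r = whnf≈-renT ρ r
R-renT pr      ρ r = whnf≈-renT ρ r
R-renT ac      ρ r = whnf≈-renT ρ r
R-renT (σ ⇒ τ) ρ {t} {u} r ρ' {a} {b} e =
  subst₂ (λ f g → R τ (app f a) (app g b)) (sym (renT-renT ρ ρ' t)) (sym (renT-renT ρ ρ' u))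
    (r (ρ' ∘ ρ) e)

R-expand : ∀ τ {t t' u : Tm Γ τ} → t ↦ t' → R τ t' u → R τ t u
R-expand nm      q (_ , _ , r) = _ , _ , q ◅ proj₁ r , proj₂ r
R-expand pr      q (_ , _ , r) = _ , _ , q ◅ proj₁ r , proj₂ r
R-expand ac      q (_ , _ , r) = _ , _ , q ◅ proj₁ r , proj₂ r
R-expand (σ ⇒ τ) q r ρ e = R-expand τ (xi (↦-renT ρ q)) (r ρ e)

R-expandʳ : ∀ τ {t u u' : Tm Γ τ} → u ↦ u' → R τ t u' → R τ t u
R-expandʳ τ q r = R-sym τ (R-expand τ q (R-sym τ r))

reflect : ∀ τ {t u : Tm Γ τ} → t ≋ u → R τ t u
reify   : ∀ τ {t u : Tm Γ τ} → R τ t u → t ≈ u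

reflect nm      e = _ , _ , done , done , e
reflect pr      e = _ , _ , done , done , e
reflect ac      e = _ , _ , done , done , e
reflect (σ ⇒ τ) e ρ a = reflect τ (app (≋-renT ρ e) (reify σ a))

reify nm (_ , _ , r , r' , e) = ≈trans (↦*⇒≈ r) (≈trans (≋⇒≈ e) (≈sym (↦*⇒≈ r')))
reify pr (_ , _ , r , r' , e) = ≈trans (↦*⇒≈ r) (≈trans (≋⇒≈ e) (≈sym (↦*⇒≈ r')))
reify ac (_ , _ , r , r' , e) = ≈trans (↦*⇒≈ r) (≈trans (≋⇒≈ e) (≈sym (↦*⇒≈ r')))
-- Both sides are η-expanded and compared on a fresh variable. Quantifying `R` over renamings
-- provides the context containing it, which matters at `nm`, a type without closed terms.
reify (σ ⇒ τ) r = ≈trans ≈η (≈trans (≈lam (reify τ (r vs (reflect σ (var vz))))) (≈sym ≈η))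

RS : Sub Γ Δ → Sub Γ Δ → Set
RS {Γ} θ θ' = ∀ {τ} (v : Γ ∋ τ) → R τ (θ v) (θ' v)

RS-sym : {θ θ' : Sub Γ Δ} → RS θ θ' → RS θ' θ
RS-sym r v = R-sym _ (r v)

RS-left : {θ θ' : Sub Γ Δ} → RS θ θ' → RS θ θ
RS-left r v = R-trans _ (r v) (R-sym _ (r v))

RS-extend : {θ θ' : Sub Γ Δ} (ρ : Ren Δ Θ) {a b : Tm Θ σ} → RS θ θ' → R σ a b →
  RS ((renT ρ ∘ θ) ,ˢ a) ((renT ρ ∘ θ') ,ˢ b)
RS-extend ρ r e vz     = e
RS-extend ρ r e (vs v) = R-renT _ ρ (r v)

-- Contracting the β-redex of a renamed closure evaluates its body in an extended environment; this
-- is how the abstraction and η cases reach the induction hypothesis.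
β-closure : (θ : Sub Γ Δ) (ρ : Ren Δ Θ) (t : Tm (Γ ▸ σ) τ) (a : Tm Θ σ) →
  subT (sub0 a) (renT (liftR ρ) (subT (liftS θ) t)) ≡ subT ((renT ρ ∘ θ) ,ˢ a) t
β-closure θ ρ t a = begin
  subT (sub0 a) (renT (liftR ρ) (subT (liftS θ) t)) ≡⟨ cong (subT (sub0 a)) (renT-subT-comm (liftS θ) (liftR ρ) t) ⟩
  subT (sub0 a) (subT (renT (liftR ρ) ∘ liftS θ) t) ≡⟨ subT-subT _ (sub0 a) t ⟩
  subT ((renT (liftR ρ) ∘ liftS θ) ⨟ sub0 a) t      ≡⟨ subT-cong pointwise t ⟩
  subT ((renT ρ ∘ θ) ,ˢ a) t                        ∎
  where
  open ≡-Reasoning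
  pointwise : (renT (liftR ρ) ∘ liftS θ) ⨟ sub0 a ≗ˢ (renT ρ ∘ θ) ,ˢ a
  pointwise vz     = refl
  pointwise (vs v) = trans (cong (subT (sub0 a)) (renT-wkT ρ (θ v))) (sub0-wkT a (renT ρ (θ v)))

R-lam : ∀ {σ τ} {θ θ' : Sub Γ Δ} {t u : Tm (Γ ▸ σ) τ} →
  (∀ {Θ} {φ φ' : Sub (Γ ▸ σ) Θ} → RS φ φ' → R τ (subT φ t) (subT φ' u)) →
  RS θ θ' → R (σ ⇒ τ) (subT θ (lam t)) (subT θ' (lam u))
R-lam {θ = θ} {θ'} {t} {u} h r ρ {a} {b} e = R-expand _ beta (R-expandʳ _ beta
  (subst₂ (R _) (sym (β-closure θ ρ t a)) (sym (β-closure θ' ρ u b)) (h (RS-extend ρ r e))))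

renT-id : (t : Tm Γ τ) → renT id t ≡ t
renT-id t = trans (renT-subT id t) (subT-id (λ _ → refl) t)

R-app : {t t' : Tm Γ (σ ⇒ τ)} {u u' : Tm Γ σ} → R (σ ⇒ τ) t t' → R σ u u' → R τ (app t u) (app t' u')
R-app {τ = τ} {t = t} {t'} {u} {u'} r e =
  subst₂ (λ f g → R τ (app f u) (app g u')) (renT-id t) (renT-id t') (r id e)

fundamentalT : (t : Tm Γ τ) {θ θ' : Sub Γ Δ} → RS θ θ' → R τ (subT θ t) (subT θ' t)
fundamentalT (var v)   r = r v
fundamentalT (con c)   r = reflect _ (con c)
fundamentalT (lam t)   r = R-lam {t = t} {t} (fundamentalT t) r
fundamentalT (app t u) r = R-app (fundamentalT t r) (fundamentalT u r)

fundamental : {t u : Tm Γ τ} → t ≈ u → {θ θ' : Sub Γ Δ} → RS θ θ' → R τ (subT θ t) (subT θ' u)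
fundamental (≈refl {t = t}) r = fundamentalT t r
fundamental (≈sym e) {θ} r = R-sym _ (fundamental e (RS-sym {θ = θ} r))
-- The middle term is taken under `θ'`-free data on the left, i.e. under `θ` on both sides of `e`,
-- so that `e'` alone crosses from `θ` to `θ'`.
fundamental (≈trans e e') {θ' = θ'} r = R-trans _ (fundamental e (RS-left {θ' = θ'} r)) (fundamental e' r)
fundamental (≈app e e') r = R-app (fundamental e r) (fundamental e' r)
fundamental (≈lam {t = t} {t'} e) r = R-lam {t = t} {t'} (fundamental e) r
fundamental (≈β {t = t} {u}) {θ} {θ'} r =
  R-expand _ beta (subst₂ (R _) (cong-sub θ) (sym (subT-subT (sub0 u) θ' t))
    (fundamentalT t λ { vz → fundamentalT u r ; (vs v) → r v }))
  where
  cong-sub : (θ : Sub _ _) → subT (θ ,ˢ subT θ u) t ≡ subT (sub0 (subT θ u)) (subT (liftS θ) t)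
  cong-sub θ = trans
    (subT-cong (λ { vz → refl ; (vs v) → sym (sub0-wkT (subT θ u) (θ v)) }) t)
    (sym (subT-subT (liftS θ) (sub0 (subT θ u)) t))
fundamental (≈η {σ = σ} {τ} {t = t}) {θ} {θ'} r ρ {a} {b} e =
  R-expandʳ τ beta (subst (λ s → R τ _ (app s b)) (sym lem) (fundamentalT t r ρ e))
  where
  lem : subT (sub0 b) (renT (liftR ρ) (subT (liftS θ') (wkT t))) ≡ renT ρ (subT θ' t)
  lem = trans (β-closure θ' ρ (wkT t) b)
    (trans (subT-renT vs _ t) (sym (renT-subT-comm θ' ρ t)))

≈⇒R : {t u : Tm Γ τ} → t ≈ u → R τ t u
≈⇒R {t = t} {u} e = subst₂ (R _) (subT-id (λ _ → refl) t) (subT-id (λ _ → refl) u)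
  (fundamental e (λ v → reflect _ (var v)))

-- Injectivity and distinctness of rigid terms modulo conversion

variable
  m n k : ℕ

data Base : Ty → Set where
  nm : Base nm
  pr : Base pr
  ac : Base ac

≈⇒whnf≈ : Base τ → {t u : Tm Γ τ} → t ≈ u → Whnf≈ t u
≈⇒whnf≈ nm = ≈⇒R
≈⇒whnf≈ pr = ≈⇒R
≈⇒whnf≈ ac = ≈⇒R

≋-↦* : {t u s : Tm Γ τ} → t ≋ u → t ↦* s → t ≡ s
≋-↦* e done    = refl
≋-↦* e (r ◅ _) = ⊥-elim (≋-irreducible e r)

-- Neutral terms do not weak-head reduce, so the normal forms supplied by the logical relation are
-- the given terms themselves.
≈⇒≋ : Base τ → {t u : Tm Γ τ} → t ≋ t → u ≋ u → t ≈ u → t ≋ u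
≈⇒≋ b t≋ u≋ e with _ , _ , r , r' , q ← ≈⇒whnf≈ b e
  with refl ← ≋-↦* t≋ r | refl ← ≋-↦* u≋ r' = q

con-inj₁ : Base τ → {c : Const (σ ⇒ τ)} {a a' : Tm Γ σ} → con c · a ≈ con c · a' → a ≈ a'
con-inj₁ b e with app (con _) p ← ≈⇒≋ b (app (con _) ≈refl) (app (con _) ≈refl) e = p

con-inj₂ : Base τ → ∀ {σ₁ σ₂} {c : Const (σ₁ ⇒ σ₂ ⇒ τ)} {a₁ a₁' : Tm Γ σ₁} {a₂ a₂' : Tm Γ σ₂} →
  con c · a₁ · a₂ ≈ con c · a₁' · a₂' → a₁ ≈ a₁' × a₂ ≈ a₂'
con-inj₂ b e with app (app (con _) p) q ←
  ≈⇒≋ b (app (app (con _) ≈refl) ≈refl) (app (app (con _) ≈refl) ≈refl) e = p , q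

con-inj₃ : Base τ → ∀ {σ₁ σ₂ σ₃} {c : Const (σ₁ ⇒ σ₂ ⇒ σ₃ ⇒ τ)}
  {a₁ a₁' : Tm Γ σ₁} {a₂ a₂' : Tm Γ σ₂} {a₃ a₃' : Tm Γ σ₃} →
  con c · a₁ · a₂ · a₃ ≈ con c · a₁' · a₂' · a₃' → a₁ ≈ a₁' × a₂ ≈ a₂' × a₃ ≈ a₃'
con-inj₃ b e with app (app (app (con _) p) q) r ←
  ≈⇒≋ b (app (app (app (con _) ≈refl) ≈refl) ≈refl) (app (app (app (con _) ≈refl) ≈refl) ≈refl) e = p , q , r

-- Tags for the head constants of processes. The action constants share one tag, since tags are
-- compared only to match a process against the first argument of a clause head.
data Op : Set where
  o-nil o-sum o-par o-tau o-match o-out o-inp o-new o-act : Op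

opC : Const τ → Op
opC c𝟘     = o-nil
opC c+     = o-sum
opC c∣     = o-par
opC cτ     = o-tau
opC cmatch = o-match
opC cout   = o-out
opC cin    = o-inp
opC cν     = o-new
opC aτ     = o-act
opC a↓     = o-act
opC a↑     = o-act

opT : Tm Γ τ → Maybe Op
opT (var v)   = nothing
opT (con c)   = just (opC c)
opT (lam t)   = nothing
opT (app t u) = opT t

rigid : ∀ {o} (t : Tm Γ τ) → opT t ≡ just o → t ≋ t
rigid (con c)   e = con c
rigid (app t u) e = app (rigid t e) ≈refl

≋⇒op : {t u : Tm Γ τ} → t ≋ u → opT t ≡ opT u
≋⇒op (var v)   = refl
≋⇒op (con c)   = refl
≋⇒op (app e _) = ≋⇒op e

op-unique : ∀ {o o'} {t u : Tm Γ pr} → opT t ≡ just o → opT u ≡ just o' → t ≈ u → o ≡ o'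
op-unique {t = t} {u} p q e with trans (sym p) (trans (≋⇒op (≈⇒≋ pr (rigid t p) (rigid u q) e)) q)
... | refl = refl

-- `liftR vs` keeps the last variable and `vs` moves it, while both agree on weakened terms. So a
-- term convertible to a weakened one cannot tell them apart, and an occurrence of the last variable
-- in an injective position would give `v0 ≈ v1`.
wk-fresh : {a : Tm Γ τ} {t : Tm (Γ ▸ σ) τ} → wkT a ≈ t → renT (liftR {τ = σ} vs) t ≈ renT vs t
wk-fresh {a = a} e = ≈trans (≈sym (≈-renT (liftR vs) e)) (≈trans (≡⇒≈ (renT-wkT vs a)) (≈-renT vs e))

v0≉v1 : var {Γ ▸ nm ▸ nm} vz ≈ var (vs vz) → ⊥
v0≉v1 e with ≈⇒≋ nm (var _) (var _) e
... | ()

wk≉v0 : {a : Tm Γ nm} → wkT a ≈ var vz → ⊥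
wk≉v0 {a = a} e = v0≉v1 (wk-fresh {a = a} e)

-- The type σ must be inhabited in Γ, which for σ = nm is not automatic.
wk-inj : {a b : Tm Γ τ} → Tm Γ σ → wkT {ρ = σ} a ≈ wkT b → a ≈ b
wk-inj {a = a} {b} s e = ≈trans (≡⇒≈ (sym (sub0-wkT s a))) (≈trans (≈-subT (sub0 s) e) (≡⇒≈ (sub0-wkT s b)))

wk-inj-aτ : {a : Tm Γ ac} → wkT {ρ = σ} a ≈ con aτ → a ≈ con aτ
wk-inj-aτ {a = a} e with ≈⇒whnf≈ ac e
... | t' , u' , r , r' , q with refl ← ≋-↦* (con aτ) r' with a' , r″ , e' ← ↦*-renT⁻ vs a r =
  ≈trans (↦*⇒≈ r″) (≡⇒≈ (lem a' e' q))
  where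
  lem : ∀ {t'} (a' : Tm _ ac) → wkT a' ≡ t' → t' ≋ con aτ → a' ≡ con aτ
  lem (con aτ) e (con .aτ) = refl

-- Encoding of processes and actions under a name assignment

infixl 5 _,ⁿ_
_,ⁿ_ : (Fin n → Tm Γ τ) → Tm Γ τ → Fin (suc n) → Tm Γ τ
(θ ,ⁿ t) zero    = t
(θ ,ⁿ t) (suc i) = θ i

liftN : (Fin n → Tm Γ nm) → Fin (suc n) → Tm (Γ ▸ nm) nm
liftN θ = (wkT ∘ θ) ,ⁿ v0

enc : (Fin n → Tm Γ nm) → Proc n → Tm Γ pr
enc θ 𝟘             = con c𝟘
enc θ (P ⊕ Q)       = con c+ · enc θ P · enc θ Q
enc θ (P ∥ Q)       = con c∣ · enc θ P · enc θ Q
enc θ (τ∙ P)        = con cτ · enc θ P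
enc θ ([ x ≐ y ] P) = con cmatch · θ x · θ y · enc θ P
enc θ (out x y P)   = con cout · θ x · θ y · enc θ P
enc θ (inp x P)     = con cin · θ x · lam (enc (liftN θ) P)
enc θ (new P)       = con cν · lam (enc (liftN θ) P)

-- A bound action is encoded without its bound name, as a term of type nm ⇒ ac.
encA : (Fin n → Tm Γ nm) → FAct n → Tm Γ ac
encA θ τₐ      = con aτ
encA θ (ō x y) = con a↑ · θ x · θ y

encB : (Fin n → Tm Γ nm) → BAct n → Tm Γ (nm ⇒ ac)
encB θ (ι x)  = con a↓ · θ x
encB θ (ōν x) = con a↑ · θ x

infix 4 _≈ⁿ_
_≈ⁿ_ : (Fin n → Tm Γ nm) → (Fin n → Tm Γ nm) → Set
θ ≈ⁿ θ' = ∀ i → θ i ≈ θ' i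

liftN-cong : {θ θ' : Fin n → Tm Γ nm} → θ ≈ⁿ θ' → liftN θ ≈ⁿ liftN θ'
liftN-cong e zero    = ≈refl
liftN-cong e (suc i) = ≈-renT vs (e i)

enc-cong : {θ θ' : Fin n → Tm Γ nm} → θ ≈ⁿ θ' → (P : Proc n) → enc θ P ≈ enc θ' P
enc-cong e 𝟘             = ≈refl
enc-cong e (P ⊕ Q)       = ≈app (≈app ≈refl (enc-cong e P)) (enc-cong e Q)
enc-cong e (P ∥ Q)       = ≈app (≈app ≈refl (enc-cong e P)) (enc-cong e Q)
enc-cong e (τ∙ P)        = ≈app ≈refl (enc-cong e P)
enc-cong e ([ x ≐ y ] P) = ≈app (≈app (≈app ≈refl (e x)) (e y)) (enc-cong e P)
enc-cong e (out x y P)   = ≈app (≈app (≈app ≈refl (e x)) (e y)) (enc-cong e P)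
enc-cong e (inp x P)     = ≈app (≈app ≈refl (e x)) (≈lam (enc-cong (liftN-cong e) P))
enc-cong e (new P)       = ≈app ≈refl (≈lam (enc-cong (liftN-cong e) P))

encA-cong : {θ θ' : Fin n → Tm Γ nm} → θ ≈ⁿ θ' → (α : FAct n) → encA θ α ≈ encA θ' α
encA-cong e τₐ      = ≈refl
encA-cong e (ō x y) = ≈app (≈app ≈refl (e x)) (e y)

encB-cong : {θ θ' : Fin n → Tm Γ nm} → θ ≈ⁿ θ' → (α : BAct n) → encB θ α ≈ encB θ' α
encB-cong e (ι x)  = ≈app ≈refl (e x)
encB-cong e (ōν x) = ≈app ≈refl (e x)

liftN-subT : (δ : Sub Γ Δ) (θ : Fin n → Tm Γ nm) → subT (liftS δ) ∘ liftN θ ≈ⁿ liftN (subT δ ∘ θ)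
liftN-subT δ θ zero    = ≈refl
liftN-subT δ θ (suc i) = ≡⇒≈ (subT-wkT δ (θ i))

enc-subT : (δ : Sub Γ Δ) (θ : Fin n → Tm Γ nm) (P : Proc n) → subT δ (enc θ P) ≈ enc (subT δ ∘ θ) P
enc-subT δ θ 𝟘             = ≈refl
enc-subT δ θ (P ⊕ Q)       = ≈app (≈app ≈refl (enc-subT δ θ P)) (enc-subT δ θ Q)
enc-subT δ θ (P ∥ Q)       = ≈app (≈app ≈refl (enc-subT δ θ P)) (enc-subT δ θ Q)
enc-subT δ θ (τ∙ P)        = ≈app ≈refl (enc-subT δ θ P)
enc-subT δ θ ([ x ≐ y ] P) = ≈app ≈refl (enc-subT δ θ P)
enc-subT δ θ (out x y P)   = ≈app ≈refl (enc-subT δ θ P)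
enc-subT δ θ (inp x P)     =
  ≈app ≈refl (≈lam (≈trans (enc-subT (liftS δ) (liftN θ) P) (enc-cong (liftN-subT δ θ) P)))
enc-subT δ θ (new P)       =
  ≈app ≈refl (≈lam (≈trans (enc-subT (liftS δ) (liftN θ) P) (enc-cong (liftN-subT δ θ) P)))

liftN-ext : (θ : Fin n → Tm Γ nm) (ρ : Fin m → Fin n) → liftN θ ∘ ext ρ ≈ⁿ liftN (θ ∘ ρ)
liftN-ext θ ρ zero    = ≈refl
liftN-ext θ ρ (suc i) = ≈refl

enc-ren : (θ : Fin n → Tm Γ nm) (ρ : Fin m → Fin n) (P : Proc m) → enc θ (ren ρ P) ≈ enc (θ ∘ ρ) P
enc-ren θ ρ 𝟘             = ≈refl
enc-ren θ ρ (P ⊕ Q)       = ≈app (≈app ≈refl (enc-ren θ ρ P)) (enc-ren θ ρ Q)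
enc-ren θ ρ (P ∥ Q)       = ≈app (≈app ≈refl (enc-ren θ ρ P)) (enc-ren θ ρ Q)
enc-ren θ ρ (τ∙ P)        = ≈app ≈refl (enc-ren θ ρ P)
enc-ren θ ρ ([ x ≐ y ] P) = ≈app ≈refl (enc-ren θ ρ P)
enc-ren θ ρ (out x y P)   = ≈app ≈refl (enc-ren θ ρ P)
enc-ren θ ρ (inp x P)     = ≈app ≈refl (≈lam (≈trans (enc-ren (liftN θ) (ext ρ) P) (enc-cong (liftN-ext θ ρ) P)))
enc-ren θ ρ (new P)       = ≈app ≈refl (≈lam (≈trans (enc-ren (liftN θ) (ext ρ) P) (enc-cong (liftN-ext θ ρ) P)))

⟦⟧≈enc : (P : Proc n) → ⟦ P ⟧ ≈ enc nameVar P
⟦⟧≈enc 𝟘             = ≈refl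
⟦⟧≈enc (P ⊕ Q)       = ≈app (≈app ≈refl (⟦⟧≈enc P)) (⟦⟧≈enc Q)
⟦⟧≈enc (P ∥ Q)       = ≈app (≈app ≈refl (⟦⟧≈enc P)) (⟦⟧≈enc Q)
⟦⟧≈enc (τ∙ P)        = ≈app ≈refl (⟦⟧≈enc P)
⟦⟧≈enc ([ x ≐ y ] P) = ≈app ≈refl (⟦⟧≈enc P)
⟦⟧≈enc (out x y P)   = ≈app ≈refl (⟦⟧≈enc P)
⟦⟧≈enc (inp x P)     = ≈app ≈refl (≈lam (≈trans (⟦⟧≈enc P) (enc-cong (λ { zero → ≈refl ; (suc i) → ≈refl }) P)))
⟦⟧≈enc (new P)       = ≈app ≈refl (≈lam (≈trans (⟦⟧≈enc P) (enc-cong (λ { zero → ≈refl ; (suc i) → ≈refl }) P)))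

enc-inst : (θ : Fin n → Tm Γ nm) (t : Tm Γ nm) (P : Proc (suc n)) →
  lam (enc (liftN θ) P) · t ≈ enc (θ ,ⁿ t) P
enc-inst θ t P = ≈trans ≈β (≈trans (enc-subT (sub0 t) (liftN θ) P)
  (enc-cong (λ { zero → ≈refl ; (suc i) → ≡⇒≈ (sub0-wkT t (θ i)) }) P))

enc-wk : (θ : Fin n → Tm Γ nm) (P : Proc n) → wkT {ρ = σ} (enc θ P) ≈ enc (wkT ∘ θ) P
enc-wk θ P = ≈trans (≡⇒≈ (renT-subT vs (enc θ P))) (≈trans (enc-subT (λ v → var (vs v)) θ P)
  (enc-cong (λ i → ≡⇒≈ (sym (renT-subT vs (θ i)))) P))

encA-subT : (δ : Sub Γ Δ) (θ : Fin n → Tm Γ nm) (α : FAct n) → subT δ (encA θ α) ≡ encA (subT δ ∘ θ) α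
encA-subT δ θ τₐ      = refl
encA-subT δ θ (ō x y) = refl

encB-subT : (δ : Sub Γ Δ) (θ : Fin n → Tm Γ nm) (α : BAct n) → subT δ (encB θ α) ≡ encB (subT δ ∘ θ) α
encB-subT δ θ (ι x)  = refl
encB-subT δ θ (ōν x) = refl

encA-wk : (θ : Fin n → Tm Γ nm) (α : FAct n) → encA (liftN θ) (renFA suc α) ≡ wkT (encA θ α)
encA-wk θ τₐ      = refl
encA-wk θ (ō x y) = refl

encB-wk : (θ : Fin n → Tm Γ nm) (α : BAct n) → encB (liftN θ) (renBA suc α) ≡ wkT (encB θ α)
encB-wk θ (ι x)  = refl
encB-wk θ (ōν x) = refl

-- Inversion of neutral terms is available at base types only, so both sides are first applied to a
-- name; `x` is the one at hand.
con-inj-⇒ : ∀ {c : Const (nm ⇒ nm ⇒ ac)} {x y : Tm Γ nm} → con c · x ≈ con c · y → x ≈ y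
con-inj-⇒ {x = x} e = proj₁ (con-inj₂ ac (≈app {u = x} e ≈refl))

-- This recovers the side condition of the restriction rule: an action convertible to one weakened
-- past the restricted name cannot mention that name, by `wk-fresh`.
encA-wk⁻ : (θ : Fin n → Tm Γ nm) (α : FAct (suc n)) {a : Tm Γ ac} → wkT a ≈ encA (liftN θ) α →
  ∃[ α' ] α ≡ renFA suc α' × a ≈ encA θ α'
encA-wk⁻ θ τₐ e = τₐ , refl , wk-inj-aτ e
encA-wk⁻ θ (ō zero y) {a} e = ⊥-elim (v0≉v1 (proj₁ (con-inj₂ ac (wk-fresh {a = a} e))))
encA-wk⁻ θ (ō (suc x) zero) {a} e = ⊥-elim (v0≉v1 (proj₂ (con-inj₂ ac (wk-fresh {a = a} e))))
encA-wk⁻ θ (ō (suc x) (suc y)) e = ō x y , refl , wk-inj (θ x) e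

encB-wk⁻ : (θ : Fin n → Tm Γ nm) (α : BAct (suc n)) {a : Tm Γ (nm ⇒ ac)} → wkT a ≈ encB (liftN θ) α →
  ∃[ α' ] α ≡ renBA suc α' × a ≈ encB θ α'
encB-wk⁻ θ (ι zero) {a} e = ⊥-elim (v0≉v1 (con-inj-⇒ (wk-fresh {a = a} e)))
encB-wk⁻ θ (ι (suc x)) e = ι x , refl , wk-inj (θ x) e
encB-wk⁻ θ (ōν zero) {a} e = ⊥-elim (v0≉v1 (con-inj-⇒ (wk-fresh {a = a} e)))
encB-wk⁻ θ (ōν (suc x)) e = ōν x , refl , wk-inj (θ x) e

-- Renaming of processes and transitions

ext-cong : {ρ ρ' : Fin n → Fin m} → ρ ≗ ρ' → ext ρ ≗ ext ρ'
ext-cong e zero    = refl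
ext-cong e (suc i) = cong suc (e i)

ren-cong : {ρ ρ' : Fin n → Fin m} → ρ ≗ ρ' → ren ρ ≗ ren ρ'
ren-cong e 𝟘             = refl
ren-cong e (P ⊕ Q)       = cong₂ _⊕_ (ren-cong e P) (ren-cong e Q)
ren-cong e (P ∥ Q)       = cong₂ _∥_ (ren-cong e P) (ren-cong e Q)
ren-cong e (τ∙ P)        = cong τ∙_ (ren-cong e P)
ren-cong e ([ x ≐ y ] P) rewrite e x | e y = cong ([ _ ≐ _ ]_) (ren-cong e P)
ren-cong e (out x y P)   rewrite e x | e y = cong (out _ _) (ren-cong e P)
ren-cong e (inp x P)     = cong₂ inp (e x) (ren-cong (ext-cong e) P)
ren-cong e (new P)       = cong new (ren-cong (ext-cong e) P)

ext-∘ : (ρ' : Fin m → Fin k) (ρ : Fin n → Fin m) → ext ρ' ∘ ext ρ ≗ ext (ρ' ∘ ρ)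
ext-∘ ρ' ρ zero    = refl
ext-∘ ρ' ρ (suc i) = refl

ren-∘ : (ρ' : Fin m → Fin k) (ρ : Fin n → Fin m) (P : Proc n) → ren ρ' (ren ρ P) ≡ ren (ρ' ∘ ρ) P
ren-∘ ρ' ρ 𝟘             = refl
ren-∘ ρ' ρ (P ⊕ Q)       = cong₂ _⊕_ (ren-∘ ρ' ρ P) (ren-∘ ρ' ρ Q)
ren-∘ ρ' ρ (P ∥ Q)       = cong₂ _∥_ (ren-∘ ρ' ρ P) (ren-∘ ρ' ρ Q)
ren-∘ ρ' ρ (τ∙ P)        = cong τ∙_ (ren-∘ ρ' ρ P)
ren-∘ ρ' ρ ([ x ≐ y ] P) = cong ([ _ ≐ _ ]_) (ren-∘ ρ' ρ P)
ren-∘ ρ' ρ (out x y P)   = cong (out _ _) (ren-∘ ρ' ρ P)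
ren-∘ ρ' ρ (inp x P)     = cong (inp _) (trans (ren-∘ (ext ρ') (ext ρ) P) (ren-cong (ext-∘ ρ' ρ) P))
ren-∘ ρ' ρ (new P)       = cong new (trans (ren-∘ (ext ρ') (ext ρ) P) (ren-cong (ext-∘ ρ' ρ) P))

ren-comm : ∀ {n m m' k} {f : Fin m → Fin k} {g : Fin n → Fin m} {f' : Fin m' → Fin k} {g' : Fin n → Fin m'} →
  f ∘ g ≗ f' ∘ g' → (P : Proc n) → ren f (ren g P) ≡ ren f' (ren g' P)
ren-comm e P = trans (ren-∘ _ _ P) (trans (ren-cong e P) (sym (ren-∘ _ _ P)))

renFA-suc : (ρ : Fin n → Fin m) (α : FAct n) → renFA (ext ρ) (renFA suc α) ≡ renFA suc (renFA ρ α)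
renFA-suc ρ τₐ      = refl
renFA-suc ρ (ō x y) = refl

renBA-suc : (ρ : Fin n → Fin m) (α : BAct n) → renBA (ext ρ) (renBA suc α) ≡ renBA suc (renBA ρ α)
renBA-suc ρ (ι x)  = refl
renBA-suc ρ (ōν x) = refl

ext-inst : (ρ : Fin n → Fin m) (y : Fin n) → inst (ρ y) ∘ ext ρ ≗ ρ ∘ inst y
ext-inst ρ y zero    = refl
ext-inst ρ y (suc i) = refl

ext-swap : (ρ : Fin n → Fin m) → swap ∘ ext (ext ρ) ≗ ext (ext ρ) ∘ swap
ext-swap ρ zero          = refl
ext-swap ρ (suc zero)    = refl
ext-swap ρ (suc (suc i)) = refl

-- No transition rule tests names for being different, so even a non-injective `ρ` preserves
-- transitions. This is what allows names to be merged after a transition has been found.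
—→-ren : (ρ : Fin n → Fin m) {P : Proc n} {α : FAct n} {P' : Proc n} →
  P —[ α ]→ P' → ren ρ P —[ renFA ρ α ]→ ren ρ P'
—→ᵇ-ren : (ρ : Fin n → Fin m) {P : Proc n} {α : BAct n} {P' : Proc (suc n)} →
  P —[ α ]→ᵇ P' → ren ρ P —[ renBA ρ α ]→ᵇ ren (ext ρ) P'

—→-ren ρ tau       = tau
—→-ren ρ output    = output
—→-ren ρ (match t) = match (—→-ren ρ t)
—→-ren ρ (sumˡ t)  = sumˡ (—→-ren ρ t)
—→-ren ρ (sumʳ t)  = sumʳ (—→-ren ρ t)
—→-ren ρ (parˡ t)  = parˡ (—→-ren ρ t)
—→-ren ρ (parʳ t)  = parʳ (—→-ren ρ t)
—→-ren ρ (comˡ {y = y} {Q' = Q'} t s) =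
  subst (λ R → _ —[ τₐ ]→ _ ∥ R) (ren-comm (ext-inst ρ y) Q') (comˡ (—→-ren ρ t) (—→ᵇ-ren ρ s))
—→-ren ρ (comʳ {y = y} {P' = P'} t s) =
  subst (λ R → _ —[ τₐ ]→ R ∥ _) (ren-comm (ext-inst ρ y) P') (comʳ (—→ᵇ-ren ρ t) (—→-ren ρ s))
—→-ren ρ (closeˡ t s) = closeˡ (—→ᵇ-ren ρ t) (—→ᵇ-ren ρ s)
—→-ren ρ (closeʳ t s) = closeʳ (—→ᵇ-ren ρ t) (—→ᵇ-ren ρ s)
—→-ren ρ (res {α = α} t) = res (subst (λ a → _ —[ a ]→ _) (renFA-suc ρ α) (—→-ren (ext ρ) t))

—→ᵇ-ren ρ input     = input
—→ᵇ-ren ρ (match t) = match (—→ᵇ-ren ρ t)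
—→ᵇ-ren ρ (sumˡ t)  = sumˡ (—→ᵇ-ren ρ t)
—→ᵇ-ren ρ (sumʳ t)  = sumʳ (—→ᵇ-ren ρ t)
—→ᵇ-ren ρ (parˡ {P = P} {Q} t) =
  subst (λ R → ren ρ P ∥ ren ρ Q —[ _ ]→ᵇ _ ∥ R) (ren-comm (λ _ → refl) Q) (parˡ (—→ᵇ-ren ρ t))
—→ᵇ-ren ρ (parʳ {P = P} {Q} t) =
  subst (λ R → ren ρ P ∥ ren ρ Q —[ _ ]→ᵇ R ∥ _) (ren-comm (λ _ → refl) P) (parʳ (—→ᵇ-ren ρ t))
—→ᵇ-ren ρ (res {β = α} {P' = P'} t) =
  subst (λ R → _ —[ _ ]→ᵇ new R) (ren-comm (ext-swap ρ) P')
    (res (subst (λ a → _ —[ a ]→ᵇ _) (renBA-suc ρ α) (—→ᵇ-ren (ext ρ) t)))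
—→ᵇ-ren ρ (open' t) = open' (—→-ren (ext ρ) t)

-- Derived sequent rules

private variable
  L : Ctx
  Ψ : List (LF Σ)
  G : LF Σ

wkS : Sub Γ (Γ ▸ τ)
wkS v = var (vs v)

⊩-id : {Ψ : List (LF Σ)} {G : LF Σ} → Σ ⊩ Ψ [ var ]ᶜ ⊢ subLF var G → Σ ⊩ Ψ ⊢ G
⊩-id {Ψ = Ψ} {G} = subst₂ (_ ⊩_⊢_) ([]ᶜ-id Ψ) (subLF-id G)

⊩-⨟ : {δ : Sub Σ Σ'} {δ' : Sub Σ' Σ''} {Ψ : List (LF Σ)} {G : LF Σ} →
  Σ'' ⊩ Ψ [ δ ⨟ δ' ]ᶜ ⊢ subLF (δ ⨟ δ') G → Σ'' ⊩ (Ψ [ δ ]ᶜ) [ δ' ]ᶜ ⊢ subLF δ' (subLF δ G)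
⊩-⨟ {δ = δ} {δ'} {Ψ} {G} = subst₂ (_ ⊩_⊢_) (sym ([]ᶜ-⨟ δ δ' Ψ)) (sym (subLF-⨟ δ δ' G))

∧L : ∀ {A B : Fm (Σ ⧺ L)} → Σ ⊩ (L ▹ A) ∷ (L ▹ B) ∷ Ψ ⊢ G → Σ ⊩ (L ▹ A ∧̇ B) ∷ Ψ ⊢ G
∧L d = contr (∧L₁ (exch (Perm.swap _ _ ↭-refl) (∧L₂ (exch (Perm.swap _ _ ↭-refl) d))))

module _ {Σ L X : Ctx} (s : Sub X (Σ ⧺ L)) {τ : Ty} (B : Fm (X ▸ τ)) where

  raise-closure : subF (raiseInst L) (subF (liftS s) B) ≡
    subF ((s ⨟ liftS* L wkS) ,ˢ appLocals L (var vz)) B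
  raise-closure = trans (subF-subF (liftS s) (raiseInst L) B) (subF-cong closure B)
    where
    closure : liftS s ⨟ raiseInst L ≗ˢ (s ⨟ liftS* L wkS) ,ˢ appLocals L (var vz)
    closure vz     = refl
    closure (vs v) = trans (subT-renT vs (raiseInst L) (s v)) (subT-cong (liftR*-var L vs) (s v))

  -- The premise is asked for every instantiation `δ` and every term `t`, so that later arguments
  -- never see the raised eigenvariable. Keeping the formula as a closure `subF s B` makes each
  -- quantifier step a mere extension of `s`.
  ∀R' : (∀ {Σ'} (δ : Sub Σ Σ') (t : Tm (Σ' ⧺ L) τ) →
           Σ' ⊩ Ψ [ δ ]ᶜ ⊢ L ▹ subF ((s ⨟ liftS* L δ) ,ˢ t) B) →
        Σ ⊩ Ψ ⊢ L ▹ subF s (∀̇ τ B)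
  ∀R' {Ψ = Ψ} h = ∀R (subst₂ (λ Φ F → _ ⊩ Φ ⊢ L ▹ F) (sym ([]ᶜ-ren vs Ψ)) (sym raise-closure) (h _ _))

  ∃L' : (∀ {Σ'} (δ : Sub Σ Σ') (t : Tm (Σ' ⧺ L) τ) →
           Σ' ⊩ (L ▹ subF ((s ⨟ liftS* L δ) ,ˢ t) B) ∷ Ψ [ δ ]ᶜ ⊢ subLF δ G) →
        Σ ⊩ (L ▹ subF s (∃̇ τ B)) ∷ Ψ ⊢ G
  ∃L' {Ψ = Ψ} {G} h = ∃L (subst₂ (_ ⊩_⊢_)
    (cong₂ (λ F Φ → (L ▹ F) ∷ Φ) (sym raise-closure) (sym ([]ᶜ-ren vs Ψ)))
    (sym (renLF-subLF vs G)) (h _ _))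

  ∃R' : (t : Tm (Σ ⧺ L) τ) → Σ ⊩ Ψ ⊢ L ▹ subF (s ,ˢ t) B → Σ ⊩ Ψ ⊢ L ▹ subF s (∃̇ τ B)
  ∃R' t d = ∃R t (subst (λ F → _ ⊩ _ ⊢ L ▹ F) (sym (trans (subF-subF (liftS s) (sub0 t) B)
    (subF-cong (λ { vz → refl ; (vs v) → sub0-wkT t (s v) }) B))) d)

-- The complete set of unifiers is taken to be the set of all unifiers.
defL' : ∀ {p} {ts : Args (Σ ⧺ L) (arity p)} →
  ((c : Cl p) {Σ' : Ctx} (δ : Sub Σ Σ') (u : Sub (Clause.vars (clauseOf c)) (Σ' ⧺ L)) →
     subA (liftS* L δ) ts ≈* subA u (Clause.head (clauseOf c)) →
     Σ' ⊩ (L ▹ subF u (Clause.body (clauseOf c))) ∷ Ψ [ δ ]ᶜ ⊢ subLF δ G) →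
  Σ ⊩ (L ▹ atom p ts) ∷ Ψ ⊢ G
defL' {Σ = Σ} {L = L} {Ψ = Ψ} {G = G} {p = p} {ts = ts} h =
  defL (λ c Σ' δ → Unifies L (renA (liftR* L (wk⧺ _)) ts) (subA (raiseSub L _) (Clause.head (clauseOf c))) δ)
       (λ c → record
          { sound    = λ δ e → e
          ; complete = λ {Σ''} θ e → Σ'' , θ , e , var , λ v → ≡⇒≈ (sym (subT-id (λ _ → refl) (θ v))) })
       (λ c Σ' δ e → subst (λ F → Σ' ⊩ (L ▹ F) ∷ Ψ [ δ ∘ wk⧺ _ ]ᶜ ⊢ subLF (δ ∘ wk⧺ _) G)
          (sym (subF-subF (raiseSub L _) (liftS* L δ) (Clause.body (clauseOf c))))
          (h c (δ ∘ wk⧺ _) (raiseSub L _ ⨟ liftS* L δ)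
            (subst₂ _≈*_ (goal-args (wk⧺ _) δ) (subA-subA (raiseSub L _) (liftS* L δ) (Clause.head (clauseOf c))) e)))
  where
  goal-args : ∀ {Σ₁ Σ₂} (ρ : Ren Σ Σ₁) (δ : Sub Σ₁ Σ₂) →
    subA (liftS* L δ) (renA (liftR* L ρ) ts) ≡ subA (liftS* L (δ ∘ ρ)) ts
  goal-args ρ δ = begin
    subA (liftS* L δ) (renA (liftR* L ρ) ts)                ≡⟨ cong (subA (liftS* L δ)) (renA-subA _ ts) ⟩
    subA (liftS* L δ) (subA (var ∘ liftR* L ρ) ts)          ≡⟨ cong (subA (liftS* L δ)) (subA-cong (liftR*-var L ρ) ts) ⟩
    subA (liftS* L δ) (subA (liftS* L (var ∘ ρ)) ts)        ≡⟨ subA-subA _ _ ts ⟩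
    subA (liftS* L (var ∘ ρ) ⨟ liftS* L δ) ts               ≡⟨ subA-cong (liftS*-⨟ L (var ∘ ρ) δ) ts ⟩
    subA (liftS* L (δ ∘ ρ)) ts                              ∎ where open ≡-Reasoning

-- Transitions are derivable

εˢ : Sub ε Γ
εˢ ()

defR∃ : ∀ L {Ψ : List (LF Σ)} {p τ} {ts : Args (Σ ⧺ L) (arity p)} (c : Cl p) {B}
  (u : Sub (Clause.vars (clauseOf c)) (Σ ⧺ L)) → Clause.body (clauseOf c) ≡ ∃̇ τ B →
  subA u (Clause.head (clauseOf c)) ≈* ts →
  (t : Tm (Σ ⧺ L) τ) → Σ ⊩ Ψ ⊢ L ▹ subF (u ,ˢ t) B → Σ ⊩ Ψ ⊢ L ▹ atom p ts
defR∃ L c {B} u b e t d =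
  defR c u e (subst (λ F → _ ⊩ _ ⊢ L ▹ subF u F) (sym b) (∃R' u B t d))

β-liftS : (φ : Sub Γ Δ) (t : Tm (Γ ▸ σ) τ) (a : Tm Δ σ) → lam (subT (liftS φ) t) · a ≈ subT (φ ,ˢ a) t
β-liftS φ t a = lam-β≡ (trans (subT-subT (liftS φ) (sub0 a) t)
  (subT-cong (λ { vz → refl ; (vs v) → sub0-wkT a (φ v) }) t))

β-wk : (t : Tm (Γ ▸ σ) τ) → wkT (lam t) · v0 ≈ t
β-wk t = lam-β≡ (trans (subT-renT (liftR vs) (sub0 v0) t)
  (subT-id (λ { vz → refl ; (vs v) → refl }) t))

enc-inst-ren : (θ : Fin n → Tm Γ nm) (y : Fin n) (P : Proc (suc n)) →
  lam (enc (liftN θ) P) · θ y ≈ enc θ (ren (inst y) P)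
enc-inst-ren θ y P = ≈trans (enc-inst θ (θ y) P) (≈trans
  (enc-cong (λ { zero → ≈refl ; (suc i) → ≈refl }) P) (≈sym (enc-ren θ (inst y) P)))

enc-ren-suc : (θ : Fin n → Tm Γ nm) (P : Proc n) → wkT (enc θ P) ≈ enc (liftN θ) (ren suc P)
enc-ren-suc θ P = ≈trans (enc-wk θ P) (≈sym (enc-ren (liftN θ) suc P))

-- In the residual of a bound action under a restriction, index zero is the name bound by the action
-- and index one the restricted name. `new` needs the opposite order, which `res` obtains by `swap`
-- and the clause `onepRes` by the order of the arguments in `P' n m`.
enc-swap : (θ : Fin n → Tm Γ nm) (P : Proc (suc (suc n))) →
  wkT (wkT (lam (lam (enc (liftN (liftN θ)) P)))) · v0 · v1 ≈ enc (liftN (liftN θ)) (ren swap P)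
enc-swap θ P =
  ≈trans (≈app (≈app (≡⇒≈ (trans (renT-renT vs vs (lam (lam E)))
                                 (renT-subT (λ v → vs (vs v)) (lam (lam E))))) ≈refl) ≈refl)
  (≈trans (≈app (β-liftS φ (lam E) v0) ≈refl)
  (≈trans (β-liftS (φ ,ˢ v0) E v1)
  (≈trans (enc-subT ((φ ,ˢ v0) ,ˢ v1) (liftN (liftN θ)) P)
  (≈trans (enc-cong pointwise P) (≈sym (enc-ren (liftN (liftN θ)) swap P))))))
  where
  E = enc (liftN (liftN θ)) P
  φ : Sub _ _
  φ v = var (vs (vs v))
  pointwise : subT ((φ ,ˢ v0) ,ˢ v1) ∘ liftN (liftN θ) ≈ⁿ liftN (liftN θ) ∘ swap
  pointwise zero          = ≈refl
  pointwise (suc zero)    = ≈refl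
  pointwise (suc (suc i)) = ≡⇒≈ (trans (cong (subT ((φ ,ˢ v0) ,ˢ v1)) (renT-renT vs vs (θ i)))
    (trans (subT-renT (λ v → vs (vs v)) ((φ ,ˢ v0) ,ˢ v1) (θ i))
    (trans (sym (renT-subT (λ v → vs (vs v)) (θ i))) (sym (renT-renT vs vs (θ i))))))

-- All three arguments are given up to `≈`, because below a `∇` the clause bodies contain
-- applications such as `wkT M · v0`, which only convert to encodings.
—→⇒⊢ : ∀ L {Ψ : List (LF Σ)} (θ : Fin n → Tm (Σ ⧺ L) nm) {P α P'} {p a p'} → P —[ α ]→ P' →
  p ≈ enc θ P → a ≈ encA θ α → p' ≈ enc θ P' → Σ ⊩ Ψ ⊢ L ▹ oneA p a p'
—→ᵇ⇒⊢ : ∀ L {Ψ : List (LF Σ)} (θ : Fin n → Tm (Σ ⧺ L) nm) {P α P'} {p a p'} → P —[ α ]→ᵇ P' →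
  p ≈ enc θ P → a ≈ encB θ α → p' ≈ lam (enc (liftN θ) P') → Σ ⊩ Ψ ⊢ L ▹ onepA p a p'

—→⇒⊢ L θ (tau {P}) e f g =
  defR oneTau (εˢ ,ˢ enc θ P) (≈sym e ∷ ≈sym f ∷ ≈sym g ∷ []) ⊤R
—→⇒⊢ L θ (output {x} {y} {P}) e f g =
  defR oneOut (εˢ ,ˢ θ x ,ˢ θ y ,ˢ enc θ P) (≈sym e ∷ ≈sym f ∷ ≈sym g ∷ []) ⊤R
—→⇒⊢ L θ {a = a} {p'} (match {x} {P} t) e f g =
  defR oneMatch (εˢ ,ˢ θ x ,ˢ enc θ P ,ˢ a ,ˢ p') (≈sym e ∷ ≈refl ∷ ≈refl ∷ [])
    (—→⇒⊢ L θ t ≈refl f g)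
—→⇒⊢ L θ {a = a} {p'} (sumˡ {P} {Q} t) e f g =
  defR oneSumˡ (εˢ ,ˢ enc θ P ,ˢ enc θ Q ,ˢ a ,ˢ p') (≈sym e ∷ ≈refl ∷ ≈refl ∷ [])
    (—→⇒⊢ L θ t ≈refl f g)
—→⇒⊢ L θ {a = a} {p'} (sumʳ {P} {Q} t) e f g =
  defR oneSumʳ (εˢ ,ˢ enc θ P ,ˢ enc θ Q ,ˢ a ,ˢ p') (≈sym e ∷ ≈refl ∷ ≈refl ∷ [])
    (—→⇒⊢ L θ t ≈refl f g)
—→⇒⊢ L θ {a = a} (parˡ {P} {Q} {P' = P'} t) e f g =
  defR oneParˡ (εˢ ,ˢ enc θ P ,ˢ enc θ Q ,ˢ a ,ˢ enc θ P') (≈sym e ∷ ≈refl ∷ ≈sym g ∷ [])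
    (—→⇒⊢ L θ t ≈refl f ≈refl)
—→⇒⊢ L θ {a = a} (parʳ {P} {Q} {Q' = Q'} t) e f g =
  defR oneParʳ (εˢ ,ˢ enc θ P ,ˢ enc θ Q ,ˢ a ,ˢ enc θ Q') (≈sym e ∷ ≈refl ∷ ≈sym g ∷ [])
    (—→⇒⊢ L θ t ≈refl f ≈refl)
-- The sides cross: `comˡ` and `closeˡ` have the sender on the left, whereas `oneComˡ` and
-- `oneCloseˡ` have the receiver there.
—→⇒⊢ L θ (comˡ {P} {Q} {x} {y} {P'} {Q'} t s) e f g =
  defR∃ L oneComʳ (εˢ ,ˢ enc θ P ,ˢ enc θ Q ,ˢ enc θ P' ,ˢ lam (enc (liftN θ) Q') ,ˢ θ y) refl
    (≈sym e ∷ ≈sym f ∷ ≈trans (≈app ≈refl (enc-inst-ren θ y Q')) (≈sym g) ∷ [])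
    (θ x) (∧R (—→⇒⊢ L θ t ≈refl ≈refl ≈refl) (—→ᵇ⇒⊢ L θ s ≈refl ≈refl ≈refl))
—→⇒⊢ L θ (comʳ {P} {Q} {x} {y} {P'} {Q'} t s) e f g =
  defR∃ L oneComˡ (εˢ ,ˢ enc θ P ,ˢ enc θ Q ,ˢ lam (enc (liftN θ) P') ,ˢ θ y ,ˢ enc θ Q') refl
    (≈sym e ∷ ≈sym f ∷ ≈trans (≈app (≈app ≈refl (enc-inst-ren θ y P')) ≈refl) (≈sym g) ∷ [])
    (θ x) (∧R (—→ᵇ⇒⊢ L θ t ≈refl ≈refl ≈refl) (—→⇒⊢ L θ s ≈refl ≈refl ≈refl))
—→⇒⊢ L θ (closeˡ {P} {Q} {x} {P'} {Q'} t s) e f g =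
  defR∃ L oneCloseʳ (εˢ ,ˢ enc θ P ,ˢ enc θ Q ,ˢ lam (enc (liftN θ) P') ,ˢ lam (enc (liftN θ) Q')) refl
    (≈sym e ∷ ≈sym f ∷
      ≈trans (≈app ≈refl (≈lam (≈app (≈app ≈refl (β-wk _)) (β-wk _)))) (≈sym g) ∷ [])
    (θ x) (∧R (—→ᵇ⇒⊢ L θ t ≈refl ≈refl ≈refl) (—→ᵇ⇒⊢ L θ s ≈refl ≈refl ≈refl))
—→⇒⊢ L θ (closeʳ {P} {Q} {x} {P'} {Q'} t s) e f g =
  defR∃ L oneCloseˡ (εˢ ,ˢ enc θ P ,ˢ enc θ Q ,ˢ lam (enc (liftN θ) P') ,ˢ lam (enc (liftN θ) Q')) refl
    (≈sym e ∷ ≈sym f ∷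
      ≈trans (≈app ≈refl (≈lam (≈app (≈app ≈refl (β-wk _)) (β-wk _)))) (≈sym g) ∷ [])
    (θ x) (∧R (—→ᵇ⇒⊢ L θ t ≈refl ≈refl ≈refl) (—→ᵇ⇒⊢ L θ s ≈refl ≈refl ≈refl))
—→⇒⊢ L θ {a = a} (res {P} {α} {P'} t) e f g =
  defR oneRes (εˢ ,ˢ lam (enc (liftN θ) P) ,ˢ a ,ˢ lam (enc (liftN θ) P'))
    (≈trans (≈app ≈refl (≈sym ≈η)) (≈sym e) ∷ ≈refl ∷ ≈trans (≈app ≈refl (≈sym ≈η)) (≈sym g) ∷ [])
    (∇R (—→⇒⊢ (L ▸ nm) (liftN θ) t (β-wk _)
      (≈trans (≈-renT vs f) (≡⇒≈ (sym (encA-wk θ α)))) (β-wk _)))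

—→ᵇ⇒⊢ L θ (input {x} {P}) e f g =
  defR onepIn (εˢ ,ˢ θ x ,ˢ lam (enc (liftN θ) P)) (≈sym e ∷ ≈sym f ∷ ≈sym g ∷ []) ⊤R
—→ᵇ⇒⊢ L θ {a = a} {p'} (match {x} {P} t) e f g =
  defR onepMatch (εˢ ,ˢ θ x ,ˢ enc θ P ,ˢ a ,ˢ p') (≈sym e ∷ ≈refl ∷ ≈refl ∷ [])
    (—→ᵇ⇒⊢ L θ t ≈refl f g)
—→ᵇ⇒⊢ L θ {a = a} {p'} (sumˡ {P} {Q} t) e f g =
  defR onepSumˡ (εˢ ,ˢ enc θ P ,ˢ enc θ Q ,ˢ a ,ˢ p') (≈sym e ∷ ≈refl ∷ ≈refl ∷ [])
    (—→ᵇ⇒⊢ L θ t ≈refl f g)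
—→ᵇ⇒⊢ L θ {a = a} {p'} (sumʳ {P} {Q} t) e f g =
  defR onepSumʳ (εˢ ,ˢ enc θ P ,ˢ enc θ Q ,ˢ a ,ˢ p') (≈sym e ∷ ≈refl ∷ ≈refl ∷ [])
    (—→ᵇ⇒⊢ L θ t ≈refl f g)
—→ᵇ⇒⊢ L θ {a = a} (parˡ {P} {Q} {P' = P'} t) e f g =
  defR onepParˡ (εˢ ,ˢ enc θ P ,ˢ enc θ Q ,ˢ a ,ˢ lam (enc (liftN θ) P'))
    (≈sym e ∷ ≈refl ∷ ≈trans (≈lam (≈app (≈app ≈refl (β-wk _)) (enc-ren-suc θ Q))) (≈sym g) ∷ [])
    (—→ᵇ⇒⊢ L θ t ≈refl f ≈refl)
—→ᵇ⇒⊢ L θ {a = a} (parʳ {P} {Q} {Q' = Q'} t) e f g =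
  defR onepParʳ (εˢ ,ˢ enc θ P ,ˢ enc θ Q ,ˢ a ,ˢ lam (enc (liftN θ) Q'))
    (≈sym e ∷ ≈refl ∷ ≈trans (≈lam (≈app (≈app ≈refl (enc-ren-suc θ P)) (β-wk _))) (≈sym g) ∷ [])
    (—→ᵇ⇒⊢ L θ t ≈refl f ≈refl)
—→ᵇ⇒⊢ L θ {a = a} (res {P} {α} {P'} t) e f g =
  defR onepRes (εˢ ,ˢ lam (enc (liftN θ) P) ,ˢ a ,ˢ lam (lam (enc (liftN (liftN θ)) P')))
    (≈trans (≈app ≈refl (≈sym ≈η)) (≈sym e) ∷ ≈refl ∷
      ≈trans (≈lam (≈app ≈refl (≈lam (enc-swap θ P')))) (≈sym g) ∷ [])
    (∇R (—→ᵇ⇒⊢ (L ▸ nm) (liftN θ) t (β-wk _)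
      (≈trans (≈-renT vs f) (≡⇒≈ (sym (encB-wk θ α)))) (β-wk _)))
—→ᵇ⇒⊢ L θ (open' {P} {x} {P'} t) e f g =
  defR onepOpen (εˢ ,ˢ lam (enc (liftN θ) P) ,ˢ θ x ,ˢ lam (enc (liftN θ) P'))
    (≈trans (≈app ≈refl (≈sym ≈η)) (≈sym e) ∷ ≈sym f ∷ ≈sym g ∷ [])
    (∇R (—→⇒⊢ (L ▸ nm) (liftN θ) t (β-wk _) ≈refl (β-wk _)))

-- Transitions up to conversion, and merging of names

data Kind : Set where
  free bound : Kind

actTy resTy : Kind → Ty
actTy free  = ac
actTy bound = nm ⇒ ac
resTy free  = pr
resTy bound = nm ⇒ pr

Steps : ∀ k → (Fin n → Tm Γ nm) → Proc n → Tm Γ (actTy k) → Tm Γ (resTy k) → Set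
Steps free  θ P a p = ∃[ α ] ∃[ P' ] P —[ α ]→ P' × a ≈ encA θ α × p ≈ enc θ P'
Steps bound θ P a p = ∃[ β ] ∃[ P' ] P —[ β ]→ᵇ P' × a ≈ encB θ β × p ≈ lam (enc (liftN θ) P')

Steps-cong : ∀ k {θ θ' : Fin n → Tm Γ nm} {P : Proc n} {a a' p p'} →
  θ ≈ⁿ θ' → a' ≈ a → p' ≈ p → Steps k θ P a p → Steps k θ' P a' p'
Steps-cong free  e f g (α , P' , t , h , h') =
  α , P' , t , ≈trans f (≈trans h (encA-cong e α)) , ≈trans g (≈trans h' (enc-cong e P'))
Steps-cong bound e f g (β , P' , t , h , h') =
  β , P' , t , ≈trans f (≈trans h (encB-cong e β)) ,
    ≈trans g (≈trans h' (≈lam (enc-cong (liftN-cong e) P')))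

Steps-subT : ∀ k (δ : Sub Γ Δ) {θ : Fin n → Tm Γ nm} {P : Proc n} {a p} →
  Steps k θ P a p → Steps k (subT δ ∘ θ) P (subT δ a) (subT δ p)
Steps-subT free  δ {θ} (α , P' , t , h , h') =
  α , P' , t , ≈trans (≈-subT δ h) (≡⇒≈ (encA-subT δ θ α)) , ≈trans (≈-subT δ h') (enc-subT δ θ P')
Steps-subT bound δ {θ} (β , P' , t , h , h') =
  β , P' , t , ≈trans (≈-subT δ h) (≡⇒≈ (encB-subT δ θ β)) ,
    ≈trans (≈-subT δ h') (≈lam (≈trans (enc-subT (liftS δ) (liftN θ) P') (enc-cong (liftN-subT δ θ) P')))

-- Name identifications already validated by θ do not change encodings.
module _ {n : ℕ} {Γ : Ctx} {θ : Fin n → Tm Γ nm} {κ : Fin n → Fin n} (c : θ ∘ κ ≈ⁿ θ) where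

  liftN-stable : liftN θ ∘ ext κ ≈ⁿ liftN θ
  liftN-stable i = ≈trans (liftN-ext θ κ i) (liftN-cong c i)

  enc-stable : (P : Proc n) → enc θ (ren κ P) ≈ enc θ P
  enc-stable P = ≈trans (enc-ren θ κ P) (enc-cong c P)

  enc-lift-stable : (P : Proc (suc n)) → enc (liftN θ) (ren (ext κ) P) ≈ enc (liftN θ) P
  enc-lift-stable P = ≈trans (enc-ren (liftN θ) (ext κ) P) (enc-cong liftN-stable P)

  Steps-ren : ∀ k {P : Proc n} {a p} → Steps k θ P a p → Steps k θ (ren κ P) a p
  Steps-ren free (α , P' , t , h , h') =
    _ , _ , —→-ren κ t , ≈trans h (stable α) , ≈trans h' (≈sym (enc-stable P'))
    where
    stable : ∀ α → encA θ α ≈ encA θ (renFA κ α)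
    stable τₐ      = ≈refl
    stable (ō x y) = ≈app (≈app ≈refl (≈sym (c x))) (≈sym (c y))
  Steps-ren bound (β , P' , t , h , h') =
    _ , _ , —→ᵇ-ren κ t , ≈trans h (stable β) , ≈trans h'
      (≈lam (≈sym (enc-lift-stable P')))
    where
    stable : ∀ α → encB θ α ≈ encB θ (renBA κ α)
    stable (ι x)  = ≈app ≈refl (≈sym (c x))
    stable (ōν x) = ≈app ≈refl (≈sym (c x))

merge : Fin n → Fin n → Fin n → Fin n
merge x y z with z ≟ x
... | yes _ = y
... | no  _ = z

merge-unifies : (x y : Fin n) → merge x y x ≡ merge x y y
merge-unifies x y with x ≟ x | y ≟ x
... | yes _ | yes _ = refl
... | yes _ | no  _ = refl
... | no ¬e | _     = ⊥-elim (¬e refl)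

merge-stable : {θ : Fin n → Tm Γ nm} (x y : Fin n) → θ x ≈ θ y → θ ∘ merge x y ≈ⁿ θ
merge-stable x y e z with z ≟ x
... | yes refl = ≈sym e
... | no  _    = ≈refl

ō-subst : {x x' y : Fin n} {P P' : Proc n} → x ≡ x' → P —[ ō x y ]→ P' → P —[ ō x' y ]→ P'
ō-subst refl t = t

ōν-subst : {x x' : Fin n} {P : Proc n} {P' : Proc (suc n)} → x ≡ x' → P —[ ōν x ]→ᵇ P' → P —[ ōν x' ]→ᵇ P'
ōν-subst refl t = t

a↑≉a↓ : {x y : Tm Γ nm} → con a↑ · x ≈ con a↓ · y → ⊥
a↑≉a↓ {x = x} e with ≈⇒≋ ac (app (app (con _) ≈refl) ≈refl) (app (app (con _) ≈refl) ≈refl) (≈app {u = x} e ≈refl)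
... | app (app () _) _

a↑≉aτ : {x y : Tm Γ nm} → con a↑ · x · y ≈ con aτ → ⊥
a↑≉aτ e with ≈⇒≋ ac (app (app (con _) ≈refl) ≈refl) (con _) e
... | ()

module _ {n : ℕ} {Γ : Ctx} {θ : Fin n → Tm Γ nm} where

  input-act : ∀ {x} (β : BAct n) → con a↓ · x ≈ encB θ β → ∃[ i ] β ≡ ι i × x ≈ θ i
  input-act (ι i)  e = i , refl , con-inj-⇒ e
  input-act (ōν i) e = ⊥-elim (a↑≉a↓ (≈sym e))

  bout-act : ∀ {x} (β : BAct n) → con a↑ · x ≈ encB θ β → ∃[ i ] β ≡ ōν i × x ≈ θ i
  bout-act (ι i)  e = ⊥-elim (a↑≉a↓ e)
  bout-act (ōν i) e = i , refl , con-inj-⇒ e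

  output-act : ∀ {x y} (α : FAct n) → con a↑ · x · y ≈ encA θ α → ∃[ i ] ∃[ j ] α ≡ ō i j × x ≈ θ i × y ≈ θ j
  output-act τₐ      e = ⊥-elim (a↑≉aτ e)
  output-act (ō i j) e = i , j , refl , con-inj₂ ac e

  private variable
    P Q : Proc n

  parˡ-steps : ∀ {a p q} → Steps free θ P a p → q ≈ enc θ Q → Steps free θ (P ∥ Q) a (par p q)
  parˡ-steps (_ , _ , t , h , h') e = _ , _ , parˡ t , h , ≈app (≈app ≈refl h') e

  parʳ-steps : ∀ {a p q} → p ≈ enc θ P → Steps free θ Q a q → Steps free θ (P ∥ Q) a (par p q)
  parʳ-steps e (_ , _ , t , h , h') = _ , _ , parʳ t , h , ≈app (≈app ≈refl e) h'

  wk-lam : ∀ {m : Tm Γ (nm ⇒ pr)} {E} → m ≈ lam E → wkT m · v0 ≈ E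
  wk-lam {E = E} e = ≈trans (≈app (≈-renT vs e) ≈refl) (β-wk E)

  lam-wk : ∀ {σ} {m : Tm Γ (nm ⇒ σ)} {E} → wkT m · v0 ≈ E → m ≈ lam E
  lam-wk e = ≈trans ≈η (≈lam e)

  parˡ-stepsᵇ : ∀ {a m q} → Steps bound θ P a m → q ≈ enc θ Q →
    Steps bound θ (P ∥ Q) a (lam (par (wkT m · v0) (wkT q)))
  parˡ-stepsᵇ {Q = Q} (_ , _ , t , h , h') e = _ , _ , parˡ t , h ,
    ≈lam (≈app (≈app ≈refl (wk-lam h')) (≈trans (≈-renT vs e) (enc-ren-suc θ Q)))

  parʳ-stepsᵇ : ∀ {a m p} → p ≈ enc θ P → Steps bound θ Q a m →
    Steps bound θ (P ∥ Q) a (lam (par (wkT p) (wkT m · v0)))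
  parʳ-stepsᵇ {P = P} e (_ , _ , t , h , h') = _ , _ , parʳ t , h ,
    ≈lam (≈app (≈app ≈refl (≈trans (≈-renT vs e) (enc-ren-suc θ P))) (wk-lam h'))

  MergedSteps : Proc n → Tm Γ pr → Set
  MergedSteps P p = ∃[ κ ] θ ∘ κ ≈ⁿ θ × Steps free θ (ren κ P) (con aτ) p

  -- The right-hand side has the form that the communication rules produce from renamed components,
  -- where the transmitted name is renamed as well; `θ` does not notice `κ`, so it still encodes the
  -- original residual.
  received : ∀ {κ m y} → θ ∘ κ ≈ⁿ θ → ∀ j (P : Proc (suc n)) → m ≈ lam (enc (liftN θ) P) → y ≈ θ j →
    m · y ≈ enc θ (ren (inst (κ j)) (ren (ext κ) P))
  received c j P e f = ≈trans
    (≈app (≈trans e (≈lam (≈sym (enc-lift-stable c P)))) (≈trans f (≈sym (c j)))) (enc-inst-ren θ _ _)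

  extruded : ∀ {κ m m'} → θ ∘ κ ≈ⁿ θ → (P Q : Proc (suc n)) →
    m ≈ lam (enc (liftN θ) P) → m' ≈ lam (enc (liftN θ) Q) →
    νλ (par (wkT m · v0) (wkT m' · v0)) ≈ enc θ (new (ren (ext κ) P ∥ ren (ext κ) Q))
  extruded c P Q e f = ≈app ≈refl (≈lam (≈app
    (≈app ≈refl (≈trans (wk-lam e) (≈sym (enc-lift-stable c P))))
    (≈trans (wk-lam f) (≈sym (enc-lift-stable c Q)))))

  -- The two channels need only be identified by θ; merging them makes them equal.
  comˡ-steps : ∀ {x y p m} → Steps free θ P (con a↑ · x · y) p → Steps bound θ Q (con a↓ · x) m →
    MergedSteps (P ∥ Q) (par p (m · y))
  comˡ-steps (α , P' , t , h , e) (β , Q' , s , k , f)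
    with i , j , refl , ei , ej ← output-act α h | i' , refl , ei' ← input-act β k
    with c ← merge-stable {θ = θ} i i' (≈trans (≈sym ei) ei') =
    _ , c , _ , _ ,
    comˡ (ō-subst (merge-unifies i i') (—→-ren (merge i i') t)) (—→ᵇ-ren (merge i i') s) , ≈refl ,
    ≈app (≈app ≈refl (≈trans e (≈sym (enc-stable c P')))) (received c j Q' f ej)

  comʳ-steps : ∀ {x y q m} → Steps bound θ P (con a↓ · x) m → Steps free θ Q (con a↑ · x · y) q →
    MergedSteps (P ∥ Q) (par (m · y) q)
  comʳ-steps (β , P' , s , k , f) (α , Q' , t , h , e)
    with i , j , refl , ei , ej ← output-act α h | i' , refl , ei' ← input-act β k
    with c ← merge-stable {θ = θ} i i' (≈trans (≈sym ei) ei') =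
    _ , c , _ , _ ,
    comʳ (—→ᵇ-ren (merge i i') s) (ō-subst (merge-unifies i i') (—→-ren (merge i i') t)) , ≈refl ,
    ≈app (≈app ≈refl (received c j P' f ej)) (≈trans e (≈sym (enc-stable c Q')))

  closeˡ-steps : ∀ {x m m'} → Steps bound θ P (con a↑ · x) m → Steps bound θ Q (con a↓ · x) m' →
    MergedSteps (P ∥ Q) (νλ (par (wkT m · v0) (wkT m' · v0)))
  closeˡ-steps (α , P' , t , h , e) (β , Q' , s , k , f)
    with i , refl , ei ← bout-act α h | i' , refl , ei' ← input-act β k
    with c ← merge-stable {θ = θ} i i' (≈trans (≈sym ei) ei') =
    _ , c , _ , _ ,
    closeˡ (ōν-subst (merge-unifies i i') (—→ᵇ-ren (merge i i') t)) (—→ᵇ-ren (merge i i') s) , ≈refl ,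
    extruded c P' Q' e f

  closeʳ-steps : ∀ {x m m'} → Steps bound θ P (con a↓ · x) m → Steps bound θ Q (con a↑ · x) m' →
    MergedSteps (P ∥ Q) (νλ (par (wkT m · v0) (wkT m' · v0)))
  closeʳ-steps (β , P' , s , k , f) (α , Q' , t , h , e)
    with i , refl , ei ← bout-act α h | i' , refl , ei' ← input-act β k
    with c ← merge-stable {θ = θ} i i' (≈trans (≈sym ei) ei') =
    _ , c , _ , _ ,
    closeʳ (—→ᵇ-ren (merge i i') s) (ōν-subst (merge-unifies i i') (—→ᵇ-ren (merge i i') t)) , ≈refl ,
    extruded c P' Q' f e

  res-steps : ∀ {R : Proc (suc n)} {a p} → Steps free (liftN θ) R (wkT a) p → Steps free θ (new R) a (νλ p)
  res-steps (α , R' , t , h , h') with _ , refl , e ← encA-wk⁻ θ α h =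
    _ , _ , res t , e , ≈app ≈refl (≈lam h')

  res-stepsᵇ : ∀ {R : Proc (suc n)} {a m} → Steps bound (liftN θ) R (wkT a) (wkT m · v0) →
    Steps bound θ (new R) a (lam (νλ (wkT (wkT m) · v0 · v1)))
  res-stepsᵇ (β , R' , t , h , h') with _ , refl , e ← encB-wk⁻ θ β h =
    _ , _ , res t , e , ≈lam (≈app ≈refl (≈lam (≈trans
      (≈app (≈app (≈-renT vs (≈-renT vs (lam-wk h'))) ≈refl) ≈refl) (enc-swap θ R'))))

  -- Freshness leaves exactly the shape required by `open'`: the object is index zero because it
  -- converts to the last variable, and the channel is not, because it converts to a weakened term.
  open-steps : ∀ {R : Proc (suc n)} {x m} → Steps free (liftN θ) R (con a↑ · wkT x · v0) (wkT m · v0) →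
    Steps bound θ (new R) (con a↑ · x) m
  open-steps {x = x} (α , R' , t , h , h') with output-act' α h
    where
    output-act' : ∀ α → con a↑ · wkT x · v0 ≈ encA (liftN θ) α → ∃[ i ] α ≡ ō (suc i) zero × x ≈ θ i
    output-act' τₐ e = ⊥-elim (a↑≉aτ e)
    output-act' (ō i (suc j)) e = ⊥-elim (wk≉v0 (≈sym (proj₂ (con-inj₂ ac e))))
    output-act' (ō zero zero) e = ⊥-elim (wk≉v0 (proj₁ (con-inj₂ ac e)))
    output-act' (ō (suc i) zero) e = i , refl , wk-inj x (proj₁ (con-inj₂ ac e))
  ... | i , refl , e = _ , _ , open' t , ≈app ≈refl e , lam-wk h'

-- The newest name is assigned a variable that converts to no weakened term, so `κ` must fix it and
-- can send no other name to it. Hence identifications found below a restriction never involve the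
-- restricted name.
ext-stable⁻ : {θ : Fin n → Tm Γ nm} (κ : Fin (suc n) → Fin (suc n)) → liftN θ ∘ κ ≈ⁿ liftN θ →
  ∃[ κ' ] κ ≗ ext κ' × θ ∘ κ' ≈ⁿ θ
ext-stable⁻ {n = n} {θ = θ} κ c = (λ i → proj₁ (fresh i)) , ext≗ , (λ i → proj₂ (proj₂ (fresh i)))
  where
  fresh : ∀ i → ∃[ j ] κ (suc i) ≡ suc j × θ j ≈ θ i
  fresh i with κ (suc i) | c (suc i)
  ... | zero  | e = ⊥-elim (wk≉v0 (≈sym e))
  ... | suc j | e = j , refl , wk-inj (θ i) e
  ext≗ : κ ≗ ext (λ i → proj₁ (fresh i))
  ext≗ zero with κ zero | c zero
  ... | zero  | _ = refl
  ... | suc j | e = ⊥-elim (wk≉v0 e)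
  ext≗ (suc i) = proj₁ (proj₂ (fresh i))

-- Case analysis of a hypothetical transition

module _ {n : ℕ} {Γ Δ : Ctx} (δ : Sub Γ Δ) (θ : Fin n → Tm Γ nm) where

  lift-steps : ∀ k (ρ : Fin n → Fin n) (κ : Fin (suc n) → Fin (suc n)) (P : Proc (suc n)) {a p} →
    (subT (liftS δ) ∘ liftN θ) ∘ κ ≈ⁿ subT (liftS δ) ∘ liftN θ →
    Steps k (subT (liftS δ) ∘ liftN θ) (ren (κ ∘ ext ρ) P) a p →
    ∃[ κ' ] (subT δ ∘ θ) ∘ κ' ≈ⁿ subT δ ∘ θ ×
      Steps k (liftN (subT δ ∘ θ)) (ren (ext (κ' ∘ ρ)) P) a p
  lift-steps k ρ κ P c s
    with κ' , e , c' ← ext-stable⁻ κ (λ i →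
      ≈trans (≈sym (liftN-subT δ θ (κ i))) (≈trans (c i) (liftN-subT δ θ i))) =
    κ' , c' , subst (λ R → Steps k _ R _ _)
      (ren-cong (λ i → trans (e (ext ρ i)) (ext-∘ κ' ρ i)) P)
      (Steps-cong k (liftN-subT δ θ) ≈refl ≈refl s)

-- ρ collects the identifications of names made on the way to the current subprocess P, κ those
-- made while analysing P under the global instantiation δ.
record Cont {n : ℕ} {Σ : Ctx} (k : Kind) (L : Ctx) (Ψ : List (LF Σ)) (G : LF Σ)
  (θ : Fin n → Tm (Σ ⧺ L) nm) (ρ : Fin n → Fin n) (P : Proc n)
  (a : Tm (Σ ⧺ L) (actTy k)) (p : Tm (Σ ⧺ L) (resTy k)) : Set₁ where
  constructor cont
  field
    resume : ∀ {Σ'} (δ : Sub Σ Σ') κ →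
      (subT (liftS* L δ) ∘ θ) ∘ κ ≈ⁿ subT (liftS* L δ) ∘ θ →
      Steps k (subT (liftS* L δ) ∘ θ) (ren (κ ∘ ρ) P) (subT (liftS* L δ) a) (subT (liftS* L δ) p) →
      Σ' ⊩ Ψ [ δ ]ᶜ ⊢ subLF δ G
open Cont

module _ {n : ℕ} {Σ : Ctx} (k : Kind) (L : Ctx) {Ψ : List (LF Σ)} {G : LF Σ}
  {θ : Fin n → Tm (Σ ⧺ L) nm} {ρ : Fin n → Fin n} {P : Proc n}
  {a : Tm (Σ ⧺ L) (actTy k)} {p : Tm (Σ ⧺ L) (resTy k)} where

  Cont-shift : Cont k L Ψ G θ ρ P a p → (δ : Sub Σ Σ') →
    Cont k L (Ψ [ δ ]ᶜ) (subLF δ G) (subT (liftS* L δ) ∘ θ) ρ P (subT (liftS* L δ) a) (subT (liftS* L δ) p)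
  Cont-shift K δ .resume δ' κ c s = ⊩-⨟ (resume K (δ ⨟ δ') κ
    (λ i → ≈trans (≡⇒≈ (sym (subT*-⨟ L δ δ' (θ (κ i))))) (≈trans (c i) (≡⇒≈ (subT*-⨟ L δ δ' (θ i)))))
    (Steps-cong k (λ i → ≡⇒≈ (subT*-⨟ L δ δ' (θ i))) (≡⇒≈ (sym (subT*-⨟ L δ δ' a))) (≡⇒≈ (sym (subT*-⨟ L δ δ' p))) s))

  Cont-now : Cont k L Ψ G θ ρ P a p → ∀ κ → θ ∘ κ ≈ⁿ θ → Steps k θ (ren (κ ∘ ρ) P) a p → Σ ⊩ Ψ ⊢ G
  Cont-now K κ c s = ⊩-id (resume K var κ
    (λ i → ≈trans (≡⇒≈ (subT*-id L (θ (κ i)))) (≈trans (c i) (≡⇒≈ (sym (subT*-id L (θ i))))))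
    (Steps-cong k (λ i → ≡⇒≈ (sym (subT*-id L (θ i)))) (≡⇒≈ (subT*-id L a)) (≡⇒≈ (subT*-id L p)) s))

transAtom : ∀ k → Tm Γ pr → Tm Γ (actTy k) → Tm Γ (resTy k) → Fm Γ
transAtom free  = oneA
transAtom bound = onepA

-- Abstracted as a type so that `analyse₂` can be given the analyses of two parallel components as
-- arguments.
Analyser : ∀ k → Proc n → Set₁
Analyser {n} k P = ∀ {Σ} L {Ψ : List (LF Σ)} {G : LF Σ} {θ : Fin n → Tm (Σ ⧺ L) nm} (ρ : Fin n → Fin n) →
  θ ∘ ρ ≈ⁿ θ → ∀ {p a p'} → p ≈ enc θ P → Cont k L Ψ G θ ρ P a p' →
  Σ ⊩ (L ▹ transAtom k p a p') ∷ Ψ ⊢ G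

subLF-atom : ∀ k L (δ : Sub Σ Σ') {p a q} →
  subLF δ (L ▹ transAtom k p a q) ≡
  (L ▹ transAtom k (subT (liftS* L δ) p) (subT (liftS* L δ) a) (subT (liftS* L δ) q))
subLF-atom free  L δ = refl
subLF-atom bound L δ = refl

≈enc-subT : (δ : Sub Γ Δ) {θ : Fin n → Tm Γ nm} (P : Proc n) {p : Tm Γ pr} →
  p ≈ enc θ P → subT δ p ≈ enc (subT δ ∘ θ) P
≈enc-subT δ {θ} P e = ≈trans (≈-subT δ e) (enc-subT δ θ P)

-- The second hypothesis is analysed inside the continuation of the first, starting from the
-- identifications already made there. The first transition then has to be carried along the
-- instantiation `δ'` and the renaming `κ'` found by the second, so that both end up over the same
-- names.
analyse₂ : ∀ {k₁ k₂} {P Q : Proc n} → Analyser k₁ P → Analyser k₂ Q →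
  ∀ L {Ψ : List (LF Σ)} {G : LF Σ} {θ : Fin n → Tm (Σ ⧺ L) nm} (ρ : Fin n → Fin n) → θ ∘ ρ ≈ⁿ θ →
  ∀ {p a p' q b q'} → p ≈ enc θ P → q ≈ enc θ Q →
  (∀ {Σ'} (δ : Sub Σ Σ') κ → (subT (liftS* L δ) ∘ θ) ∘ κ ≈ⁿ subT (liftS* L δ) ∘ θ →
    Steps k₁ (subT (liftS* L δ) ∘ θ) (ren (κ ∘ ρ) P) (subT (liftS* L δ) a) (subT (liftS* L δ) p') →
    Steps k₂ (subT (liftS* L δ) ∘ θ) (ren (κ ∘ ρ) Q) (subT (liftS* L δ) b) (subT (liftS* L δ) q') →
    Σ' ⊩ Ψ [ δ ]ᶜ ⊢ subLF δ G) →
  Σ ⊩ (L ▹ transAtom k₁ p a p') ∷ (L ▹ transAtom k₂ q b q') ∷ Ψ ⊢ G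
analyse₂ {k₁ = k₁} {k₂} {P} {Q} A B L {Ψ} {G} {θ} ρ c {a = a} {p'} {q} {b} {q'} e f h =
  A L ρ c e (cont λ δ κ d s → subst (λ H → _ ⊩ H ∷ Ψ [ δ ]ᶜ ⊢ subLF δ G) (sym (subLF-atom k₂ L δ))
    (B L (κ ∘ ρ) (λ i → ≈trans (d (ρ i)) (≈-subT (liftS* L δ) (c i))) (≈enc-subT (liftS* L δ) Q f)
      (cont λ δ' κ' d' s' → ⊩-⨟ (h (δ ⨟ δ') (κ' ∘ κ)
        (λ i → ≈trans (fuse δ δ' (θ (κ' (κ i)))) (≈trans (d' (κ i))
          (≈trans (≈-subT _ (d i)) (≈sym (fuse δ δ' (θ i))))))
        (Steps-cong k₁ (λ i → ≈sym (fuse δ δ' (θ i))) (fuse δ δ' a) (fuse δ δ' p')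
          (subst (λ R → Steps k₁ _ R _ _) (ren-∘ κ' (κ ∘ ρ) P) (Steps-ren d' k₁ (Steps-subT k₁ (liftS* L δ') s))))
        (Steps-cong k₂ (λ i → ≈sym (fuse δ δ' (θ i))) (fuse δ δ' b) (fuse δ δ' q') s')))))
  where
  fuse : ∀ {Σ' Σ'' τ} (δ : Sub _ Σ') (δ' : Sub Σ' Σ'') (t : Tm (_ ⧺ L) τ) →
    subT (liftS* L (δ ⨟ δ')) t ≈ subT (liftS* L δ') (subT (liftS* L δ) t)
  fuse δ δ' t = ≡⇒≈ (sym (subT*-⨟ L δ δ' t))

∃L-body : ∀ L {Ψ : List (LF Σ)} {G : LF Σ} {p τ} (c : Cl p) {B} (u : Sub (Clause.vars (clauseOf c)) (Σ ⧺ L)) →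
  Clause.body (clauseOf c) ≡ ∃̇ τ B →
  (∀ {Σ'} (δ : Sub Σ Σ') (t : Tm (Σ' ⧺ L) τ) →
     Σ' ⊩ (L ▹ subF ((u ⨟ liftS* L δ) ,ˢ t) B) ∷ Ψ [ δ ]ᶜ ⊢ subLF δ G) →
  Σ ⊩ (L ▹ subF u (Clause.body (clauseOf c))) ∷ Ψ ⊢ G
∃L-body L c {B} u e h = subst (λ F → _ ⊩ (L ▹ subF u F) ∷ _ ⊢ _) (sym e) (∃L' u B h)

procOp : (θ : Fin n → Tm Γ nm) (P : Proc n) → ∃[ o ] opT (enc θ P) ≡ just o
procOp θ 𝟘             = _ , refl
procOp θ (P ⊕ Q)       = _ , refl
procOp θ (P ∥ Q)       = _ , refl
procOp θ (τ∙ P)        = _ , refl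
procOp θ ([ x ≐ y ] P) = _ , refl
procOp θ (out x y P)   = _ , refl
procOp θ (inp x P)     = _ , refl
procOp θ (new P)       = _ , refl

headA : Args Γ (τ ∷ τs) → Tm Γ τ
headA (t ∷ ts) = t

headA-≈ : {ts us : Args Γ (τ ∷ τs)} → ts ≈* us → headA ts ≈ headA us
headA-≈ (e ∷ es) = e

≈*-cons : {t t' : Tm Γ τ} {ts : Args Γ τs} {us : Args Γ (τ ∷ τs)} → t' ≈ t → (t ∷ ts) ≈* us → (t' ∷ ts) ≈* us
≈*-cons e (f ∷ fs) = ≈trans e f ∷ fs

oneOp : (c : Cl one) (u : Sub (Clause.vars (clauseOf c)) Γ) →
  ∃[ o ] opT (headA (subA u (Clause.head (clauseOf c)))) ≡ just o
oneOp oneTau    u = _ , refl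
oneOp oneOut    u = _ , refl
oneOp oneMatch  u = _ , refl
oneOp oneSumˡ   u = _ , refl
oneOp oneSumʳ   u = _ , refl
oneOp oneParˡ   u = _ , refl
oneOp oneParʳ   u = _ , refl
oneOp oneRes    u = _ , refl
oneOp oneCloseˡ u = _ , refl
oneOp oneCloseʳ u = _ , refl
oneOp oneComˡ   u = _ , refl
oneOp oneComʳ   u = _ , refl

onepOp : (c : Cl onep) (u : Sub (Clause.vars (clauseOf c)) Γ) →
  ∃[ o ] opT (headA (subA u (Clause.head (clauseOf c)))) ≡ just o
onepOp onepIn    u = _ , refl
onepOp onepMatch u = _ , refl
onepOp onepSumˡ  u = _ , refl
onepOp onepSumʳ  u = _ , refl
onepOp onepParˡ  u = _ , refl
onepOp onepParʳ  u = _ , refl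
onepOp onepRes   u = _ , refl
onepOp onepOpen  u = _ , refl

-- A communication contributes a further identification `κ'` of its two channels on top of the `κ`
-- found in the components; the continuation is resumed with their composite.
Cont-merged : ∀ L {Ψ : List (LF Σ)} {G : LF Σ} {θ : Fin n → Tm (Σ ⧺ L) nm} {ρ} {P : Proc n} {a p p'} →
  Cont free L Ψ G θ ρ P a p → a ≈ con aτ → p ≈ p' → (δ : Sub Σ Σ') (κ : Fin n → Fin n) →
  (subT (liftS* L δ) ∘ θ) ∘ κ ≈ⁿ subT (liftS* L δ) ∘ θ →
  MergedSteps {θ = subT (liftS* L δ) ∘ θ} (ren (κ ∘ ρ) P) (subT (liftS* L δ) p') → Σ' ⊩ Ψ [ δ ]ᶜ ⊢ subLF δ G
Cont-merged L {ρ = ρ} {P} K e f δ κ c (κ' , c' , s) = resume K δ (κ' ∘ κ) (λ i → ≈trans (c' (κ i)) (c i))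
  (Steps-cong free (λ _ → ≈refl) (≈-subT _ e) (≈-subT _ f)
    (subst (λ R → Steps free _ R _ _) (ren-∘ κ' (κ ∘ ρ) P) s))

match-≡ : {x y : Fin n} {P P' : Proc n} {α : FAct n} → x ≡ y → P —[ α ]→ P' → [ x ≐ y ] P —[ α ]→ P'
match-≡ refl t = match t

match-≡ᵇ : {x y : Fin n} {P : Proc n} {P' : Proc (suc n)} {β : BAct n} →
  x ≡ y → P —[ β ]→ᵇ P' → [ x ≐ y ] P —[ β ]→ᵇ P'
match-≡ᵇ refl t = match t

≈enc-stable : (δ : Sub Γ Δ) {θ : Fin n → Tm Γ nm} {ρ κ : Fin n → Fin n} → θ ∘ ρ ≈ⁿ θ →
  (subT δ ∘ θ) ∘ κ ≈ⁿ subT δ ∘ θ → (Q : Proc n) {q : Tm Γ pr} → q ≈ enc θ Q →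
  subT δ q ≈ enc (subT δ ∘ θ) (ren (κ ∘ ρ) Q)
≈enc-stable δ {ρ = ρ} c cκ Q e = ≈trans (≈enc-subT δ Q e)
  (≈sym (enc-stable (λ i → ≈trans (cκ (ρ i)) (≈-subT δ (c i))) Q))

new-inj : {E : Tm (Γ ▸ nm) pr} {m : Tm Γ (nm ⇒ pr)} → con cν · lam E ≈ νλ (wkT m · v0) → m ≈ lam E
new-inj e = ≈trans ≈η (≈sym (con-inj₁ pr e))

νλ-par-subT : (δ : Sub Γ Δ) (m m' : Tm Γ (nm ⇒ pr)) →
  subT δ (νλ (par (wkT m · v0) (wkT m' · v0))) ≡ νλ (par (wkT (subT δ m) · v0) (wkT (subT δ m') · v0))
νλ-par-subT δ m m' = cong₂ (λ m m' → νλ (par (m · v0) (m' · v0))) (subT-wkT δ m) (subT-wkT δ m')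

analyse  : (P : Proc n) → Analyser free P
analyseᵇ : (P : Proc n) → Analyser bound P

-- The equation between tags discards ill-fitting clauses: for them it equates distinct constructors
-- of `Op`, so only the clauses whose head has the form of `P` remain to be treated.
analyse-clause : ∀ (P : Proc n) L {Ψ : List (LF Σ)} {G : LF Σ} {θ : Fin n → Tm (Σ ⧺ L) nm} (ρ : Fin n → Fin n) →
  θ ∘ ρ ≈ⁿ θ → ∀ {a p} (c : Cl one) (u : Sub (Clause.vars (clauseOf c)) (Σ ⧺ L)) →
  proj₁ (procOp θ P) ≡ proj₁ (oneOp c u) →
  (enc θ P ∷ a ∷ p ∷ []) ≈* subA u (Clause.head (clauseOf c)) →
  Cont free L Ψ G θ ρ P a p → Σ ⊩ (L ▹ subF u (Clause.body (clauseOf c))) ∷ Ψ ⊢ G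

analyse-clauseᵇ : ∀ (P : Proc n) L {Ψ : List (LF Σ)} {G : LF Σ} {θ : Fin n → Tm (Σ ⧺ L) nm} (ρ : Fin n → Fin n) →
  θ ∘ ρ ≈ⁿ θ → ∀ {a p} (c : Cl onep) (u : Sub (Clause.vars (clauseOf c)) (Σ ⧺ L)) →
  proj₁ (procOp θ P) ≡ proj₁ (onepOp c u) →
  (enc θ P ∷ a ∷ p ∷ []) ≈* subA u (Clause.head (clauseOf c)) →
  Cont bound L Ψ G θ ρ P a p → Σ ⊩ (L ▹ subF u (Clause.body (clauseOf c))) ∷ Ψ ⊢ G

analyse P L {Ψ} {G} {θ} ρ c e K = defL' λ cl δ u es →
  let es' = ≈*-cons (≈sym (≈enc-subT (liftS* L δ) P e)) es in
  analyse-clause P L ρ (λ i → ≈-subT (liftS* L δ) (c i)) cl u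
    (op-unique (proj₂ (procOp _ P)) (proj₂ (oneOp cl u)) (headA-≈ es')) es' (Cont-shift free L K δ)

analyseᵇ P L {Ψ} {G} {θ} ρ c e K = defL' λ cl δ u es →
  let es' = ≈*-cons (≈sym (≈enc-subT (liftS* L δ) P e)) es in
  analyse-clauseᵇ P L ρ (λ i → ≈-subT (liftS* L δ) (c i)) cl u
    (op-unique (proj₂ (procOp _ P)) (proj₂ (onepOp cl u)) (headA-≈ es')) es' (Cont-shift bound L K δ)

analyse-clause (τ∙ P) L ρ c oneTau u _ (e ∷ f ∷ g ∷ []) K =
  weak (Cont-now free L K id (λ _ → ≈refl)
    (_ , _ , tau , f , ≈trans g (≈trans (≈sym (con-inj₁ pr e)) (≈sym (enc-stable c P)))))
analyse-clause (out x y P) L ρ c oneOut u _ (e ∷ f ∷ g ∷ []) K with ex , ey , eP ← con-inj₃ pr e =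
  weak (Cont-now free L K id (λ _ → ≈refl)
    (_ , _ , output , ≈trans f (≈app (≈app ≈refl (≈sym (≈trans (c x) ex))) (≈sym (≈trans (c y) ey))) ,
      ≈trans g (≈trans (≈sym eP) (≈sym (enc-stable c P)))))
analyse-clause ([ x ≐ y ] P) L {θ = θ} ρ c oneMatch u _ (e ∷ f ∷ g ∷ []) K
  with ex , ey , eP ← con-inj₃ pr e
  -- The head repeats its variable, so unification identifies `θ x` and `θ y`. The representatives
  -- `ρ x` and `ρ y` are merged, not `x` and `y`, because the transition will be one of the process
  -- already renamed by `ρ`.
  with d ← merge-stable {θ = θ} (ρ x) (ρ y) (≈trans (c x) (≈trans ex (≈trans (≈sym ey) (≈sym (c y))))) =
  analyse P L (merge (ρ x) (ρ y) ∘ ρ) (λ i → ≈trans (d (ρ i)) (c i)) (≈sym eP)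
    (cont λ { δ κ cκ (_ , _ , t , h , h') → resume K δ (κ ∘ merge (ρ x) (ρ y))
      (λ i → ≈trans (cκ (merge (ρ x) (ρ y) i)) (≈-subT (liftS* L δ) (d i)))
      (_ , _ , match-≡ (cong κ (merge-unifies (ρ x) (ρ y))) t ,
        ≈trans (≈-subT _ f) h , ≈trans (≈-subT _ g) h') })
analyse-clause (P ⊕ Q) L ρ c oneSumˡ u _ (e ∷ f ∷ g ∷ []) K with eP , eQ ← con-inj₂ pr e =
  analyse P L ρ c (≈sym eP) (cont λ { δ κ cκ (_ , _ , t , h , h') →
    resume K δ κ cκ (_ , _ , sumˡ t , ≈trans (≈-subT _ f) h , ≈trans (≈-subT _ g) h') })
analyse-clause (P ⊕ Q) L ρ c oneSumʳ u _ (e ∷ f ∷ g ∷ []) K with eP , eQ ← con-inj₂ pr e =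
  analyse Q L ρ c (≈sym eQ) (cont λ { δ κ cκ (_ , _ , t , h , h') →
    resume K δ κ cκ (_ , _ , sumʳ t , ≈trans (≈-subT _ f) h , ≈trans (≈-subT _ g) h') })
analyse-clause (P ∥ Q) L ρ c oneParˡ u _ (e ∷ f ∷ g ∷ []) K with eP , eQ ← con-inj₂ pr e =
  analyse P L ρ c (≈sym eP) (cont λ δ κ cκ s →
    resume K δ κ cκ (Steps-cong free (λ _ → ≈refl) (≈-subT _ f) (≈-subT _ g)
      (parˡ-steps s (≈enc-stable (liftS* L δ) c cκ Q (≈sym eQ)))))
analyse-clause (P ∥ Q) L ρ c oneParʳ u _ (e ∷ f ∷ g ∷ []) K with eP , eQ ← con-inj₂ pr e =
  analyse Q L ρ c (≈sym eQ) (cont λ δ κ cκ s →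
    resume K δ κ cκ (Steps-cong free (λ _ → ≈refl) (≈-subT _ f) (≈-subT _ g)
      (parʳ-steps (≈enc-stable (liftS* L δ) c cκ P (≈sym eP)) s)))
analyse-clause (P ∥ Q) L ρ c oneComˡ u _ (e ∷ f ∷ g ∷ []) K with eP , eQ ← con-inj₂ pr e =
  ∃L-body L oneComˡ u refl λ δ X → ∧L (analyse₂ {k₁ = bound} {free} (analyseᵇ P) (analyse Q) L ρ
    (λ i → ≈-subT (liftS* L δ) (c i)) (≈enc-subT (liftS* L δ) P (≈sym eP)) (≈enc-subT (liftS* L δ) Q (≈sym eQ))
    λ δ' κ cκ s s' → Cont-merged L (Cont-shift free L K δ) (≈-subT _ f) (≈-subT _ g) δ' κ cκ (comʳ-steps s s'))
analyse-clause (P ∥ Q) L ρ c oneComʳ u _ (e ∷ f ∷ g ∷ []) K with eP , eQ ← con-inj₂ pr e =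
  ∃L-body L oneComʳ u refl λ δ X → ∧L (analyse₂ {k₁ = free} {bound} (analyse P) (analyseᵇ Q) L ρ
    (λ i → ≈-subT (liftS* L δ) (c i)) (≈enc-subT (liftS* L δ) P (≈sym eP)) (≈enc-subT (liftS* L δ) Q (≈sym eQ))
    λ δ' κ cκ s s' → Cont-merged L (Cont-shift free L K δ) (≈-subT _ f) (≈-subT _ g) δ' κ cκ (comˡ-steps s s'))
analyse-clause (P ∥ Q) L {θ = θ} ρ c oneCloseˡ u _ (e ∷ f ∷ g ∷ []) K with eP , eQ ← con-inj₂ pr e =
  ∃L-body L oneCloseˡ u refl λ δ X → ∧L (analyse₂ {k₁ = bound} {bound} (analyseᵇ P) (analyseᵇ Q) L ρ
    (λ i → ≈-subT (liftS* L δ) (c i)) (≈enc-subT (liftS* L δ) P (≈sym eP)) (≈enc-subT (liftS* L δ) Q (≈sym eQ))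
    λ δ' κ cκ s s' → Cont-merged L (Cont-shift free L K δ) (≈-subT _ f)
      (≈trans (≈-subT _ g) (≡⇒≈ (νλ-par-subT (liftS* L δ) (u (vs vz)) (u vz)))) δ' κ cκ
      (subst (MergedSteps {θ = subT (liftS* L δ') ∘ subT (liftS* L δ) ∘ θ} _)
        (sym (νλ-par-subT (liftS* L δ') (subT (liftS* L δ) (u (vs vz))) (subT (liftS* L δ) (u vz))))
        (closeʳ-steps s s')))
analyse-clause (P ∥ Q) L {θ = θ} ρ c oneCloseʳ u _ (e ∷ f ∷ g ∷ []) K with eP , eQ ← con-inj₂ pr e =
  ∃L-body L oneCloseʳ u refl λ δ X → ∧L (analyse₂ {k₁ = bound} {bound} (analyseᵇ P) (analyseᵇ Q) L ρ
    (λ i → ≈-subT (liftS* L δ) (c i)) (≈enc-subT (liftS* L δ) P (≈sym eP)) (≈enc-subT (liftS* L δ) Q (≈sym eQ))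
    λ δ' κ cκ s s' → Cont-merged L (Cont-shift free L K δ) (≈-subT _ f)
      (≈trans (≈-subT _ g) (≡⇒≈ (νλ-par-subT (liftS* L δ) (u (vs vz)) (u vz)))) δ' κ cκ
      (subst (MergedSteps {θ = subT (liftS* L δ') ∘ subT (liftS* L δ) ∘ θ} _)
        (sym (νλ-par-subT (liftS* L δ') (subT (liftS* L δ) (u (vs vz))) (subT (liftS* L δ) (u vz))))
        (closeˡ-steps s s')))
analyse-clause (new P) L {θ = θ} ρ c oneRes u _ (e ∷ f ∷ g ∷ []) K =
  -- The restricted name becomes a local variable that no instantiation `δ` of the signature can
  -- reach; this is why `lift-steps` can return an identification `κ'` of the outer names alone.
  ∇L (analyse P (L ▸ nm) (ext ρ) (liftN-stable c) (wk-lam {θ = θ} (new-inj e))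
    (cont λ δ κ cκ s → let κ' , c' , s' = lift-steps (liftS* L δ) θ free ρ κ P cκ s in
      resume K δ κ' c' (Steps-cong free (λ _ → ≈refl) (≈-subT _ f) (≈-subT _ g)
        (res-steps (Steps-cong free (λ _ → ≈refl) (≡⇒≈ (sym (subT-wkT (liftS* L δ) (u (vs vz))))) ≈refl s')))))

analyse-clauseᵇ (inp x P) L ρ c onepIn u _ (e ∷ f ∷ g ∷ []) K with ex , eP ← con-inj₂ pr e =
  weak (Cont-now bound L K id (λ _ → ≈refl)
    (_ , _ , input , ≈trans f (≈app ≈refl (≈sym (≈trans (c x) ex))) ,
      ≈trans g (≈trans (≈sym eP) (≈lam (≈sym (enc-lift-stable c P))))))
analyse-clauseᵇ ([ x ≐ y ] P) L {θ = θ} ρ c onepMatch u _ (e ∷ f ∷ g ∷ []) K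
  with ex , ey , eP ← con-inj₃ pr e
  with d ← merge-stable {θ = θ} (ρ x) (ρ y) (≈trans (c x) (≈trans ex (≈trans (≈sym ey) (≈sym (c y))))) =
  analyseᵇ P L (merge (ρ x) (ρ y) ∘ ρ) (λ i → ≈trans (d (ρ i)) (c i)) (≈sym eP)
    (cont λ { δ κ cκ (_ , _ , t , h , h') → resume K δ (κ ∘ merge (ρ x) (ρ y))
      (λ i → ≈trans (cκ (merge (ρ x) (ρ y) i)) (≈-subT (liftS* L δ) (d i)))
      (_ , _ , match-≡ᵇ (cong κ (merge-unifies (ρ x) (ρ y))) t ,
        ≈trans (≈-subT _ f) h , ≈trans (≈-subT _ g) h') })
analyse-clauseᵇ (P ⊕ Q) L ρ c onepSumˡ u _ (e ∷ f ∷ g ∷ []) K with eP , eQ ← con-inj₂ pr e =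
  analyseᵇ P L ρ c (≈sym eP) (cont λ { δ κ cκ (_ , _ , t , h , h') →
    resume K δ κ cκ (_ , _ , sumˡ t , ≈trans (≈-subT _ f) h , ≈trans (≈-subT _ g) h') })
analyse-clauseᵇ (P ⊕ Q) L ρ c onepSumʳ u _ (e ∷ f ∷ g ∷ []) K with eP , eQ ← con-inj₂ pr e =
  analyseᵇ Q L ρ c (≈sym eQ) (cont λ { δ κ cκ (_ , _ , t , h , h') →
    resume K δ κ cκ (_ , _ , sumʳ t , ≈trans (≈-subT _ f) h , ≈trans (≈-subT _ g) h') })
analyse-clauseᵇ (P ∥ Q) L ρ c onepParˡ u _ (e ∷ f ∷ g ∷ []) K with eP , eQ ← con-inj₂ pr e =
  analyseᵇ P L ρ c (≈sym eP) (cont λ δ κ cκ s →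
    resume K δ κ cκ (Steps-cong bound (λ _ → ≈refl) (≈-subT _ f)
      (≈trans (≈-subT _ g) (≡⇒≈ (cong₂ (λ m q → lam (par (m · v0) q))
        (subT-wkT (liftS* L δ) (u vz)) (subT-wkT (liftS* L δ) (u (vs (vs vz)))))))
      (parˡ-stepsᵇ s (≈enc-stable (liftS* L δ) c cκ Q (≈sym eQ)))))
analyse-clauseᵇ (P ∥ Q) L ρ c onepParʳ u _ (e ∷ f ∷ g ∷ []) K with eP , eQ ← con-inj₂ pr e =
  analyseᵇ Q L ρ c (≈sym eQ) (cont λ δ κ cκ s →
    resume K δ κ cκ (Steps-cong bound (λ _ → ≈refl) (≈-subT _ f)
      (≈trans (≈-subT _ g) (≡⇒≈ (cong₂ (λ q m → lam (par q (m · v0)))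
        (subT-wkT (liftS* L δ) (u (vs (vs (vs vz))))) (subT-wkT (liftS* L δ) (u vz)))))
      (parʳ-stepsᵇ (≈enc-stable (liftS* L δ) c cκ P (≈sym eP)) s)))
analyse-clauseᵇ (new P) L {θ = θ} ρ c onepRes u _ (e ∷ f ∷ g ∷ []) K =
  ∇L (analyseᵇ P (L ▸ nm) (ext ρ) (liftN-stable c) (wk-lam {θ = θ} (new-inj e))
    (cont λ δ κ cκ s → let κ' , c' , s' = lift-steps (liftS* L δ) θ bound ρ κ P cκ s in
      resume K δ κ' c' (Steps-cong bound (λ _ → ≈refl) (≈-subT _ f)
        (≈trans (≈-subT _ g) (≡⇒≈ (cong (λ m → lam (νλ (m · v0 · v1)))
          (trans (subT-wkT (liftS (liftS* L δ)) (wkT (u vz))) (cong wkT (subT-wkT (liftS* L δ) (u vz)))))))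
        (res-stepsᵇ (Steps-cong bound (λ _ → ≈refl) (≡⇒≈ (sym (subT-wkT (liftS* L δ) (u (vs vz)))))
          (≈app (≡⇒≈ (sym (subT-wkT (liftS* L δ) (u vz)))) ≈refl) s')))))
analyse-clauseᵇ (new P) L {θ = θ} ρ c onepOpen u _ (e ∷ f ∷ g ∷ []) K =
  ∇L (analyse P (L ▸ nm) (ext ρ) (liftN-stable c) (wk-lam {θ = θ} (new-inj e))
    (cont λ δ κ cκ s → let κ' , c' , s' = lift-steps (liftS* L δ) θ free ρ κ P cκ s in
      resume K δ κ' c' (Steps-cong bound (λ _ → ≈refl) (≈-subT _ f) (≈-subT _ g)
        (open-steps (Steps-cong free (λ _ → ≈refl)
          (≈app (≈app ≈refl (≡⇒≈ (sym (subT-wkT (liftS* L δ) (u (vs vz)))))) ≈refl)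
          (≈app (≡⇒≈ (sym (subT-wkT (liftS* L δ) (u vz)))) ≈refl) s')))))

-- Open bisimilarity yields lbisim

-- Counts prefixes. Every transition consumes at least one, and renaming changes none, so a residual
-- of `ren κ P` is smaller than `P` itself.
size : Proc n → ℕ
size 𝟘             = 0
size (P ⊕ Q)       = size P + size Q
size (P ∥ Q)       = size P + size Q
size (τ∙ P)        = suc (size P)
size ([ x ≐ y ] P) = size P
size (out x y P)   = suc (size P)
size (inp x P)     = suc (size P)
size (new P)       = size P

size-ren : (ρ : Fin n → Fin m) (P : Proc n) → size (ren ρ P) ≡ size P
size-ren ρ 𝟘             = refl
size-ren ρ (P ⊕ Q)       = cong₂ _+_ (size-ren ρ P) (size-ren ρ Q)
size-ren ρ (P ∥ Q)       = cong₂ _+_ (size-ren ρ P) (size-ren ρ Q)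
size-ren ρ (τ∙ P)        = cong suc (size-ren ρ P)
size-ren ρ ([ x ≐ y ] P) = size-ren ρ P
size-ren ρ (out x y P)   = cong suc (size-ren ρ P)
size-ren ρ (inp x P)     = cong suc (size-ren (ext ρ) P)
size-ren ρ (new P)       = size-ren (ext ρ) P

—→-size : {P P' : Proc n} {α : FAct n} → P —[ α ]→ P' → size P' < size P
—→ᵇ-size : {P : Proc n} {P' : Proc (suc n)} {β : BAct n} → P —[ β ]→ᵇ P' → size P' < size P

—→-size tau       = n<1+n _
—→-size output    = n<1+n _
—→-size (match t) = —→-size t
—→-size (sumˡ t)  = <-≤-trans (—→-size t) (m≤m+n _ _)
—→-size (sumʳ {P = P} t)  = <-≤-trans (—→-size t) (m≤n+m _ (size P))
—→-size (parˡ {Q = Q} t)  = +-monoˡ-< (size Q) (—→-size t)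
—→-size (parʳ {P = P} t)  = +-monoʳ-< (size P) (—→-size t)
—→-size (comˡ {y = y} {Q' = Q'} t s) rewrite size-ren (inst y) Q' = +-mono-< (—→-size t) (—→ᵇ-size s)
—→-size (comʳ {y = y} {P' = P'} t s) rewrite size-ren (inst y) P' = +-mono-< (—→ᵇ-size t) (—→-size s)
—→-size (closeˡ t s) = +-mono-< (—→ᵇ-size t) (—→ᵇ-size s)
—→-size (closeʳ t s) = +-mono-< (—→ᵇ-size t) (—→ᵇ-size s)
—→-size (res t)   = —→-size t

—→ᵇ-size input     = n<1+n _
—→ᵇ-size (match t) = —→ᵇ-size t
—→ᵇ-size (sumˡ t)  = <-≤-trans (—→ᵇ-size t) (m≤m+n _ _)
—→ᵇ-size (sumʳ {P = P} t)  = <-≤-trans (—→ᵇ-size t) (m≤n+m _ (size P))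
—→ᵇ-size (parˡ {Q = Q} t) rewrite size-ren suc Q = +-monoˡ-< (size Q) (—→ᵇ-size t)
—→ᵇ-size (parʳ {P = P} t) rewrite size-ren suc P = +-monoʳ-< (size P) (—→ᵇ-size t)
—→ᵇ-size (res {P' = P'} t) rewrite size-ren swap P' = —→ᵇ-size t
—→ᵇ-size (open' t) = —→-size t

-- Distinctions and their refutation from hypotheses

respects? : (κ : Fin n → Fin m) (D : Dist n) →
  Respects κ D ⊎ (∃[ x ] ∃[ y ] (x , y) ∈ D × κ x ≡ κ y)
respects? κ [] = inj₁ λ ()
respects? κ ((x , y) ∷ D) with κ x ≟ κ y | respects? κ D
... | yes e | _ = inj₂ (x , y , here refl , e)
... | no ¬e | inj₁ r = inj₁ λ { (here refl) → ¬e ; (there i) → r i }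
... | no ¬e | inj₂ (x' , y' , i , e) = inj₂ (x' , y' , there i , e)

open IsDistinction

image-distinction : {D : Dist n} (κ : Fin n → Fin m) → IsDistinction D → Respects κ D → IsDistinction (D [ κ ]ᴰ)
image-distinction κ d r .symmetric i with _ , j , refl ← ∈-map⁻ (pairMap κ) i = ∈-map⁺ (pairMap κ) (symmetric d j)
image-distinction κ d r .irreflexive i with _ , j , e ← ∈-map⁻ (pairMap κ) i =
  r j (trans (sym (cong proj₁ e)) (cong proj₂ e))

suc-distinction : {D : Dist n} → IsDistinction D → IsDistinction (D [ suc ]ᴰ)
suc-distinction {D = D} d = image-distinction suc d λ i e →
  irreflexive d (subst (λ z → (_ , z) ∈ D) (sym (suc-injective e)) i)

freshPairs : List (Fin n) → Dist (suc n)
freshPairs = concatMap (λ u → (zero , suc u) ∷ (suc u , zero) ∷ [])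

∈-freshPairs : (us : List (Fin n)) {x y : Fin (suc n)} → (x , y) ∈ freshPairs us →
  (y , x) ∈ freshPairs us × ∃[ u ] ((x ≡ zero × y ≡ suc u) ⊎ (x ≡ suc u × y ≡ zero))
∈-freshPairs (u ∷ us) (here refl)         = there (here refl) , u , inj₁ (refl , refl)
∈-freshPairs (u ∷ us) (there (here refl)) = here refl , u , inj₂ (refl , refl)
∈-freshPairs (u ∷ us) (there (there i)) with j , r ← ∈-freshPairs us i = there (there j) , r

boutDist-distinction : {D : Dist n} (P Q : Proc n) → IsDistinction D → IsDistinction (boutDist D P Q)
boutDist-distinction {D = D} P Q d .symmetric i with ∈-++⁻ (D [ suc ]ᴰ) i
... | inj₁ j = ∈-++⁺ˡ (symmetric (suc-distinction d) j)
... | inj₂ j = ∈-++⁺ʳ (D [ suc ]ᴰ) (proj₁ (∈-freshPairs (fn P ++ fn Q ++ namesᴰ D) j))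
boutDist-distinction {D = D} P Q d .irreflexive i with ∈-++⁻ (D [ suc ]ᴰ) i
... | inj₁ j = irreflexive (suc-distinction d) j
... | inj₂ j with proj₂ (∈-freshPairs (fn P ++ fn Q ++ namesᴰ D) j)
... | u , inj₁ (refl , ())
... | u , inj₂ (refl , ())

-- What the hypotheses must know about `D`. It replaces the formula for `D` as invariant, because
-- the pairs added by a bound output never become formulas. All `δ` are covered since later case
-- analyses instantiate the hypotheses.
record Refutes {n : ℕ} {Σ : Ctx} (L : Ctx) (Ψ : List (LF Σ)) (θ : Fin n → Tm (Σ ⧺ L) nm) (D : Dist n) : Set₁ where
  constructor refutes
  field
    refute : ∀ {x y} → (x , y) ∈ D → ∀ {Σ'} (δ : Sub Σ Σ') →
      subT (liftS* L δ) (θ x) ≈ subT (liftS* L δ) (θ y) → (G : LF Σ') → Σ' ⊩ Ψ [ δ ]ᶜ ⊢ G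
open Refutes

module _ {n : ℕ} {Σ : Ctx} (L : Ctx) {Ψ : List (LF Σ)} {θ : Fin n → Tm (Σ ⧺ L) nm} {D : Dist n}
  (r : Refutes L Ψ θ D) where

  refutes-subT : (δ : Sub Σ Σ') → Refutes L (Ψ [ δ ]ᶜ) (subT (liftS* L δ) ∘ θ) D
  refutes-subT δ .refute {x} {y} i δ' e G = subst (λ Φ → _ ⊩ Φ ⊢ G) (sym ([]ᶜ-⨟ δ δ' Ψ))
    (refute r i (δ ⨟ δ') (≈trans (≡⇒≈ (sym (subT*-⨟ L δ δ' (θ x)))) (≈trans e (≡⇒≈ (subT*-⨟ L δ δ' (θ y))))) G)

  refutes-image : (f : Fin n → Fin m) {θ' : Fin m → Tm (Σ ⧺ L) nm} → θ' ∘ f ≈ⁿ θ → Refutes L Ψ θ' (D [ f ]ᴰ)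
  refutes-image f c .refute i δ e G with (x , y) , j , refl ← ∈-map⁻ (pairMap f) i =
    refute r j δ (≈trans (≈sym (≈-subT _ (c x))) (≈trans e (≈-subT _ (c y)))) G

  -- Old pairs are refuted as before, after removing the weakening. A pair with the new name is
  -- impossible outright: that name is a local variable, untouched by `δ` and convertible to no
  -- weakened term.
  refutes-lift : (P Q : Proc n) → Refutes (L ▸ nm) Ψ (liftN θ) (boutDist D P Q)
  refutes-lift P Q .refute i δ e G with ∈-++⁻ (D [ suc ]ᴰ) i
  ... | inj₁ j with (x , y) , k , refl ← ∈-map⁻ (pairMap suc) j =
    refute r k δ (wk-inj (subT (liftS* L δ) (θ x))
      (≈trans (≡⇒≈ (sym (subT-wkT (liftS* L δ) (θ x)))) (≈trans e (≡⇒≈ (subT-wkT (liftS* L δ) (θ y)))))) G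
  ... | inj₂ j with proj₂ (∈-freshPairs (fn P ++ fn Q ++ namesᴰ D) j)
  ... | u , inj₁ (refl , refl) = ⊥-elim (wk≉v0 (≈sym (≈trans e (≡⇒≈ (subT-wkT (liftS* L δ) (θ u))))))
  ... | u , inj₂ (refl , refl) = ⊥-elim (wk≉v0 (≈trans (≡⇒≈ (sym (subT-wkT (liftS* L δ) (θ u)))) e))

  -- If `κ` merges a pair of `D`, then `θ`, which does not distinguish `κ x` from `x`, already
  -- identifies that pair, and the hypotheses are contradictory. Otherwise the bisimulation clauses
  -- apply to `κ`.
  by-respect : {κ : Fin n → Fin n} {G : LF Σ} → θ ∘ κ ≈ⁿ θ → (Respects κ D → Σ ⊩ Ψ ⊢ G) → Σ ⊩ Ψ ⊢ G
  by-respect {κ} {G} c h with respects? κ D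
  ... | inj₁ resp = h resp
  ... | inj₂ (x , y , i , e) = subst (λ Φ → _ ⊩ Φ ⊢ G) ([]ᶜ-id Ψ) (refute r i var
    (≈trans (≡⇒≈ (subT*-id L (θ x))) (≈trans (≈sym (c x)) (≈trans (≡⇒≈ (cong θ e))
      (≈trans (c y) (≡⇒≈ (sym (subT*-id L (θ y)))))))) G)

⊢-subLF : ∀ L {Ψ : List (LF Σ')} (s : Sub X (Σ ⧺ L)) (δ : Sub Σ Σ') (B : Fm X) →
  Σ' ⊩ Ψ ⊢ L ▹ subF (s ⨟ liftS* L δ) B → Σ' ⊩ Ψ ⊢ subLF δ (L ▹ subF s B)
⊢-subLF L s δ B = subst (λ F → _ ⊩ _ ⊢ L ▹ F) (sym (subF-subF s (liftS* L δ) B))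

-- This and the following formulas are the parts of `halfBisim v1 v0`, named because the closure
-- rules act on formulas before substitution.
freeReply : Fm (ε ▸ pr ▸ pr ▸ ac ▸ pr ▸ pr)
freeReply = oneA v3 v2 v0 ∧̇ lbisimA v1 v0

boundNext : Fm (ε ▸ pr ▸ pr ▸ nm ▸ (nm ⇒ pr) ▸ (nm ⇒ pr) ▸ nm)
boundNext = lbisimA (v2 · v0) (v1 · v0)

inReply boutReply : Fm (ε ▸ pr ▸ pr ▸ nm ▸ (nm ⇒ pr) ▸ (nm ⇒ pr))
inReply   = onepA v3 (con a↓ · v2) v0 ∧̇ ∀̇ nm boundNext
boutReply = onepA v3 (con a↑ · v2) v0 ∧̇ ∇̇ nm boundNext

freeMove : Fm (ε ▸ pr ▸ pr ▸ ac ▸ pr)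
freeMove = oneA v3 v1 v0 ⊃̇ ∃̇ pr freeReply

inMove boutMove : Fm (ε ▸ pr ▸ pr ▸ nm ▸ (nm ⇒ pr))
inMove   = onepA v3 (con a↓ · v1) v0 ⊃̇ ∃̇ (nm ⇒ pr) inReply
boutMove = onepA v3 (con a↑ · v1) v0 ⊃̇ ∃̇ (nm ⇒ pr) boutReply

≈enc-app : (δ : Sub Γ Δ) {θ : Fin n → Tm Γ nm} {m : Tm Γ (nm ⇒ pr)} (P : Proc (suc n)) {w : Tm Δ nm} →
  m ≈ lam (enc (liftN θ) P) → subT δ m · w ≈ enc ((subT δ ∘ θ) ,ⁿ w) P
≈enc-app δ {θ} P {w} e = ≈trans
  (≈app (≈trans (≈-subT δ e) (≈lam (≈trans (enc-subT (liftS δ) (liftN θ) P) (enc-cong (liftN-subT δ θ) P)))) ≈refl)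
  (enc-inst (subT δ ∘ θ) w P)

module _ {S : Family} (bis : IsOpenBisim S) where
  open IsOpenBisim bis

  -- The bound `k` covers both processes, since the two halves of the game exchange their roles. The
  -- local context `L` is arbitrary because each bound output extends it by one variable.
  bisim⊢ : ∀ k L {Ψ : List (LF Σ)} {θ : Fin n → Tm (Σ ⧺ L) nm} {D} (P Q : Proc n) {p q} →
    IsDistinction D → S n D P Q → size P < k → size Q < k → Refutes L Ψ θ D →
    p ≈ enc θ P → q ≈ enc θ Q → Σ ⊩ Ψ ⊢ L ▹ lbisimA p q

  half⊢ : ∀ k L {Ψ : List (LF Σ)} {θ : Fin n → Tm (Σ ⧺ L) nm} {D} (P Q : Proc n) {p q} →
    IsDistinction D → S n D P Q → size P ≤ k → size Q ≤ k → Refutes L Ψ θ D →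
    p ≈ enc θ P → q ≈ enc θ Q → Σ ⊩ Ψ ⊢ L ▹ subF (εˢ ,ˢ p ,ˢ q) (halfBisim v1 v0)

  bisim⊢ (suc k) L P Q {p} {q} d s (s≤s a) (s≤s b) r e f =
    defR lbisimDef (εˢ ,ˢ p ,ˢ q) (≈refl ∷ ≈refl ∷ [])
      -- Exchanging `p` and `q` in the substitution and exchanging `v1` and `v0` in `halfBisim`
      -- compute to the same formula, so one lemma serves both conjuncts.
      (∧R (half⊢ k L P Q d s a b r e f) (half⊢ k L Q P d (symm d s) b a r f e))

  half⊢ {Σ} {n} k L {Ψ} {θ} {D} P Q {p} {q} d s a b r e f = ∧R freeCase (∧R inCase boutCase)
    where
    smaller : ∀ κ (R : Proc n) {m} → size R ≤ k → m < size (ren κ R) → m < k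
    smaller κ R l t = <-≤-trans t (≤-trans (≤-reflexive (size-ren κ R)) l)

    -- `δ₁` and `δ₂` come from the quantifiers over the action (or channel) and the residual, `δ₃`
    -- from the case analysis of the hypothetical transition.
    module Stage {Σ₁ Σ₂ Σ₃} (δ₁ : Sub Σ Σ₁) (δ₂ : Sub Σ₁ Σ₂) (δ₃ : Sub Σ₂ Σ₃) where
      θ₂ : Fin n → Tm (Σ₂ ⧺ L) nm
      θ₂ = subT (liftS* L δ₂) ∘ subT (liftS* L δ₁) ∘ θ
      θ₃ : Fin n → Tm (Σ₃ ⧺ L) nm
      θ₃ = subT (liftS* L δ₃) ∘ θ₂
      r₃ : Refutes L (((Ψ [ δ₁ ]ᶜ) [ δ₂ ]ᶜ) [ δ₃ ]ᶜ) θ₃ D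
      r₃ = refutes-subT L (refutes-subT L (refutes-subT L r δ₁) δ₂) δ₃
      q≈ : ∀ {κ} → θ₃ ∘ κ ≈ⁿ θ₃ →
        subT (liftS* L δ₃) (subT (liftS* L δ₂) (subT (liftS* L δ₁) q)) ≈ enc θ₃ (ren κ Q)
      q≈ c = ≈trans (≈enc-subT (liftS* L δ₃) Q (≈enc-subT (liftS* L δ₂) Q (≈enc-subT (liftS* L δ₁) Q f)))
        (≈sym (enc-stable c Q))

    p₂≈ : ∀ {Σ₁ Σ₂} (δ₁ : Sub Σ Σ₁) (δ₂ : Sub Σ₁ Σ₂) →
      subT (liftS* L δ₂) (subT (liftS* L δ₁) p) ≈ enc (subT (liftS* L δ₂) ∘ subT (liftS* L δ₁) ∘ θ) P
    p₂≈ δ₁ δ₂ = ≈enc-subT (liftS* L δ₂) P (≈enc-subT (liftS* L δ₁) P e)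

    s₀ : Sub (ε ▸ pr ▸ pr) (Σ ⧺ L)
    s₀ = εˢ ,ˢ p ,ˢ q

    freeCase : Σ ⊩ Ψ ⊢ L ▹ subF s₀ (∀̇ ac (∀̇ pr freeMove))
    freeCase = ∀R' s₀ (∀̇ pr freeMove) λ δ₁ A →
      ∀R' (s₀ ⨟ liftS* L δ₁ ,ˢ A) freeMove λ δ₂ P₁ →
      ⊃R (analyse P L id (λ _ → ≈refl) (p₂≈ δ₁ δ₂) (cont λ { δ₃ κ c (α , P' , t , h , h') →
        let open Stage δ₁ δ₂ δ₃
            s₂ = (s₀ ⨟ liftS* L δ₁ ,ˢ A) ⨟ liftS* L δ₂ ,ˢ P₁ in
        ⊢-subLF L s₂ δ₃ (∃̇ pr freeReply) (by-respect L r₃ c λ resp →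
          let Q' , t' , s' = freeStep d s κ resp t in
          ∃R' (s₂ ⨟ liftS* L δ₃) freeReply (enc θ₃ Q') (∧R
            (—→⇒⊢ L θ₃ t' (q≈ c) h ≈refl)
            (bisim⊢ k L P' Q' (image-distinction κ d resp) s'
              (smaller κ P a (—→-size t)) (smaller κ Q b (—→-size t'))
              (refutes-image L r₃ κ {θ₃} c) h' ≈refl))) }))

    inCase : Σ ⊩ Ψ ⊢ L ▹ subF s₀ (∀̇ nm (∀̇ (nm ⇒ pr) inMove))
    inCase = ∀R' s₀ (∀̇ (nm ⇒ pr) inMove) λ δ₁ A →
      ∀R' (s₀ ⨟ liftS* L δ₁ ,ˢ A) inMove λ δ₂ P₁ →
      ⊃R (analyseᵇ P L id (λ _ → ≈refl) (p₂≈ δ₁ δ₂) (cont λ { δ₃ κ c (β , P' , t , h , h') →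
        let open Stage δ₁ δ₂ δ₃
            s₂ = (s₀ ⨟ liftS* L δ₁ ,ˢ A) ⨟ liftS* L δ₂ ,ˢ P₁
            x , β≡ , _ = input-act {θ = θ₃} β h
            t = subst (λ β → ren κ P —[ β ]→ᵇ P') β≡ t in
        ⊢-subLF L s₂ δ₃ (∃̇ (nm ⇒ pr) inReply) (by-respect L r₃ c λ resp →
          let Q' , t' , s' = inStep d s κ resp t
              M = lam (enc (liftN θ₃) Q')
              s₃ = s₂ ⨟ liftS* L δ₃ ,ˢ M in
          ∃R' (s₂ ⨟ liftS* L δ₃) inReply M (∧R
            (—→ᵇ⇒⊢ L θ₃ t' (q≈ c) (subst (λ β → _ ≈ encB θ₃ β) β≡ h) ≈refl)
            -- The received `w` is an arbitrary term and may coincide with a known name. Accordingly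
            -- the distinction is only shifted by `suc`, and nothing about index zero has to be
            -- refuted.
            (∀R' s₃ boundNext λ δ₄ w →
              bisim⊢ k L P' Q' (suc-distinction (image-distinction κ d resp)) s'
              (smaller κ P a (—→ᵇ-size t)) (smaller κ Q b (—→ᵇ-size t'))
              (refutes-image L (refutes-subT L (refutes-image L r₃ κ {θ₃} c) δ₄) suc (λ _ → ≈refl))
              (≈enc-app (liftS* L δ₄) P' h') (≈enc-app (liftS* L δ₄) Q' ≈refl)))) }))

    boutCase : Σ ⊩ Ψ ⊢ L ▹ subF s₀ (∀̇ nm (∀̇ (nm ⇒ pr) boutMove))
    boutCase = ∀R' s₀ (∀̇ (nm ⇒ pr) boutMove) λ δ₁ A →
      ∀R' (s₀ ⨟ liftS* L δ₁ ,ˢ A) boutMove λ δ₂ P₁ →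
      ⊃R (analyseᵇ P L id (λ _ → ≈refl) (p₂≈ δ₁ δ₂) (cont λ { δ₃ κ c (β , P' , t , h , h') →
        let open Stage δ₁ δ₂ δ₃
            s₂ = (s₀ ⨟ liftS* L δ₁ ,ˢ A) ⨟ liftS* L δ₂ ,ˢ P₁
            x , β≡ , _ = bout-act {θ = θ₃} β h
            t = subst (λ β → ren κ P —[ β ]→ᵇ P') β≡ t in
        ⊢-subLF L s₂ δ₃ (∃̇ (nm ⇒ pr) boutReply) (by-respect L r₃ c λ resp →
          let Q' , t' , s' = boutStep d s κ resp t
              M = lam (enc (liftN θ₃) Q') in
          ∃R' (s₂ ⨟ liftS* L δ₃) boutReply M (∧R
            (—→ᵇ⇒⊢ L θ₃ t' (q≈ c) (subst (λ β → _ ≈ encB θ₃ β) β≡ h) ≈refl)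
            (∇R (bisim⊢ k (L ▸ nm) P' Q'
              (boutDist-distinction (ren κ P) (ren κ Q) (image-distinction κ d resp)) s'
              (smaller κ P a (—→ᵇ-size t)) (smaller κ Q b (—→ᵇ-size t'))
              (refutes-lift L (refutes-image L r₃ κ {θ₃} c) (ren κ P) (ren κ Q))
              (wk-lam {θ = θ₃} h') (β-wk _))))) }))

-- The pair occurs as a conjunct `s ≠̇ t`; as its two sides have become convertible, `eqRefl` proves
-- the equation and the conjunct yields `⊥̇`.
⟦⟧ᴰ-refutes : (D : Dist n) {x y : Fin n} → (x , y) ∈ D → (δ : Sub (names n) Σ) →
  subT δ (nameVar x) ≈ subT δ (nameVar y) → (G : LF Σ) → Σ ⊩ (ε ▹ subF δ ⟦ D ⟧ᴰ) ∷ [] ⊢ G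
⟦⟧ᴰ-refutes (_ ∷ []) {x} (here refl) δ e G =
  ⊃L (defR eqRefl (εˢ ,ˢ subT δ (nameVar x)) (≈refl ∷ e ∷ []) ⊤R) ⊥L
⟦⟧ᴰ-refutes (_ ∷ _ ∷ D) {x} (here refl) δ e G =
  ∧L₁ (⊃L (defR eqRefl (εˢ ,ˢ subT δ (nameVar x)) (≈refl ∷ e ∷ []) ⊤R) ⊥L)
⟦⟧ᴰ-refutes (_ ∷ p ∷ D) (there i) δ e G = ∧L₂ (⟦⟧ᴰ-refutes (p ∷ D) i δ e G)

-- With an empty local context raising is trivial, so the eigenvariables of `∀R` are the names
-- themselves and the substitution in its premise is the identity.
∀names-intro : ∀ n {B : Fm (names n)} → names n ⊩ [] ⊢ ε ▹ B → Provable (∀names n B)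
∀names-intro zero    d = d
∀names-intro (suc n) {B} d = ∀names-intro n (∀R (subst (λ F → _ ⊩ [] ⊢ ε ▹ F)
  (sym (subF-id (λ { vz → refl ; (vs v) → refl }) B)) d))

theorem5p11 : (n : ℕ) (P Q : Proc n) (D : Dist n) → IsDistinction D →
    CoveredBy P Q D → OpenBisimilar D P Q →
    Provable (∀names n (⟦ D ⟧ᴰ ⊃̇ lbisimA ⟦ P ⟧ ⟦ Q ⟧))
theorem5p11 n P Q D d _ (S , bis , s) = ∀names-intro n (⊃R
  -- The sum of the sizes is a common bound for both processes, and `suc` makes it strict.
  (bisim⊢ bis (suc (size P + size Q)) ε P Q d s (s≤s (m≤m+n _ _)) (s≤s (m≤n+m _ _))
    (refutes λ i → ⟦⟧ᴰ-refutes D i) (⟦⟧≈enc P) (⟦⟧≈enc Q)))
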